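{- Let $k$ be an integer, and let $G$ be a graph of order $n$. (1) If $\delta(G)\geq k\geq 0$, $n\geq 2k+2$ and $\rho(\overline{G})\leq \rho(\overline{\underline{L}_n^k})$, then $G$ is traceable unless $G=\underline{L}_n^k$, or $n=2k+2$ and $G\in \mathcal{H}_n$. (2) If $\delta(G)\geq k\geq 1$, $n\geq 2k+1$ and $\rho(\overline{G})\leq\rho(\overline{L^k_n})$, then $G$ is Hamiltonian unless $G=L_n^k$, or $n=2k+1$ and $G\in\mathcal{H}_n$.
   Context: All graphs are finite and simple; equality of graphs and membership in classes of graphs are up to isomorphism. $\overline{G}$ is the complement of $G$, $\delta(G)$ the minimum degree, and $\rho(G)$ the spectral radius, i.e. the largest eigenvalue of the adjacency matrix. A graph is Hamiltonian (traceable) if it contains a cycle (path) through all its vertices. $G_1+G_2$ denotes the disjoint union of graphs, $kG$ the disjoint union of $k$ copies of $G$, and $G_1\vee G_2$ the join (the disjoint union together with all edges between $V(G_1)$ and $V(G_2)$). For $1\leq k\leq (n-1)/2$, $L_n^k=K_1\vee(K_k+K_{n-k-1})$. For $0\leq k\leq n/2-1$, $\underline{L}_n^k=K_{k+1}+K_{n-k-1}$. The class $\mathcal{H}_n$ consists of the graphs $G$ of order $n$ with $$K_{\lceil n/2\rceil-1,\lfloor n/2\rfloor+1}\subseteq G\subseteq K_{\lceil n/2\rceil-1}\vee(\lfloor n/2\rfloor+1)K_1,$$ where $\subseteq$ denotes the (spanning) subgraph relation and $K_{a,b}$ is the complete bipartite graph with parts of sizes $a,b$ ($K_{0,b}$ being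 edgeless on $b$ vertices). -}

module Defs where

open import Data.Bool.Base using (Bool; true; false; not; _∧_; if_then_else_; T)
open import Data.Bool.Properties using (∧-zeroʳ)
open import Data.Fin.Base using (Fin; splitAt)
open import Data.Fin.Permutation using (Permutation; _⟨$⟩ʳ_)
open import Data.Fin.Properties using (_≟_)
open import Data.Fin.Subset using (Subset; ∣_∣)
open import Data.List.Base using (List; []; _∷_; _++_; [_]; map; allFin; length)
open import Data.List.Extrema.Nat using (min)
open import Data.List.Membership.Propositional using (_∈_)
open import Data.List.Relation.Unary.Linked using (Linked)
open import Data.List.Relation.Unary.Unique.Propositional using (Unique)
open import Data.Nat.Base as ℕ using (ℕ; zero; suc; ⌊_/2⌋; ⌈_/2⌉)
import Data.Nat.Properties as ℕ
open import Data.Product.Base using (Σ; ∃-syntax; _×_; _,_)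
open import Data.Rational.Base as ℚ using (ℚ; 0ℚ; 1ℚ)
import Data.Rational.Properties as ℚ
open import Data.Rational.Solver using (module +-*-Solver)
open import Data.Sum.Base using (_⊎_; inj₁; inj₂)
import Data.Vec.Base as Vec
open import Data.Vec.Functional using (Vector; foldr)
open import Relation.Binary.PropositionalEquality
  using (_≡_; refl; sym; cong; cong₂; subst)
open import Relation.Nullary using (¬_)
open import Relation.Nullary.Decidable using (⌊_⌋; yes; no)
open import Relation.Nullary.Negation using (contradiction)

-- Real numbers: Cauchy sequences of rationals, compared by the setoid
-- equality _≈_.  Arithmetic is pointwise.

IsCauchy : (ℕ → ℚ) → Set
IsCauchy x = ∀ ε → 0ℚ ℚ.< ε →
  ∃[ N ] (∀ m n → N ℕ.≤ m → N ℕ.≤ n → ℚ.∣ x m ℚ.- x n ∣ ℚ.< ε)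

record ℝ : Set where
  constructor mkℝ
  field
    seq    : ℕ → ℚ
    cauchy : IsCauchy seq

open ℝ public

infix 4 _≈_ _≤ᴿ_

_≈_ : ℝ → ℝ → Set
x ≈ y = ∀ ε → 0ℚ ℚ.< ε →
  ∃[ N ] (∀ n → N ℕ.≤ n → ℚ.∣ seq x n ℚ.- seq y n ∣ ℚ.< ε)

-- The slack ε makes this the non-strict order of the limits (a pointwise
-- comparison of terms would not respect _≈_).
_≤ᴿ_ : ℝ → ℝ → Set
x ≤ᴿ y = ∀ ε → 0ℚ ℚ.< ε →
  ∃[ N ] (∀ n → N ℕ.≤ n → seq x n ℚ.< seq y n ℚ.+ ε)

private
  open +-*-Solver using (solve; _:=_; _:+_; _:*_; :-_; _:-_; con)

  scaled : ∀ ε → 0ℚ ℚ.< ε → ∀ p → 0ℚ ℚ.< p →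
           ∃[ δ ] (0ℚ ℚ.< δ × p ℚ.* δ ≡ ε)
  scaled ε 0<ε p 0<p = 1/p ℚ.* ε , 0<δ , eq
    where
    instance
      p-pos : ℚ.Positive p
      p-pos = ℚ.positive 0<p
      p-nz : ℚ.NonZero p
      p-nz = ℚ.pos⇒nonZero p
    1/p : ℚ
    1/p = ℚ.1/ p
    instance
      1/p-pos : ℚ.Positive 1/p
      1/p-pos = ℚ.1/pos⇒pos p
    0<δ : 0ℚ ℚ.< 1/p ℚ.* ε
    0<δ = subst (ℚ._< 1/p ℚ.* ε) (ℚ.*-zeroʳ 1/p) (ℚ.*-monoʳ-<-pos 1/p 0<ε)
    open ℚ.≤-Reasoning
    eq : p ℚ.* (1/p ℚ.* ε) ≡ ε
    eq = begin-equality
      p ℚ.* (1/p ℚ.* ε)  ≡⟨ sym (ℚ.*-assoc p 1/p ε) ⟩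
      p ℚ.* 1/p ℚ.* ε    ≡⟨ cong (ℚ._* ε) (ℚ.*-inverseʳ p) ⟩
      1ℚ ℚ.* ε           ≡⟨ ℚ.*-identityˡ ε ⟩
      ε                  ∎

  halve : ∀ ε → 0ℚ ℚ.< ε → ∃[ δ ] (0ℚ ℚ.< δ × δ ℚ.+ δ ≡ ε)
  halve ε 0<ε with scaled ε 0<ε (1ℚ ℚ.+ 1ℚ) (ℚ.positive⁻¹ (1ℚ ℚ.+ 1ℚ))
  ... | δ , 0<δ , eq = δ , 0<δ , (begin-equality
      δ ℚ.+ δ               ≡⟨ cong₂ ℚ._+_ (sym (ℚ.*-identityˡ δ)) (sym (ℚ.*-identityˡ δ)) ⟩
      1ℚ ℚ.* δ ℚ.+ 1ℚ ℚ.* δ ≡⟨ sym (ℚ.*-distribʳ-+ δ 1ℚ 1ℚ) ⟩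
      (1ℚ ℚ.+ 1ℚ) ℚ.* δ     ≡⟨ eq ⟩
      ε                     ∎)
    where open ℚ.≤-Reasoning

  bounded : ∀ {x} → IsCauchy x →
            ∃[ B ] (0ℚ ℚ.< B × ∃[ N ] (∀ n → N ℕ.≤ n → ℚ.∣ x n ∣ ℚ.≤ B))
  bounded {x} cx with cx 1ℚ (ℚ.positive⁻¹ 1ℚ)
  ... | N , near = 1ℚ ℚ.+ ℚ.∣ x N ∣ , 0<B , N , bound
    where
    open ℚ.≤-Reasoning
    0<B : 0ℚ ℚ.< 1ℚ ℚ.+ ℚ.∣ x N ∣
    0<B = ℚ.+-mono-<-≤ (ℚ.positive⁻¹ 1ℚ) (ℚ.0≤∣p∣ (x N))
    bound : ∀ n → N ℕ.≤ n → ℚ.∣ x n ∣ ℚ.≤ 1ℚ ℚ.+ ℚ.∣ x N ∣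
    bound n N≤n = begin
      ℚ.∣ x n ∣
        ≡⟨ cong ℚ.∣_∣ (solve 2 (λ a b → a := (a :- b) :+ b) refl (x n) (x N)) ⟩
      ℚ.∣ (x n ℚ.- x N) ℚ.+ x N ∣
        ≤⟨ ℚ.∣p+q∣≤∣p∣+∣q∣ (x n ℚ.- x N) (x N) ⟩
      ℚ.∣ x n ℚ.- x N ∣ ℚ.+ ℚ.∣ x N ∣
        ≤⟨ ℚ.+-monoˡ-≤ ℚ.∣ x N ∣ (ℚ.<⇒≤ (near n N N≤n ℕ.≤-refl)) ⟩
      1ℚ ℚ.+ ℚ.∣ x N ∣ ∎

  abstract
    const-cauchy : ∀ q → IsCauchy (λ _ → q)
    const-cauchy q ε 0<ε = 0 , λ _ _ _ _ →
      subst (ℚ._< ε) (sym (cong ℚ.∣_∣ (ℚ.+-inverseʳ q))) 0<ε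

  abstract
    +-cauchy : ∀ {x y} → IsCauchy x → IsCauchy y → IsCauchy (λ n → x n ℚ.+ y n)
    +-cauchy {x} {y} cx cy ε 0<ε with halve ε 0<ε
    ... | δ , 0<δ , 2δ≡ε with cx δ 0<δ | cy δ 0<δ
    ... | M , nearx | N , neary = M ℕ.⊔ N , near
      where
      open ℚ.≤-Reasoning
      near : ∀ m n → M ℕ.⊔ N ℕ.≤ m → M ℕ.⊔ N ℕ.≤ n →
             ℚ.∣ (x m ℚ.+ y m) ℚ.- (x n ℚ.+ y n) ∣ ℚ.< ε
      near m n ≤m ≤n = begin-strict
        ℚ.∣ (x m ℚ.+ y m) ℚ.- (x n ℚ.+ y n) ∣
          ≡⟨ cong ℚ.∣_∣ (solve 4 (λ a b c d → (a :+ b) :- (c :+ d) := (a :- c) :+ (b :- d))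
                           refl (x m) (y m) (x n) (y n)) ⟩
        ℚ.∣ (x m ℚ.- x n) ℚ.+ (y m ℚ.- y n) ∣
          ≤⟨ ℚ.∣p+q∣≤∣p∣+∣q∣ (x m ℚ.- x n) (y m ℚ.- y n) ⟩
        ℚ.∣ x m ℚ.- x n ∣ ℚ.+ ℚ.∣ y m ℚ.- y n ∣
          <⟨ ℚ.+-mono-< (nearx m n (ℕ.m⊔n≤o⇒m≤o M N ≤m) (ℕ.m⊔n≤o⇒m≤o M N ≤n))
                        (neary m n (ℕ.m⊔n≤o⇒n≤o M N ≤m) (ℕ.m⊔n≤o⇒n≤o M N ≤n)) ⟩
        δ ℚ.+ δ
          ≡⟨ 2δ≡ε ⟩
        ε ∎

  ∣∣-mono-* : ∀ p q {B δ} → 0ℚ ℚ.< B → ℚ.∣ p ∣ ℚ.≤ B → ℚ.∣ q ∣ ℚ.< δ →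
              ℚ.∣ p ℚ.* q ∣ ℚ.< B ℚ.* δ
  ∣∣-mono-* p q {B} {δ} 0<B p≤B q<δ = begin-strict
      ℚ.∣ p ℚ.* q ∣          ≡⟨ ℚ.∣p*q∣≡∣p∣*∣q∣ p q ⟩
      ℚ.∣ p ∣ ℚ.* ℚ.∣ q ∣    ≤⟨ ℚ.*-monoʳ-≤-nonNeg ℚ.∣ q ∣ {{ℚ.∣-∣-nonNeg q}} p≤B ⟩
      B ℚ.* ℚ.∣ q ∣          <⟨ ℚ.*-monoʳ-<-pos B {{ℚ.positive 0<B}} q<δ ⟩
      B ℚ.* δ                ∎
    where open ℚ.≤-Reasoning

  *-near : ∀ a b c d {B C δ} → 0ℚ ℚ.< B → 0ℚ ℚ.< C →
           ℚ.∣ a ∣ ℚ.≤ B → ℚ.∣ d ∣ ℚ.≤ C →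
           ℚ.∣ a ℚ.- c ∣ ℚ.< δ → ℚ.∣ b ℚ.- d ∣ ℚ.< δ →
           ℚ.∣ a ℚ.* b ℚ.- c ℚ.* d ∣ ℚ.< (B ℚ.+ C) ℚ.* δ
  *-near a b c d {B} {C} {δ} 0<B 0<C a≤B d≤C a~c b~d = begin-strict
    ℚ.∣ a ℚ.* b ℚ.- c ℚ.* d ∣
      ≡⟨ cong ℚ.∣_∣ (regroup a b c d) ⟩
    ℚ.∣ a ℚ.* (b ℚ.- d) ℚ.+ d ℚ.* (a ℚ.- c) ∣
      ≤⟨ ℚ.∣p+q∣≤∣p∣+∣q∣ (a ℚ.* (b ℚ.- d)) (d ℚ.* (a ℚ.- c)) ⟩
    ℚ.∣ a ℚ.* (b ℚ.- d) ∣ ℚ.+ ℚ.∣ d ℚ.* (a ℚ.- c) ∣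
      <⟨ ℚ.+-mono-< (∣∣-mono-* a (b ℚ.- d) 0<B a≤B b~d)
                    (∣∣-mono-* d (a ℚ.- c) 0<C d≤C a~c) ⟩
    B ℚ.* δ ℚ.+ C ℚ.* δ
      ≡⟨ sym (ℚ.*-distribʳ-+ δ B C) ⟩
    (B ℚ.+ C) ℚ.* δ ∎
    where
    open ℚ.≤-Reasoning
    regroup : ∀ a b c d →
              a ℚ.* b ℚ.- c ℚ.* d ≡ a ℚ.* (b ℚ.- d) ℚ.+ d ℚ.* (a ℚ.- c)
    regroup = solve 4 (λ a b c d → a :* b :- c :* d := a :* (b :- d) :+ d :* (a :- c)) refl

  abstract
    *-cauchy : ∀ {x y} → IsCauchy x → IsCauchy y → IsCauchy (λ n → x n ℚ.* y n)
    *-cauchy {x} {y} cx cy ε 0<ε =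
      let B , 0<B , M₁ , x≤B = bounded cx
          C , 0<C , N₁ , y≤C = bounded cy
          δ , 0<δ , eq       = scaled ε 0<ε (B ℚ.+ C) (ℚ.+-mono-< 0<B 0<C)
          M₂ , nearx         = cx δ 0<δ
          N₂ , neary         = cy δ 0<δ
          M = M₁ ℕ.⊔ M₂
          N = N₁ ℕ.⊔ N₂
      in M ℕ.⊔ N , λ m n ≤m ≤n →
        let M≤m = ℕ.m⊔n≤o⇒m≤o M N ≤m
            N≤m = ℕ.m⊔n≤o⇒n≤o M N ≤m
            M≤n = ℕ.m⊔n≤o⇒m≤o M N ≤n
            N≤n = ℕ.m⊔n≤o⇒n≤o M N ≤n
        in subst (ℚ.∣ x m ℚ.* y m ℚ.- x n ℚ.* y n ∣ ℚ.<_) eq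
             (*-near (x m) (y m) (x n) (y n) 0<B 0<C
               (x≤B m (ℕ.m⊔n≤o⇒m≤o M₁ M₂ M≤m))
               (y≤C n (ℕ.m⊔n≤o⇒m≤o N₁ N₂ N≤n))
               (nearx m n (ℕ.m⊔n≤o⇒n≤o M₁ M₂ M≤m) (ℕ.m⊔n≤o⇒n≤o M₁ M₂ M≤n))
               (neary m n (ℕ.m⊔n≤o⇒n≤o N₁ N₂ N≤m) (ℕ.m⊔n≤o⇒n≤o N₁ N₂ N≤n)))

fromℚ : ℚ → ℝ
fromℚ q = mkℝ (λ _ → q) (const-cauchy q)

0ℝ 1ℝ : ℝ
0ℝ = fromℚ 0ℚ
1ℝ = fromℚ 1ℚ

infixl 6 _+ᴿ_
infixl 7 _*ᴿ_

_+ᴿ_ : ℝ → ℝ → ℝ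
x +ᴿ y = mkℝ (λ n → seq x n ℚ.+ seq y n) (+-cauchy {seq x} {seq y} (cauchy x) (cauchy y))

_*ᴿ_ : ℝ → ℝ → ℝ
x *ᴿ y = mkℝ (λ n → seq x n ℚ.* seq y n) (*-cauchy {seq x} {seq y} (cauchy x) (cauchy y))

Matrix : ℕ → Set
Matrix n = Fin n → Fin n → ℝ

_·ᵥ_ : ∀ {n} → Matrix n → Vector ℝ n → Vector ℝ n
(A ·ᵥ v) i = foldr _+ᴿ_ 0ℝ (λ j → A i j *ᴿ v j)

IsEigenvalue : ∀ {n} → Matrix n → ℝ → Set
IsEigenvalue {n} A μ =
  Σ (Vector ℝ n) λ v →
    ¬ (∀ i → v i ≈ 0ℝ) × (∀ i → (A ·ᵥ v) i ≈ μ *ᴿ v i)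

IsLargestEigenvalue : ∀ {n} → Matrix n → ℝ → Set
IsLargestEigenvalue A r = IsEigenvalue A r × (∀ μ → IsEigenvalue A μ → μ ≤ᴿ r)

record Graph (n : ℕ) : Set where
  field
    adj       : Fin n → Fin n → Bool
    symmetric : ∀ i j → adj i j ≡ adj j i
    loopless  : ∀ i → adj i i ≡ false

open Graph public

Adj : ∀ {n} → Graph n → Fin n → Fin n → Set
Adj G i j = T (adj G i j)

infix 4 _≅_ _⊑_

_≅_ : ∀ {m n} → Graph m → Graph n → Set
_≅_ {m} {n} G H =
  Σ (Permutation m n) λ π → ∀ i j → adj G i j ≡ adj H (π ⟨$⟩ʳ i) (π ⟨$⟩ʳ j)

-- Spanning subgraph, up to isomorphism (so in effect m ≡ n).
_⊑_ : ∀ {m n} → Graph m → Graph n → Set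
_⊑_ {m} {n} G H =
  Σ (Permutation m n) λ π → ∀ i j → Adj G i j → Adj H (π ⟨$⟩ʳ i) (π ⟨$⟩ʳ j)

neighbours : ∀ {n} → Graph n → Fin n → Subset n
neighbours G i = Vec.tabulate (adj G i)

degree : ∀ {n} → Graph n → Fin n → ℕ
degree G i = ∣ neighbours G i ∣

-- Every degree is below n, so the default n is never the minimum unless
-- there are no vertices.
δ : ∀ {n} → Graph n → ℕ
δ {n} G = min n (map (degree G) (allFin n))

adjacencyMatrix : ∀ {n} → Graph n → Matrix n
adjacencyMatrix G i j = if adj G i j then 1ℝ else 0ℝ

-- IsSpectralRadius G r says ρ(G) = r.  All eigenvalues are real because
-- the matrix is symmetric.  It is a relation because ρ of the graph on no
-- vertices is undefined.
IsSpectralRadius : ∀ {n} → Graph n → ℝ → Set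
IsSpectralRadius G = IsLargestEigenvalue (adjacencyMatrix G)

Traceable : ∀ {n} → Graph n → Set
Traceable {n} G =
  Σ (List (Fin n)) λ p → Unique p × Linked (Adj G) p × (∀ v → v ∈ p)

-- The cycle v₁ v₂ … vₗ v₁ with l ≥ 3 is given as v₁ ∷ [v₂, …, vₗ].
Hamiltonian : ∀ {n} → Graph n → Set
Hamiltonian {n} G =
  Σ (Fin n) λ v₁ → Σ (List (Fin n)) λ vs →
    3 ℕ.≤ length (v₁ ∷ vs) ×
    Unique (v₁ ∷ vs) ×
    Linked (Adj G) (v₁ ∷ vs ++ [ v₁ ]) ×
    (∀ v → v ∈ v₁ ∷ vs)

private
  ≟-sym : ∀ {n} (i j : Fin n) → ⌊ i ≟ j ⌋ ≡ ⌊ j ≟ i ⌋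
  ≟-sym i j with i ≟ j | j ≟ i
  ... | yes _ | yes _ = refl
  ... | no  _ | no  _ = refl
  ... | yes p | no ¬q = contradiction (sym p) ¬q
  ... | no ¬p | yes q = contradiction (sym q) ¬p

  ≟-refl : ∀ {n} (i : Fin n) → ⌊ i ≟ i ⌋ ≡ true
  ≟-refl i with i ≟ i
  ... | yes _ = refl
  ... | no ¬p = contradiction refl ¬p

complement : ∀ {n} → Graph n → Graph n
complement G = record
  { adj       = λ i j → not (adj G i j) ∧ not ⌊ i ≟ j ⌋
  ; symmetric = λ i j → cong₂ (λ a b → not a ∧ not b) (symmetric G i j) (≟-sym i j)
  ; loopless  = λ i → subst (λ b → not (adj G i i) ∧ not b ≡ false)
                            (sym (≟-refl i)) (∧-zeroʳ (not (adj G i i)))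
  }

K : ∀ n → Graph n
K n = record
  { adj       = λ i j → not ⌊ i ≟ j ⌋
  ; symmetric = λ i j → cong not (≟-sym i j)
  ; loopless  = λ i → cong not (≟-refl i)
  }

-- Disjoint copies of G and H, with every cross pair adjacent iff c.
glueAdj : ∀ {m n} → Bool → Graph m → Graph n →
          Fin m ⊎ Fin n → Fin m ⊎ Fin n → Bool
glueAdj c G H (inj₁ i) (inj₁ j) = adj G i j
glueAdj c G H (inj₂ i) (inj₂ j) = adj H i j
glueAdj c G H (inj₁ _) (inj₂ _) = c
glueAdj c G H (inj₂ _) (inj₁ _) = c

glue : ∀ {m n} → Bool → Graph m → Graph n → Graph (m ℕ.+ n)
glue {m} {n} c G H = record
  { adj       = λ i j → glueAdj c G H (splitAt m i) (splitAt m j)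
  ; symmetric = λ i j → sym′ (splitAt m i) (splitAt m j)
  ; loopless  = λ i → irr (splitAt m i)
  }
  where
  sym′ : ∀ u v → glueAdj c G H u v ≡ glueAdj c G H v u
  sym′ (inj₁ i) (inj₁ j) = symmetric G i j
  sym′ (inj₂ i) (inj₂ j) = symmetric H i j
  sym′ (inj₁ _) (inj₂ _) = refl
  sym′ (inj₂ _) (inj₁ _) = refl
  irr : ∀ u → glueAdj c G H u u ≡ false
  irr (inj₁ i) = loopless G i
  irr (inj₂ i) = loopless H i

infixl 6 _+ᴳ_
infixl 7 _∨ᴳ_
infixr 8 _·ᴳ_

_+ᴳ_ : ∀ {m n} → Graph m → Graph n → Graph (m ℕ.+ n)
_+ᴳ_ = glue false

_∨ᴳ_ : ∀ {m n} → Graph m → Graph n → Graph (m ℕ.+ n)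
_∨ᴳ_ = glue true

-- The disjoint union of k copies of G.
_·ᴳ_ : ∀ {n} k → Graph n → Graph (k ℕ.* n)
zero  ·ᴳ G = K 0
suc k ·ᴳ G = G +ᴳ k ·ᴳ G

-- The complete bipartite graph with parts of sizes a and b.
Kᵇ : ∀ a b → Graph (a ℕ.* 1 ℕ.+ b ℕ.* 1)
Kᵇ a b = (a ·ᴳ K 1) ∨ᴳ (b ·ᴳ K 1)

-- L n k and Lᵤ n k (the underlined L) have order n as soon as k + 1 ≤ n.
L : ∀ n k → Graph (1 ℕ.+ (k ℕ.+ (n ℕ.∸ k ℕ.∸ 1)))
L n k = K 1 ∨ᴳ (K k +ᴳ K (n ℕ.∸ k ℕ.∸ 1))

Lᵤ : ∀ n k → Graph ((k ℕ.+ 1) ℕ.+ (n ℕ.∸ k ℕ.∸ 1))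
Lᵤ n k = K (k ℕ.+ 1) +ᴳ K (n ℕ.∸ k ℕ.∸ 1)

𝓗 : ∀ {n} → Graph n → Set
𝓗 {n} G =
  Kᵇ (⌈ n /2⌉ ℕ.∸ 1) (⌊ n /2⌋ ℕ.+ 1) ⊑ G ×
  G ⊑ K (⌈ n /2⌉ ℕ.∸ 1) ∨ᴳ ((⌊ n /2⌋ ℕ.+ 1) ·ᴳ K 1)

module Submission where

-- Adding edges uv with d(u) + d(v) ≥ n to G does not affect whether G is Hamiltonian; let H
-- be the resulting closure.  If H is not complete, then with c = k (n - k - 1) every edge uv
-- of the complement H̄ has d(u) d(v) ≥ c in H̄.  With W the set of non-isolated vertices of H̄,
-- it follows that from every vertex of W at least c walks of length two in Ḡ end in W.  Hence
-- ρ(Ḡ)² ≥ c, while ρ(L̄)² ≤ c, so the number of these walks is exactly c.  This forces Ḡ = H̄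
-- on W and d(u) d(v) = c on edges, and for k < n - k - 1 the only possibility is
-- H̄ = K_{k,n-k-1} + K₁, that is, G = L.  For n = 2k + 1 the degree condition alone suffices:
-- a Hamilton path either closes up, or splits G into two cliques sharing a vertex, or yields
-- a cycle missing one vertex w, whose neighbours must then alternate along the cycle.
-- Traceability is Hamiltonicity of the cone K₁ ∨ G.
--
-- That the largest eigenvalue bounds Rayleigh quotients needs an eigenvalue to exist: it is
-- found by bisection, positive semidefiniteness of t I - A being decidable for rational t,
-- and its eigenvector comes from elimination on a real matrix, where the case distinctions
-- hold only up to double negation.

import Algebra.Properties.Semiring.Sum as SemiringSum
import Data.Fin.Subset
import Data.Integer.Base as ℤ
import Data.Integer.Properties as ℤ
import Data.List.Relation.Binary.Permutation.Setoid.Properties as Permutationₛ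
import Data.List.Relation.Unary.All as All
import Data.List.Relation.Unary.Any as Any
import Data.Nat.Properties as ℕ
import Data.Nat.Tactic.RingSolver as ℕ
import Data.Rational.Properties as ℚ
import Data.Rational.Unnormalised.Properties as ℚᵘ
import Data.Vec.Base as Vec
open import Algebra.Bundles using (CommutativeRing)
open import Data.Bool.Base using (Bool; true; false; not; _∧_; _∨_; if_then_else_; T)
open import Data.Bool.Properties using (T?; ∨-comm; ∧-comm) renaming (_≟_ to _≟ᵇ_)
open import Data.Empty using (⊥; ⊥-elim)
open import Data.Fin.Base using (Fin; zero; suc; punchIn; splitAt; _↑ˡ_; _↑ʳ_)
open import Data.Fin.Permutation using (Permutation; _⟨$⟩ʳ_; _⟨$⟩ˡ_; insert; inverseˡ) renaming (id to idₚ)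
open import Data.Fin.Properties using (_≟_; any?; suc-injective; splitAt-↑ˡ; splitAt-↑ʳ; splitAt⁻¹-↑ˡ; splitAt⁻¹-↑ʳ)
open import Data.List.Base using (List; []; _∷_; _++_; [_]; reverse; length; allFin; map; tabulate)
open import Data.List.Extrema.Nat using (min; min≤v⁺)
open import Data.List.Membership.Propositional using (_∈_)
open import Data.List.Membership.Propositional.Properties using (∈-++⁺ˡ; ∈-++⁺ʳ; ∈-++⁻; ∈-allFin; ∈-map⁺)
open import Data.List.Properties using (unfold-reverse; length-tabulate; length-++; map-tabulate; map-injective; ++-assoc)
open import Data.List.Relation.Binary.Permutation.Propositional using (_↭_; ↭-refl; ↭-sym; ↭-trans; ↭⇒↭ₛ; prep; swap; ↭-reflexive)
open import Data.List.Relation.Binary.Permutation.Propositional.Properties using (∈-resp-↭; ↭-length; ++-comm; ↭-reverse; ++⁺ˡ; ++⁺ʳ; ++⁺; drop-∷; ↭-map-inv)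
open import Data.List.Relation.Unary.All using (All; []; _∷_)
open import Data.List.Relation.Unary.AllPairs using ([]; _∷_)
open import Data.List.Relation.Unary.Any using (here; there)
open import Data.List.Relation.Unary.Linked using (Linked; []; [-]; _∷_)
open import Data.List.Relation.Unary.Unique.Propositional using (Unique)
open import Data.List.Relation.Unary.Unique.Propositional.Properties using (allFin⁺)
open import Data.Maybe.Base using (Maybe; just; nothing)
open import Data.Nat.Base as ℕ using (ℕ; zero; suc)
open import Data.Product.Base using (Σ; ∃; ∃-syntax; _×_; _,_; proj₁; proj₂)
open import Data.Rational.Base as ℚ using (ℚ; 0ℚ; 1ℚ; ½; mkℚ; toℚᵘ)
open import Data.Rational.Unnormalised.Base as ℚᵘ using (mkℚᵘ)
open import Data.Sum.Base using (_⊎_; inj₁; inj₂; [_,_]′)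
open import Data.Unit.Base using (tt)
open import Data.Vec.Functional using (Vector; foldr)
open import Defs using (ℝ; mkℝ; seq; cauchy; IsCauchy; _≈_; _≤ᴿ_; _+ᴿ_; _*ᴿ_; 0ℝ; 1ℝ; fromℚ; Matrix; IsEigenvalue; IsLargestEigenvalue; Graph; adj; symmetric; adjacencyMatrix; IsSpectralRadius)
open import Function.Base using (_∘_; id; const)
open import Level using (0ℓ)
open import Relation.Binary.Definitions using (tri<; tri≈; tri>; DecidableEquality)
open import Relation.Binary.PropositionalEquality using (_≡_; _≢_; refl; sym; trans; cong; cong₂; subst; subst₂; setoid; module ≡-Reasoning)
open import Relation.Nullary using (¬_; Dec; yes; no; contradiction)
open import Relation.Nullary.Decidable using (⌊_⌋; _×-dec_; ¬?)
open import Tactic.RingSolver using (solve-∀)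
open import Tactic.RingSolver.Core.AlmostCommutativeRing using (AlmostCommutativeRing; fromCommutativeRing)

-- With A the adjacency matrix of Ḡ, the spectral hypothesis bounds Rayleigh quotients of A only
-- from above, while A² also feels negative eigenvalues of large modulus. The passage from A to A²
-- therefore goes through nonnegative vectors: for x the indicator of W and t slightly above the
-- root of c, the quotient at A x + t x gives x ∙ A² x ≤ c (x ∙ x). As the root of c is irrational
-- in general, bounds are stated for all rational t with c < t², and t is then moved towards the
-- root.
--
-- The constant: put m = n - k - 1. The minimum degree bounds degrees in H̄ by m, and closedness of
-- H gives d(u) + d(v) ≥ k + m on edges of H̄; within these limits the product d(u) d(v) is least
-- for the degrees k and m. Summing d(u) d(v) ≥ c over the neighbours v of u gives d(u) c, and
-- division by d(u) gives the walks.
--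
-- The double negation around the eigenvector is harmless, because all that is derived from it is
-- one inequality between rationals, which is decidable.

private
  variable
    n : ℕ

ℚ-ring : AlmostCommutativeRing 0ℓ 0ℓ
ℚ-ring = fromCommutativeRing ℚ.+-*-commutativeRing 0≟
  where
  0≟ : ∀ x → Maybe (0ℚ ≡ x)
  0≟ x with 0ℚ ℚ.≟ x
  ... | yes p = just p
  ... | no _  = nothing

module ∑ℚ = SemiringSum (CommutativeRing.semiring ℚ.+-*-commutativeRing)

module ∑ℕ = SemiringSum ℕ.+-*-semiring

⟦_⟧ : Bool → ℕ
⟦ true ⟧  = 1
⟦ false ⟧ = 0

count : (Fin n → Bool) → ℕ
count f = ∑ℕ.sum (λ i → ⟦ f i ⟧)

Relation : ℕ → Set
Relation n = Fin n → Fin n → Bool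

twoWalks : Relation n → (Fin n → Bool) → Fin n → ℕ
twoWalks D w u = ∑ℕ.sum (λ v → ⟦ D u v ⟧ ℕ.* ∑ℕ.sum (λ x → ⟦ D v x ⟧ ℕ.* ⟦ w x ⟧))

-- What the comparison of spectral radii is used for: no set W of vertices
-- from each of which at least c walks of length two end in W has a vertex
-- with more than c such walks.
Tight : Relation n → ℕ → Set
Tight D c = ∀ w → (∀ u → T (w u) → c ℕ.≤ twoWalks D w u) → ∀ u → T (w u) → twoWalks D w u ≡ c

∑-mono : ∀ {f g : Vector ℕ n} → (∀ i → f i ℕ.≤ g i) → ∑ℕ.sum f ℕ.≤ ∑ℕ.sum g
∑-mono {zero}  h = ℕ.z≤n
∑-mono {suc n} h = ℕ.+-mono-≤ (h zero) (∑-mono (h ∘ suc))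

∑-const : ∀ n c → ∑ℕ.sum {n} (λ _ → c) ≡ n ℕ.* c
∑-const zero    c = refl
∑-const (suc n) c = cong (c ℕ.+_) (∑-const n c)

⟦⟧≤1 : ∀ b → ⟦ b ⟧ ℕ.≤ 1
⟦⟧≤1 true  = ℕ.≤-refl
⟦⟧≤1 false = ℕ.z≤n

count≤n : ∀ (f : Fin n → Bool) → count f ℕ.≤ n
count≤n {n} f = ℕ.≤-trans (∑-mono (λ i → ⟦⟧≤1 (f i)))
  (ℕ.≤-reflexive (trans (∑-const n 1) (ℕ.*-identityʳ n)))

module _ where
  open import Data.Rational.Base using (_+_; _*_; _-_; -_; _≤_; _<_; ∣_∣)

  private
    variable
      k : ℕ
      p q r : ℚ

  -- Rational linear algebra

  <⇒≱ : p < q → ¬ q ≤ p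
  <⇒≱ p<q q≤p = ℚ.<-irrefl refl (ℚ.<-≤-trans p<q q≤p)

  diff⇒≤ : 0ℚ ≤ q - p → p ≤ q
  diff⇒≤ {q} {p} h = subst₂ _≤_ (ℚ.+-identityˡ p) (e q p) (ℚ.+-monoˡ-≤ p h)
    where
    e : ∀ q p → (q - p) + p ≡ q
    e = solve-∀ ℚ-ring

  ≤-by : r ≡ q - p → 0ℚ ≤ r → p ≤ q
  ≤-by e h = diff⇒≤ (subst (0ℚ ≤_) e h)

  0≤diff : p ≤ q → 0ℚ ≤ q - p
  0≤diff {p} {q} h = subst (_≤ q - p) (ℚ.+-inverseʳ p) (ℚ.+-monoˡ-≤ (- p) h)

  0<diff : p < q → 0ℚ < q - p
  0<diff {p} {q} h = subst (_< q - p) (ℚ.+-inverseʳ p) (ℚ.+-monoˡ-< (- p) h)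

  diff⇒< : 0ℚ < q - p → p < q
  diff⇒< {q} {p} h = subst₂ _<_ (ℚ.+-identityˡ p) (e q p) (ℚ.+-monoˡ-< p h)
    where
    e : ∀ q p → (q - p) + p ≡ q
    e = solve-∀ ℚ-ring

  +-nonneg : 0ℚ ≤ p → 0ℚ ≤ q → 0ℚ ≤ p + q
  +-nonneg = ℚ.+-mono-≤

  *-nonneg : 0ℚ ≤ p → 0ℚ ≤ q → 0ℚ ≤ p * q
  *-nonneg {p} {q} 0≤p 0≤q = subst (_≤ p * q) (ℚ.*-zeroʳ p)
    (ℚ.*-monoˡ-≤-nonNeg p {{ℚ.nonNegative 0≤p}} 0≤q)

  *-pos : 0ℚ < p → 0ℚ < q → 0ℚ < p * q
  *-pos {p} {q} 0<p 0<q = subst (_< p * q) (ℚ.*-zeroʳ p)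
    (ℚ.*-monoʳ-<-pos p {{ℚ.positive 0<p}} 0<q)

  square-nonneg : ∀ p → 0ℚ ≤ p * p
  square-nonneg p with ℚ.≤-total 0ℚ p
  ... | inj₁ 0≤p = *-nonneg 0≤p 0≤p
  ... | inj₂ p≤0 = subst (0ℚ ≤_) (e p) (*-nonneg 0≤-p 0≤-p)
    where
    0≤-p : 0ℚ ≤ - p
    0≤-p = ℚ.neg-antimono-≤ p≤0
    e : ∀ p → - p * - p ≡ p * p
    e = solve-∀ ℚ-ring

  *-cancelˡ-nonneg : 0ℚ < p → 0ℚ ≤ p * q → 0ℚ ≤ q
  *-cancelˡ-nonneg {p} {q} 0<p h = ℚ.*-cancelˡ-≤-pos p {{ℚ.positive 0<p}}
    (subst (_≤ p * q) (sym (ℚ.*-zeroʳ p)) h)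

  *-monoˡ-≤ : 0ℚ ≤ r → p ≤ q → r * p ≤ r * q
  *-monoˡ-≤ {r} 0≤r = ℚ.*-monoˡ-≤-nonNeg r {{ℚ.nonNegative 0≤r}}

  *-nonpos : 0ℚ ≤ p → q ≤ 0ℚ → p * q ≤ 0ℚ
  *-nonpos {p} {q} 0≤p q≤0 = subst (p * q ≤_) (ℚ.*-zeroʳ p) (*-monoˡ-≤ 0≤p q≤0)

  sum-cong : ∀ {f g : Vector ℚ n} → (∀ i → f i ≡ g i) → ∑ℚ.sum f ≡ ∑ℚ.sum g
  sum-cong = ∑ℚ.sum-cong-≋

  sum-zero : ∀ {f : Vector ℚ n} → (∀ i → f i ≡ 0ℚ) → ∑ℚ.sum f ≡ 0ℚ
  sum-zero {n} h = trans (sum-cong h) (∑ℚ.sum-replicate-zero n)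

  sum-mono : ∀ {f g : Vector ℚ n} → (∀ i → f i ≤ g i) → ∑ℚ.sum f ≤ ∑ℚ.sum g
  sum-mono {zero}  h = ℚ.≤-refl
  sum-mono {suc n} h = ℚ.+-mono-≤ (h zero) (sum-mono (h ∘ suc))

  sum-nonneg : ∀ {f : Vector ℚ n} → (∀ i → 0ℚ ≤ f i) → 0ℚ ≤ ∑ℚ.sum f
  sum-nonneg {zero}  h = ℚ.≤-refl
  sum-nonneg {suc n} h = +-nonneg (h zero) (sum-nonneg (h ∘ suc))

  term≤sum : ∀ {f : Vector ℚ n} → (∀ i → 0ℚ ≤ f i) → ∀ i → f i ≤ ∑ℚ.sum f
  term≤sum {suc n} {f} h zero = subst (_≤ ∑ℚ.sum f) (ℚ.+-identityʳ (f zero))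
    (ℚ.+-monoʳ-≤ (f zero) (sum-nonneg (h ∘ suc)))
  term≤sum {suc n} {f} h (suc i) = subst (_≤ ∑ℚ.sum f) (ℚ.+-identityˡ (f (suc i)))
    (ℚ.+-mono-≤ (h zero) (term≤sum (h ∘ suc) i))

  sum-linear : ∀ c (f g : Vector ℚ n) →
               ∑ℚ.sum (λ i → f i + c * g i) ≡ ∑ℚ.sum f + c * ∑ℚ.sum g
  sum-linear c f g = trans (∑ℚ.∑-distrib-+ f (λ i → c * g i))
    (cong (∑ℚ.sum f +_) (sym (∑ℚ.*-distribˡ-sum c g)))

  infix 7 _∙_
  infix 8 _⊛_

  _∙_ : Vector ℚ n → Vector ℚ n → ℚ
  x ∙ y = ∑ℚ.sum (λ i → x i * y i)

  Mat : ℕ → Set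
  Mat n = Fin n → Fin n → ℚ

  _⊛_ : Mat n → Vector ℚ n → Vector ℚ n
  (A ⊛ x) i = ∑ℚ.sum (λ j → A i j * x j)

  Symmetric : Mat n → Set
  Symmetric A = ∀ i j → A i j ≡ A j i

  _+[_]_ : Vector ℚ n → ℚ → Vector ℚ n → Vector ℚ n
  (x +[ c ] y) i = x i + c * y i

  ∙-cong : ∀ {x x′ y y′ : Vector ℚ n} → (∀ i → x i ≡ x′ i) → (∀ i → y i ≡ y′ i) → x ∙ y ≡ x′ ∙ y′
  ∙-cong h k = sum-cong (λ i → cong₂ _*_ (h i) (k i))

  ∙-comm : ∀ (x y : Vector ℚ n) → x ∙ y ≡ y ∙ x
  ∙-comm x y = sum-cong (λ i → ℚ.*-comm (x i) (y i))

  ∙-linearˡ : ∀ (x : Vector ℚ n) c y z → (x +[ c ] y) ∙ z ≡ x ∙ z + c * (y ∙ z)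
  ∙-linearˡ x c y z = trans (sum-cong (λ i → e (x i) c (y i) (z i)))
    (sum-linear c (λ i → x i * z i) (λ i → y i * z i))
    where
    e : ∀ a c b d → (a + c * b) * d ≡ a * d + c * (b * d)
    e = solve-∀ ℚ-ring

  ∙-linearʳ : ∀ (x : Vector ℚ n) c y z → z ∙ (x +[ c ] y) ≡ z ∙ x + c * (z ∙ y)
  ∙-linearʳ x c y z = trans (∙-comm z (x +[ c ] y)) (trans (∙-linearˡ x c y z)
    (cong₂ (λ a b → a + c * b) (∙-comm x z) (∙-comm y z)))

  ∙-nonneg : ∀ {x y : Vector ℚ n} → (∀ i → 0ℚ ≤ x i) → (∀ i → 0ℚ ≤ y i) → 0ℚ ≤ x ∙ y
  ∙-nonneg h k = sum-nonneg (λ i → *-nonneg (h i) (k i))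

  norm-nonneg : ∀ (x : Vector ℚ n) → 0ℚ ≤ x ∙ x
  norm-nonneg x = sum-nonneg (λ i → square-nonneg (x i))

  ⊛-linear : ∀ (A : Mat n) x c y i → (A ⊛ (x +[ c ] y)) i ≡ ((A ⊛ x) +[ c ] (A ⊛ y)) i
  ⊛-linear A x c y i = ∙-linearʳ x c y (A i)

  ⊛-nonneg : ∀ {A : Mat n} {x} → (∀ i j → 0ℚ ≤ A i j) → (∀ i → 0ℚ ≤ x i) → ∀ i → 0ℚ ≤ (A ⊛ x) i
  ⊛-nonneg h k i = ∙-nonneg (h i) k

  adjoint : ∀ (A : Mat n) → Symmetric A → ∀ x y → x ∙ (A ⊛ y) ≡ (A ⊛ x) ∙ y
  adjoint {n} A A-sym x y = begin
    ∑ℚ.sum (λ i → x i * ∑ℚ.sum (λ j → A i j * y j))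
      ≡⟨ sum-cong (λ i → ∑ℚ.*-distribˡ-sum (x i) (λ j → A i j * y j)) ⟩
    ∑ℚ.sum (λ i → ∑ℚ.sum (λ j → x i * (A i j * y j)))
      ≡⟨ ∑ℚ.∑-comm (λ i j → x i * (A i j * y j)) ⟩
    ∑ℚ.sum (λ j → ∑ℚ.sum (λ i → x i * (A i j * y j)))
      ≡⟨ sum-cong (λ j → sum-cong (λ i →
           trans (e (x i) (A i j) (y j)) (cong (λ a → a * x i * y j) (A-sym i j)))) ⟩
    ∑ℚ.sum (λ j → ∑ℚ.sum (λ i → A j i * x i * y j))
      ≡⟨ sum-cong (λ j → sym (∑ℚ.*-distribʳ-sum (y j) (λ i → A j i * x i))) ⟩
    ∑ℚ.sum (λ j → ∑ℚ.sum (λ i → A j i * x i) * y j) ∎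
    where
    open ≡-Reasoning
    e : ∀ a b c → a * (b * c) ≡ b * a * c
    e = solve-∀ ℚ-ring

  NonZero : Vector ℚ n → Set
  NonZero y = ∃[ i ] y i ≢ 0ℚ

  square-pos : p ≢ 0ℚ → 0ℚ < p * p
  square-pos {p} p≢0 with ℚ.<-cmp 0ℚ p
  ... | tri< 0<p _ _ = *-pos 0<p 0<p
  ... | tri≈ _ 0≡p _ = contradiction (sym 0≡p) p≢0
  ... | tri> _ _ p<0 = subst (0ℚ <_) (e p) (*-pos (ℚ.neg-antimono-< p<0) (ℚ.neg-antimono-< p<0))
    where
    e : ∀ p → - p * - p ≡ p * p
    e = solve-∀ ℚ-ring

  norm-pos : ∀ {x : Vector ℚ n} → NonZero x → 0ℚ < x ∙ x
  norm-pos {x = x} (i , xi≢0) = ℚ.<-≤-trans (square-pos xi≢0) (term≤sum (λ j → square-nonneg (x j)) i)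

  -- Quadratic forms, Schur complements and semidefiniteness

  row : Mat (suc n) → Vector ℚ n
  row M j = M zero (suc j)

  minor : Mat (suc n) → Mat n
  minor M i j = M (suc i) (suc j)

  -- Reads only the entries on and above the diagonal.
  form : Mat n → Vector ℚ n → ℚ
  form {zero}  M y = 0ℚ
  form {suc n} M y = M zero zero * (y zero * y zero)
    + (y zero * (row M ∙ (y ∘ suc)) + y zero * (row M ∙ (y ∘ suc)))
    + form (minor M) (y ∘ suc)

  form-cong : ∀ {M M′ : Mat n} {y y′} → (∀ i j → M i j ≡ M′ i j) → (∀ i → y i ≡ y′ i) →
              form M y ≡ form M′ y′
  form-cong {zero}  h k = refl
  form-cong {suc n} h k = cong₂ _+_
    (cong₂ _+_ (cong₂ (λ a b → a * (b * b)) (h zero zero) (k zero))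
      (cong₂ (λ a b → a * b + a * b) (k zero) (∙-cong (λ j → h zero (suc j)) (k ∘ suc))))
    (form-cong (λ i j → h (suc i) (suc j)) (k ∘ suc))

  form≡∙⊛ : ∀ (M : Mat n) → Symmetric M → ∀ y → form M y ≡ y ∙ (M ⊛ y)
  form≡∙⊛ {zero}  M M-sym y = refl
  form≡∙⊛ {suc n} M M-sym y = sym (begin
    y₀ * (M zero zero * y₀ + β) + ∑ℚ.sum (λ i → y (suc i) * (M (suc i) zero * y₀ + (minor M ⊛ y′) i))
      ≡⟨ cong (y₀ * (M zero zero * y₀ + β) +_) (trans
           (sum-cong (λ i → trans (cong (λ a → y (suc i) * (a * y₀ + (minor M ⊛ y′) i)) (M-sym (suc i) zero))
                                  (e₁ (y (suc i)) (row M i) y₀ ((minor M ⊛ y′) i))))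
           (sum-linear y₀ (λ i → y (suc i) * (minor M ⊛ y′) i) (λ i → row M i * y (suc i)))) ⟩
    y₀ * (M zero zero * y₀ + β) + (y′ ∙ (minor M ⊛ y′) + y₀ * β)
      ≡⟨ cong (λ a → y₀ * (M zero zero * y₀ + β) + (a + y₀ * β))
           (form≡∙⊛ (minor M) (λ i j → M-sym (suc i) (suc j)) y′) ⟨
    y₀ * (M zero zero * y₀ + β) + (form (minor M) y′ + y₀ * β)
      ≡⟨ e₂ y₀ (M zero zero) β (form (minor M) y′) ⟩
    M zero zero * (y₀ * y₀) + (y₀ * β + y₀ * β) + form (minor M) y′ ∎)
    where
    open ≡-Reasoning
    y₀ = y zero
    y′ = y ∘ suc
    β = row M ∙ y′
    e₁ : ∀ z b y₀ d → z * (b * y₀ + d) ≡ z * d + y₀ * (b * z)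
    e₁ = solve-∀ ℚ-ring
    e₂ : ∀ y₀ m b f → y₀ * (m * y₀ + b) + (f + y₀ * b) ≡ m * (y₀ * y₀) + (y₀ * b + y₀ * b) + f
    e₂ = solve-∀ ℚ-ring

  -1ℚ : ℚ
  -1ℚ = - 1ℚ

  -- The matrix has the shape of a Schur complement, a multiple of a minor less a rank-one matrix.
  -- Both `complete-square` and `form-extend` rest on this evaluation.
  form-rank-one : ∀ c (D : Mat n) (b y : Vector ℚ n) →
    form (λ i j → c * D i j + -1ℚ * (b i * b j)) y ≡ c * form D y + -1ℚ * ((b ∙ y) * (b ∙ y))
  form-rank-one {zero}  c D b y = e c
    where
    e : ∀ c → 0ℚ ≡ c * 0ℚ + -1ℚ * (0ℚ * 0ℚ)
    e = solve-∀ ℚ-ring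
  form-rank-one {suc n} c D b y = begin
    (c * D₀ + -1ℚ * (b₀ * b₀)) * (y₀ * y₀) + (y₀ * ρ + y₀ * ρ) + form _ y′
      ≡⟨ cong₂ (λ s t → (c * D₀ + -1ℚ * (b₀ * b₀)) * (y₀ * y₀) + (y₀ * s + y₀ * s) + t)
           ρ≡ (form-rank-one c (minor D) (b ∘ suc) y′) ⟩
    (c * D₀ + -1ℚ * (b₀ * b₀)) * (y₀ * y₀)
      + (y₀ * (c * (row D ∙ y′) + (-1ℚ * b₀) * β) + y₀ * (c * (row D ∙ y′) + (-1ℚ * b₀) * β))
      + (c * form (minor D) y′ + -1ℚ * (β * β))
      ≡⟨ e c D₀ b₀ y₀ (row D ∙ y′) β (form (minor D) y′) ⟩
    c * form D y + -1ℚ * ((b ∙ y) * (b ∙ y)) ∎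
    where
    open ≡-Reasoning
    y₀ = y zero
    y′ = y ∘ suc
    b₀ = b zero
    D₀ = D zero zero
    β = (b ∘ suc) ∙ y′
    ρ = ∑ℚ.sum (λ j → (c * D zero (suc j) + -1ℚ * (b₀ * b (suc j))) * y (suc j))
    e₁ : ∀ c d b₀ b y → (c * d + -1ℚ * (b₀ * b)) * y ≡ c * (d * y) + (-1ℚ * b₀) * (b * y)
    e₁ = solve-∀ ℚ-ring
    ρ≡ : ρ ≡ c * (row D ∙ y′) + (-1ℚ * b₀) * β
    ρ≡ = trans (sum-cong (λ j → e₁ c (D zero (suc j)) b₀ (b (suc j)) (y (suc j))))
        (trans (sum-linear (-1ℚ * b₀) (λ j → c * (row D j * y′ j)) (λ j → b (suc j) * y′ j))
          (cong (_+ (-1ℚ * b₀) * β) (sym (∑ℚ.*-distribˡ-sum c (λ j → row D j * y′ j)))))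
    e : ∀ c d b₀ y₀ r β f →
        (c * d + -1ℚ * (b₀ * b₀)) * (y₀ * y₀)
          + (y₀ * (c * r + (-1ℚ * b₀) * β) + y₀ * (c * r + (-1ℚ * b₀) * β))
          + (c * f + -1ℚ * (β * β))
        ≡ c * (d * (y₀ * y₀) + (y₀ * r + y₀ * r) + f)
          + -1ℚ * ((b₀ * y₀ + β) * (b₀ * y₀ + β))
    e = solve-∀ ℚ-ring

  form-scale : ∀ (M : Mat n) a y → form M (λ i → a * y i) ≡ a * a * form M y
  form-scale {zero}  M a y = e a
    where
    e : ∀ a → 0ℚ ≡ a * a * 0ℚ
    e = solve-∀ ℚ-ring
  form-scale {suc n} M a y = trans
    (cong₂ (λ s t → M zero zero * (a * y zero * (a * y zero)) + (a * y zero * s + a * y zero * s) + t)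
      (trans (sum-cong (λ j → e₁ (row M j) a (y (suc j)))) (sym (∑ℚ.*-distribˡ-sum a (λ j → row M j * y (suc j)))))
      (form-scale (minor M) a (y ∘ suc)))
    (e₂ (M zero zero) a (y zero) (row M ∙ (y ∘ suc)) (form (minor M) (y ∘ suc)))
    where
    e₁ : ∀ m a y → m * (a * y) ≡ a * (m * y)
    e₁ = solve-∀ ℚ-ring
    e₂ : ∀ m a y b f → m * (a * y * (a * y)) + (a * y * (a * b) + a * y * (a * b)) + a * a * f
         ≡ a * a * (m * (y * y) + (y * b + y * b) + f)
    e₂ = solve-∀ ℚ-ring

  -- A Schur complement scaled by the pivot, so that no division is needed.
  schur : Mat (suc n) → Mat n
  schur M i j = M zero zero * minor M i j + -1ℚ * (row M i * row M j)

  complete-square : ∀ (M : Mat (suc n)) y → M zero zero * form M y ≡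
    (M zero zero * y zero + row M ∙ (y ∘ suc)) * (M zero zero * y zero + row M ∙ (y ∘ suc))
      + form (schur M) (y ∘ suc)
  complete-square M y = trans
    (e (M zero zero) (y zero) (row M ∙ (y ∘ suc)) (form (minor M) (y ∘ suc)))
    (cong ((M zero zero * y zero + row M ∙ (y ∘ suc)) * (M zero zero * y zero + row M ∙ (y ∘ suc)) +_)
      (sym (form-rank-one (M zero zero) (minor M) (row M) (y ∘ suc))))
    where
    e : ∀ m y b f → m * (m * (y * y) + (y * b + y * b) + f)
        ≡ (m * y + b) * (m * y + b) + (m * f + -1ℚ * (b * b))
    e = solve-∀ ℚ-ring

  -- The head makes the square in `complete-square` vanish: with pivot a and β = `row M ∙ y`, its
  -- base is a (-β) + a β = 0.
  extend : Mat (suc n) → Vector ℚ n → Vector ℚ (suc n)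
  extend M y zero    = -1ℚ * (row M ∙ y)
  extend M y (suc i) = M zero zero * y i

  form-extend : ∀ (M : Mat (suc n)) y → form M (extend M y) ≡ M zero zero * form (schur M) y
  form-extend M y = trans
    (cong₂ (λ s t → M zero zero * (-1ℚ * β * (-1ℚ * β)) + (-1ℚ * β * s + -1ℚ * β * s) + t)
      (trans (sum-cong (λ j → e₁ (row M j) (M zero zero) (y j))) (sym (∑ℚ.*-distribˡ-sum (M zero zero) (λ j → row M j * y j))))
      (form-scale (minor M) (M zero zero) y))
    (trans (e₂ (M zero zero) β (form (minor M) y))
      (cong (M zero zero *_) (sym (form-rank-one (M zero zero) (minor M) (row M) y))))
    where
    β = row M ∙ y
    e₁ : ∀ m a y → m * (a * y) ≡ a * (m * y)
    e₁ = solve-∀ ℚ-ring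
    e₂ : ∀ m b f → m * (-1ℚ * b * (-1ℚ * b)) + (-1ℚ * b * (m * b) + -1ℚ * b * (m * b)) + m * m * f
         ≡ m * (m * f + -1ℚ * (b * b))
    e₂ = solve-∀ ℚ-ring

  unit₀ : Vector ℚ (suc n)
  unit₀ zero    = 1ℚ
  unit₀ (suc _) = 0ℚ

  form-zero : ∀ (M : Mat n) → form M (λ _ → 0ℚ) ≡ 0ℚ
  form-zero {n} M = trans (form-cong {M = M} (λ _ _ → refl) (λ _ → refl))
    (trans (form-scale M 0ℚ (λ _ → 0ℚ)) (ℚ.*-zeroˡ (form M (λ _ → 0ℚ))))

  form-unit₀ : ∀ (M : Mat (suc n)) → form M unit₀ ≡ M zero zero
  form-unit₀ M = trans
    (cong₂ (λ s t → M zero zero * (1ℚ * 1ℚ) + (1ℚ * s + 1ℚ * s) + t)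
      (sum-zero (λ j → ℚ.*-zeroʳ (row M j))) (form-zero (minor M)))
    (e (M zero zero))
    where
    e : ∀ m → m * (1ℚ * 1ℚ) + (1ℚ * 0ℚ + 1ℚ * 0ℚ) + 0ℚ ≡ m
    e = solve-∀ ℚ-ring

  *≢0 : 0ℚ < p → q ≢ 0ℚ → p * q ≢ 0ℚ
  *≢0 {p} {q} 0<p q≢0 pq≡0 = ℚ.<⇒≢ (*-pos (*-pos 0<p 0<p) (square-pos q≢0))
    (sym (trans (e p q) (trans (cong₂ _*_ pq≡0 pq≡0) (ℚ.*-zeroˡ 0ℚ))))
    where
    e : ∀ p q → p * p * (q * q) ≡ p * q * (p * q)
    e = solve-∀ ℚ-ring

  -- Deliberately not strict: the two outcomes of `semidefinite?` overlap for singular semidefinite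
  -- matrices, but a zero pivot then needs no separate treatment, since `unit₀` is already a
  -- witness.
  NonPosWitness : Mat n → Set
  NonPosWitness M = ∃[ y ] (NonZero y × form M y ≤ 0ℚ)

  semidefinite? : (M : Mat n) → NonPosWitness M ⊎ (∀ y → 0ℚ ≤ form M y)
  semidefinite? {zero}  M = inj₂ (λ _ → ℚ.≤-refl)
  semidefinite? {suc n} M with 0ℚ ℚ.<? M zero zero
  ... | no ¬0<a = inj₁ (unit₀ , (zero , λ ()) , subst (_≤ 0ℚ) (sym (form-unit₀ M)) (ℚ.≮⇒≥ ¬0<a))
  ... | yes 0<a with semidefinite? (schur M)
  ...   | inj₁ (y , (i , yi≢0) , h) = inj₁ (extend M y , (suc i , *≢0 0<a yi≢0) ,
            subst (_≤ 0ℚ) (sym (form-extend M y)) (*-nonpos (ℚ.<⇒≤ 0<a) h))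
  ...   | inj₂ psd = inj₂ (λ y → *-cancelˡ-nonneg 0<a (subst (0ℚ ≤_) (sym (complete-square M y))
            (+-nonneg (square-nonneg (M zero zero * y zero + row M ∙ (y ∘ suc))) (psd (y ∘ suc)))))

  -- By `complete-square` the Schur form at the tail is at most the pivot times the form of `M`. The
  -- tail is nonzero, since otherwise the form of `M` would be the pivot times a nonzero square,
  -- hence positive.
  schur-witness : ∀ (M : Mat (suc n)) → 0ℚ < M zero zero → NonPosWitness M → NonPosWitness (schur M)
  schur-witness M 0<a (y , nz , h) = y ∘ suc , tail-nonzero nz , ℚ.≤-trans S≤aM (*-nonpos (ℚ.<⇒≤ 0<a) h)
    where
    a = M zero zero
    w = a * y zero + row M ∙ (y ∘ suc)
    S = form (schur M) (y ∘ suc)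
    S≤aM : S ≤ a * form M y
    S≤aM = subst₂ _≤_ (ℚ.+-identityˡ S) (sym (complete-square M y)) (ℚ.+-monoˡ-≤ S (square-nonneg w))
    tail-nonzero : NonZero y → NonZero (y ∘ suc)
    tail-nonzero (suc i , yi≢0) = i , yi≢0
    tail-nonzero (zero , y₀≢0) with any? (λ i → ¬? (y (suc i) ℚ.≟ 0ℚ))
    ... | yes found = found
    ... | no none = contradiction h (<⇒≱ (subst (0ℚ <_) (sym My≡) (*-pos 0<a (square-pos y₀≢0))))
      where
      y≡0 : ∀ i → y (suc i) ≡ 0ℚ
      y≡0 i with y (suc i) ℚ.≟ 0ℚ
      ... | yes eq = eq
      ... | no neq = contradiction (i , neq) none
      e : ∀ m y → m * (y * y) + (y * 0ℚ + y * 0ℚ) + 0ℚ ≡ m * (y * y)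
      e = solve-∀ ℚ-ring
      My≡ : form M y ≡ a * (y zero * y zero)
      My≡ = trans (cong₂ (λ s t → a * (y zero * y zero) + (y zero * s + y zero * s) + t)
              (sum-zero (λ j → trans (cong (row M j *_) (y≡0 j)) (ℚ.*-zeroʳ (row M j))))
              (trans (form-cong {M = minor M} (λ _ _ → refl) y≡0) (form-zero (minor M))))
            (e a (y zero))

  -- Real sequences

  0<1 : 0ℚ < 1ℚ
  0<1 = ℚ.positive⁻¹ 1ℚ

  0≤1 : 0ℚ ≤ 1ℚ
  0≤1 = ℚ.<⇒≤ 0<1

  0<½ : 0ℚ < ½
  0<½ = ℚ.positive⁻¹ ½

  0≤½ : 0ℚ ≤ ½
  0≤½ = ℚ.<⇒≤ 0<½

  ½-pos : 0ℚ < p → 0ℚ < ½ * p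
  ½-pos = *-pos 0<½

  ½+½ : ∀ p → ½ * p + ½ * p ≡ p
  ½+½ = solve-∀ ℚ-ring

  quotient : 0ℚ < p → 0ℚ < q → ∃[ δ ] (0ℚ < δ × p * δ ≡ q)
  quotient {p} {q} 0<p 0<q = 1/p * q , *-pos 0<1/p 0<q ,
    trans (sym (ℚ.*-assoc p 1/p q)) (trans (cong (_* q) (ℚ.*-inverseʳ p)) (ℚ.*-identityˡ q))
    where
    instance
      p-pos : ℚ.Positive p
      p-pos = ℚ.positive 0<p
      p-nz : ℚ.NonZero p
      p-nz = ℚ.pos⇒nonZero p
    1/p : ℚ
    1/p = ℚ.1/ p
    0<1/p : 0ℚ < 1/p
    0<1/p = ℚ.positive⁻¹ 1/p {{ℚ.1/pos⇒pos p}}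

  p≤∣p∣ : ∀ p → p ≤ ∣ p ∣
  p≤∣p∣ p with ℚ.≤-total 0ℚ p
  ... | inj₁ 0≤p = ℚ.≤-reflexive (sym (ℚ.0≤p⇒∣p∣≡p 0≤p))
  ... | inj₂ p≤0 = ℚ.≤-trans p≤0 (ℚ.0≤∣p∣ p)

  ∣∣-< : p < r → - p < r → ∣ p ∣ < r
  ∣∣-< {p} {r} h k with ℚ.∣p∣≡p∨∣p∣≡-p p
  ... | inj₁ e = subst (_< r) (sym e) h
  ... | inj₂ e = subst (_< r) (sym e) k

  square-<⇒∣∣-< : 0ℚ < r → p * p < r * r → ∣ p ∣ < r
  square-<⇒∣∣-< {r} {p} 0<r h with ∣ p ∣ ℚ.<? r
  ... | yes lt = lt
  ... | no ¬lt = contradiction h (λ h → <⇒≱ h r²≤p²)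
    where
    r≤∣p∣ : r ≤ ∣ p ∣
    r≤∣p∣ = ℚ.≮⇒≥ ¬lt
    ∣p∣²≡ : ∣ p ∣ * ∣ p ∣ ≡ p * p
    ∣p∣²≡ = trans (sym (ℚ.∣p*q∣≡∣p∣*∣q∣ p p)) (ℚ.0≤p⇒∣p∣≡p (square-nonneg p))
    r²≤p² : r * r ≤ p * p
    r²≤p² = subst (r * r ≤_) ∣p∣²≡ (ℚ.≤-trans (*-monoˡ-≤ (ℚ.<⇒≤ 0<r) r≤∣p∣)
      (subst₂ _≤_ (ℚ.*-comm ∣ p ∣ r) refl (*-monoˡ-≤ (ℚ.0≤∣p∣ p) r≤∣p∣)))

  ι : ℕ → ℚ
  ι zero    = 0ℚ
  ι (suc k) = 1ℚ + ι k

  toℚᵘ-ι : ∀ k → toℚᵘ (ι k) ℚᵘ.≃ mkℚᵘ (ℤ.+ k) 0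
  toℚᵘ-ι zero    = ℚᵘ.≃-refl
  toℚᵘ-ι (suc k) = ℚᵘ.≃-trans (ℚ.toℚᵘ-homo-+ 1ℚ (ι k))
    (ℚᵘ.≃-trans (ℚᵘ.+-congʳ (toℚᵘ 1ℚ) (toℚᵘ-ι k))
      (ℚᵘ.*≡* (cong (λ a → (ℤ.+ 1 ℤ.+ a) ℤ.* ℤ.+ 1) (ℤ.*-identityʳ (ℤ.+ k)))))

  archimedean : ∀ q → ∃[ k ] q < ι k
  archimedean q@(mkℚ m d-1 _) = suc ℤ.∣ m ∣ , ℚ.toℚᵘ-cancel-<
    (ℚᵘ.<-respʳ-≃ (ℚᵘ.≃-sym (toℚᵘ-ι (suc ℤ.∣ m ∣))) (ℚᵘ.*<* (bound m)))
    where
    bound : ∀ m → m ℤ.* ℤ.+ 1 ℤ.< ℤ.+ suc ℤ.∣ m ∣ ℤ.* ℤ.+ suc d-1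
    bound m = ℤ.≤-<-trans (ℤ.≤-reflexive (ℤ.*-identityʳ m)) (ℤ.<-≤-trans (m<1+∣m∣ m)
      (ℤ.≤-trans (ℤ.≤-reflexive (sym (ℤ.*-identityʳ _)))
        (ℤ.*-monoˡ-≤-nonNeg (ℤ.+ suc ℤ.∣ m ∣) (ℤ.+≤+ (ℕ.s≤s ℕ.z≤n)))))
      where
      m<1+∣m∣ : ∀ m → m ℤ.< ℤ.+ suc ℤ.∣ m ∣
      m<1+∣m∣ (ℤ.+ k)    = ℤ.+<+ (ℕ.n<1+n k)
      m<1+∣m∣ ℤ.-[1+ k ] = ℤ.-<+

  Eventually : (ℕ → Set) → Set
  Eventually P = ∃[ N ] (∀ m → N ℕ.≤ m → P m)

  ev-map : ∀ {P Q : ℕ → Set} → (∀ m → P m → Q m) → Eventually P → Eventually Q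
  ev-map f (N , h) = N , λ m N≤m → f m (h m N≤m)

  ev-zip : ∀ {P Q R : ℕ → Set} → (∀ m → P m → Q m → R m) → Eventually P → Eventually Q → Eventually R
  ev-zip f (M , h) (N , k) = M ℕ.⊔ N , λ m ≤m →
    f m (h m (ℕ.m⊔n≤o⇒m≤o M N ≤m)) (k m (ℕ.m⊔n≤o⇒n≤o M N ≤m))

  ev-witness : ∀ {P : ℕ → Set} → Eventually P → ∃ P
  ev-witness (N , h) = N , h N ℕ.≤-refl

  Null Small Bounded : (ℕ → ℚ) → Set
  Null z = ∀ ε → 0ℚ < ε → Eventually (λ m → ∣ z m ∣ < ε)
  -- The limit superior is at most 0.
  Small z = ∀ ε → 0ℚ < ε → Eventually (λ m → z m < ε)
  Bounded z = ∃[ B ] (0ℚ < B × Eventually (λ m → ∣ z m ∣ ≤ B))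

  null⇒small : ∀ {z} → Null z → Small z
  null⇒small {z} h ε 0<ε = ev-map (λ m → ℚ.≤-<-trans (p≤∣p∣ (z m))) (h ε 0<ε)

  small-nonneg⇒null : ∀ {z} → (∀ m → 0ℚ ≤ z m) → Small z → Null z
  small-nonneg⇒null {z} 0≤z h ε 0<ε =
    ev-map (λ m → subst (_< ε) (sym (ℚ.0≤p⇒∣p∣≡p (0≤z m)))) (h ε 0<ε)

  null-cong : ∀ {z w} → (∀ m → z m ≡ w m) → Null z → Null w
  null-cong e h ε 0<ε = ev-map (λ m → subst (λ a → ∣ a ∣ < ε) (e m)) (h ε 0<ε)

  small-+ : ∀ {z w} → Small z → Small w → Small (λ m → z m + w m)
  small-+ {z} {w} h k ε 0<ε = ev-zip
    (λ m a b → subst (z m + w m <_) (½+½ ε) (ℚ.+-mono-< a b)) (h (½ * ε) (½-pos 0<ε)) (k (½ * ε) (½-pos 0<ε))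

  small-* : ∀ {z} (b : ℕ → ℚ) → 0ℚ < r → (∀ m → 0ℚ ≤ b m) → Eventually (λ m → b m ≤ r) →
            Small z → Small (λ m → b m * z m)
  small-* {B} {z} b 0<B 0≤b b≤B h ε 0<ε with quotient 0<B 0<ε
  ... | δ , 0<δ , Bδ≡ε = ev-zip bound b≤B (h δ 0<δ)
    where
    bound : ∀ m → b m ≤ B → z m < δ → b m * z m < ε
    bound m b≤B z<δ with ℚ.≤-total (z m) 0ℚ
    ... | inj₁ z≤0 = ℚ.≤-<-trans (*-nonpos (0≤b m) z≤0) 0<ε
    ... | inj₂ 0≤z = ℚ.≤-<-trans
      (subst₂ _≤_ (ℚ.*-comm (z m) (b m)) (ℚ.*-comm (z m) B) (*-monoˡ-≤ 0≤z b≤B))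
      (subst (B * z m <_) Bδ≡ε (ℚ.*-monoʳ-<-pos B {{ℚ.positive 0<B}} z<δ))

  small-mono : ∀ {z w} → (∀ m → z m ≤ w m) → Small w → Small z
  small-mono z≤w h ε 0<ε = ev-map (λ m → ℚ.≤-<-trans (z≤w m)) (h ε 0<ε)

  null-+ : ∀ {z w} → Null z → Null w → Null (λ m → z m + w m)
  null-+ {z} {w} h k ε 0<ε = ev-zip
    (λ m a b → ℚ.≤-<-trans (ℚ.∣p+q∣≤∣p∣+∣q∣ (z m) (w m)) (subst (∣ z m ∣ + ∣ w m ∣ <_) (½+½ ε) (ℚ.+-mono-< a b)))
    (h (½ * ε) (½-pos 0<ε)) (k (½ * ε) (½-pos 0<ε))

  null-- : ∀ {z} → Null z → Null (λ m → - z m)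
  null-- {z} h ε 0<ε = ev-map (λ m → subst (_< ε) (sym (ℚ.∣-p∣≡∣p∣ (z m)))) (h ε 0<ε)

  null-* : ∀ {z b} → Null z → Bounded b → Null (λ m → z m * b m)
  null-* {z} {b} h (B , 0<B , b≤B) ε 0<ε = ev-map
    (λ m → subst (_< ε) (trans (ℚ.*-comm ∣ b m ∣ ∣ z m ∣) (sym (ℚ.∣p*q∣≡∣p∣*∣q∣ (z m) (b m)))))
    (small-* (λ m → ∣ b m ∣) 0<B (λ m → ℚ.0≤∣p∣ (b m)) b≤B h ε 0<ε)

  null-sum : ∀ (z : Fin n → ℕ → ℚ) → (∀ i → Null (z i)) → Null (λ m → ∑ℚ.sum (λ i → z i m))
  null-sum {zero}  z h ε 0<ε = 0 , λ _ _ → 0<ε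
  null-sum {suc n} z h = null-+ (h zero) (null-sum (z ∘ suc) (h ∘ suc))

  null-square : ∀ {z w} → Eventually (λ m → z m * z m ≤ w m) → Small w → Null z
  null-square z²≤w h ε 0<ε = ev-zip
    (λ m z²≤wm w<ε² → square-<⇒∣∣-< 0<ε (ℚ.≤-<-trans z²≤wm w<ε²)) z²≤w (h (ε * ε) (*-pos 0<ε 0<ε))

  cauchy⇒bounded : ∀ {z} → IsCauchy z → Bounded z
  cauchy⇒bounded {z} cz with cz 1ℚ 0<1
  ... | N , near = 1ℚ + ∣ z N ∣ , ℚ.+-mono-<-≤ 0<1 (ℚ.0≤∣p∣ (z N)) , N , λ m N≤m → begin
      ∣ z m ∣                    ≡⟨ cong ∣_∣ (e (z m) (z N)) ⟩
      ∣ (z m - z N) + z N ∣      ≤⟨ ℚ.∣p+q∣≤∣p∣+∣q∣ (z m - z N) (z N) ⟩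
      ∣ z m - z N ∣ + ∣ z N ∣    ≤⟨ ℚ.+-monoˡ-≤ ∣ z N ∣ (ℚ.<⇒≤ (near m N N≤m ℕ.≤-refl)) ⟩
      1ℚ + ∣ z N ∣               ∎
    where
    open ℚ.≤-Reasoning
    e : ∀ a b → a ≡ (a - b) + b
    e = solve-∀ ℚ-ring

  AwayPositive : (ℕ → ℚ) → Set
  AwayPositive z = ∃[ δ ] (0ℚ < δ × Eventually (λ m → δ ≤ z m))

  -- From `N` on the terms differ by less than ε/4. Comparing the single rational `z N` with ε/2
  -- decides: either all later terms are below 3ε/4, or all are at least ε/4 and the sequence is
  -- bounded away from 0.
  not-away⇒small : ∀ {z} → IsCauchy z → ¬ AwayPositive z → Small z
  not-away⇒small {z} cz ¬away ε 0<ε with cz (½ * (½ * ε)) (½-pos (½-pos 0<ε))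
  ... | N , near with z N ℚ.<? ½ * ε
  ...   | yes zN<q = N , λ m N≤m → begin-strict
      z m                           ≡⟨ e (z m) (z N) ⟩
      (z m - z N) + z N             <⟨ ℚ.+-mono-< (ℚ.≤-<-trans (p≤∣p∣ (z m - z N)) (near m N N≤m ℕ.≤-refl)) zN<q ⟩
      ½ * (½ * ε) + ½ * ε           <⟨ ℚ.+-monoˡ-< (½ * ε) half-< ⟩
      ½ * ε + ½ * ε                 ≡⟨ ½+½ ε ⟩
      ε                             ∎
    where
    open ℚ.≤-Reasoning
    e : ∀ a b → a ≡ (a - b) + b
    e = solve-∀ ℚ-ring
    half-< : ½ * (½ * ε) < ½ * ε
    half-< = subst₂ _<_ (ℚ.+-identityʳ _) (½+½ (½ * ε)) (ℚ.+-monoʳ-< (½ * (½ * ε)) (½-pos (½-pos 0<ε)))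
  ...   | no zN≮q = contradiction (½ * (½ * ε) , ½-pos (½-pos 0<ε) , N , λ m N≤m →
            ≤-by (e (z m) (z N) ε)
              (+-nonneg (0≤diff (ℚ.≮⇒≥ zN≮q))
                (0≤diff (ℚ.≤-trans (p≤∣p∣ (z N - z m)) (ℚ.<⇒≤ (near N m ℕ.≤-refl N≤m)))))) ¬away
    where
    e : ∀ a b ε → (b - ½ * ε) + (½ * (½ * ε) - (b - a)) ≡ a - ½ * (½ * ε)
    e = solve-∀ ℚ-ring

  -- Halving m times divides by at least m + 1.
  halving-small : ∀ (d : ℕ → ℚ) → (∀ m → d (suc m) ≡ ½ * d m) → 0ℚ ≤ d 0 → Small d
  halving-small d halves 0≤d₀ ε 0<ε with quotient 0<ε 0<1
  ... | 1/ε , 0<1/ε , ε/ε with archimedean (d 0 * 1/ε)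
  ...   | N , d₀/ε<N = N , λ m N≤m → dm<ε m (ℚ.<-≤-trans d₀/ε<N (ℚ.≤-trans (ι-mono N≤m) (ι≤ι-suc m)))
    where
    0≤ι : ∀ k → 0ℚ ≤ ι k
    0≤ι zero    = ℚ.≤-refl
    0≤ι (suc k) = +-nonneg 0≤1 (0≤ι k)
    ι≤ι-suc : ∀ k → ι k ≤ ι (suc k)
    ι≤ι-suc k = subst (_≤ 1ℚ + ι k) (ℚ.+-identityˡ (ι k)) (ℚ.+-monoˡ-≤ (ι k) 0≤1)
    ι-mono : ∀ {a b} → a ℕ.≤ b → ι a ≤ ι b
    ι-mono {b = b} ℕ.z≤n = 0≤ι b
    ι-mono (ℕ.s≤s a≤b) = ℚ.+-monoʳ-≤ 1ℚ (ι-mono a≤b)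
    0≤d : ∀ m → 0ℚ ≤ d m
    0≤d zero    = 0≤d₀
    0≤d (suc m) = subst (0ℚ ≤_) (sym (halves m)) (*-nonneg 0≤½ (0≤d m))
    d*ι≤d₀ : ∀ m → d m * ι (suc m) ≤ d 0
    d*ι≤d₀ zero    = ℚ.≤-reflexive (ℚ.*-identityʳ (d 0))
    d*ι≤d₀ (suc m) = ℚ.≤-trans
      (subst (λ a → a * ι (suc (suc m)) ≤ d m * ι (suc m)) (sym (halves m))
        (≤-by (e (d m) (ι m)) (*-nonneg 0≤½ (*-nonneg (0≤d m) (0≤ι m)))))
      (d*ι≤d₀ m)
      where
      e : ∀ d k → ½ * (d * k) ≡ d * (1ℚ + k) - ½ * d * (1ℚ + (1ℚ + k))
      e = solve-∀ ℚ-ring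
    dm<ε : ∀ m → d 0 * 1/ε < ι (suc m) → d m < ε
    dm<ε m h with d m ℚ.<? ε
    ... | yes lt = lt
    ... | no ¬lt = contradiction (ℚ.<-≤-trans h₁ (ℚ.≤-trans h₂ (d*ι≤d₀ m))) (ℚ.<-irrefl refl)
      where
      e : ∀ d i ε → ε * (d * i) ≡ d * (ε * i)
      e = solve-∀ ℚ-ring
      h₁ : d 0 < ε * ι (suc m)
      h₁ = subst (_< ε * ι (suc m)) (trans (e (d 0) 1/ε ε) (trans (cong (d 0 *_) ε/ε) (ℚ.*-identityʳ (d 0))))
        (ℚ.*-monoʳ-<-pos ε {{ℚ.positive 0<ε}} h)
      h₂ : ε * ι (suc m) ≤ d m * ι (suc m)
      h₂ = subst₂ _≤_ (ℚ.*-comm (ι (suc m)) ε) (ℚ.*-comm (ι (suc m)) (d m))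
        (*-monoˡ-≤ (0≤ι (suc m)) (ℚ.≮⇒≥ ¬lt))

  -- Isotropic vectors of real matrices

  atM : Matrix n → ℕ → Mat n
  atM M m i j = seq (M i j) m

  atV : Vector ℝ n → ℕ → Vector ℚ n
  atV x m i = seq (x i) m

  seq-sum : ∀ (f : Vector ℝ n) m → seq (foldr _+ᴿ_ 0ℝ f) m ≡ ∑ℚ.sum (λ i → seq (f i) m)
  seq-sum {zero}  f m = refl
  seq-sum {suc n} f m = cong (seq (f zero) m +_) (seq-sum (f ∘ suc) m)

  schurᴿ : Matrix (suc n) → Matrix n
  schurᴿ M i j = M zero zero *ᴿ M (suc i) (suc j)
    +ᴿ fromℚ -1ℚ *ᴿ (M zero (suc i) *ᴿ M zero (suc j))

  extendᴿ : Matrix (suc n) → Vector ℝ n → Vector ℝ (suc n)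
  extendᴿ M x zero    = fromℚ -1ℚ *ᴿ foldr _+ᴿ_ 0ℝ (λ j → M zero (suc j) *ᴿ x j)
  extendᴿ M x (suc i) = M zero zero *ᴿ x i

  extend-at : ∀ (M : Matrix (suc n)) x m i → atV (extendᴿ M x) m i ≡ extend (atM M m) (atV x m) i
  extend-at M x m zero    = cong (-1ℚ *_) (seq-sum (λ j → M zero (suc j) *ᴿ x j) m)
  extend-at M x m (suc i) = refl

  NonZeroᴿ : Vector ℝ n → Set
  NonZeroᴿ x = ¬ (∀ i → x i ≈ 0ℝ)

  unit₀ᴿ : Vector ℝ (suc n)
  unit₀ᴿ zero    = 1ℝ
  unit₀ᴿ (suc _) = 0ℝ

  ≈0⇒null : ∀ x → x ≈ 0ℝ → Null (seq x)
  ≈0⇒null x = null-cong (λ m → e (seq x m))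
    where
    e : ∀ a → a - 0ℚ ≡ a
    e = solve-∀ ℚ-ring

  null⇒≈0 : ∀ x → Null (seq x) → x ≈ 0ℝ
  null⇒≈0 x = null-cong (λ m → e (seq x m))
    where
    e : ∀ a → a ≡ a - 0ℚ
    e = solve-∀ ℚ-ring

  -- Only a one-sided condition, the limit of the form being at most 0. It suffices because the
  -- matrix in question is a limit of semidefinite ones, where `residual-bound` turns a small form
  -- into a small residual.
  Isotropic : Matrix n → Vector ℝ n → Set
  Isotropic M x = Small (λ m → form (atM M m) (atV x m))

  unit₀ᴿ-nonzero : NonZeroᴿ {suc n} unit₀ᴿ
  unit₀ᴿ-nonzero h with ev-witness (≈0⇒null 1ℝ (h zero) 1ℚ 0<1)
  ... | _ , 1<1 = ℚ.<-irrefl refl 1<1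

  unit₀ᴿ-form : ∀ (M : Matrix (suc n)) m → form (atM M m) (atV unit₀ᴿ m) ≡ seq (M zero zero) m
  unit₀ᴿ-form M m = trans
    (form-cong {M = atM M m} {M′ = atM M m} {y = atV unit₀ᴿ m} {y′ = unit₀}
      (λ _ _ → refl) λ { zero → refl ; (suc _) → refl })
    (form-unit₀ (atM M m))

  unit₀ᴿ-isotropic : ∀ (M : Matrix (suc n)) → Small (seq (M zero zero)) → Isotropic M unit₀ᴿ
  unit₀ᴿ-isotropic M = small-mono (λ m → ℚ.≤-reflexive (unit₀ᴿ-form M m))

  null-cancel : ∀ {a z} → AwayPositive a → Null (λ m → a m * z m) → Null z
  null-cancel {a} {z} (δ , 0<δ , δ≤a) h ε 0<ε = ev-zip bound δ≤a (h (δ * ε) (*-pos 0<δ 0<ε))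
    where
    bound : ∀ m → δ ≤ a m → ∣ a m * z m ∣ < δ * ε → ∣ z m ∣ < ε
    bound m δ≤am lt = ℚ.*-cancelˡ-<-nonNeg δ {{ℚ.nonNegative (ℚ.<⇒≤ 0<δ)}} (ℚ.≤-<-trans
      (subst₂ _≤_ (ℚ.*-comm ∣ z m ∣ δ) ∣z∣a≡∣az∣ (*-monoˡ-≤ (ℚ.0≤∣p∣ (z m)) δ≤am)) lt)
      where
      0≤am : 0ℚ ≤ a m
      0≤am = ℚ.≤-trans (ℚ.<⇒≤ 0<δ) δ≤am
      ∣z∣a≡∣az∣ : ∣ z m ∣ * a m ≡ ∣ a m * z m ∣
      ∣z∣a≡∣az∣ = trans (ℚ.*-comm ∣ z m ∣ (a m))
        (trans (cong (_* ∣ z m ∣) (sym (ℚ.0≤p⇒∣p∣≡p 0≤am))) (sym (ℚ.∣p*q∣≡∣p∣*∣q∣ (a m) (z m))))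

  extendᴿ-nonzero : ∀ (M : Matrix (suc n)) x → AwayPositive (seq (M zero zero)) →
                    NonZeroᴿ x → NonZeroᴿ (extendᴿ M x)
  extendᴿ-nonzero M x away x≢0 h = x≢0 λ i →
    null⇒≈0 (x i) (null-cancel {a = seq (M zero zero)} away (≈0⇒null (M zero zero *ᴿ x i) (h (suc i))))

  form-extendᴿ : ∀ (M : Matrix (suc n)) x m →
    form (atM M m) (atV (extendᴿ M x) m) ≡ seq (M zero zero) m * form (atM (schurᴿ M) m) (atV x m)
  form-extendᴿ M x m = trans
    (form-cong {M = atM M m} {M′ = atM M m} {y = atV (extendᴿ M x) m} {y′ = extend (atM M m) (atV x m)}
      (λ _ _ → refl) (extend-at M x m))
    (form-extend (atM M m) (atV x m))

  extendᴿ-isotropic : ∀ (M : Matrix (suc n)) x → AwayPositive (seq (M zero zero)) →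
                      Isotropic (schurᴿ M) x → Isotropic M (extendᴿ M x)
  extendᴿ-isotropic M x (δ , 0<δ , δ≤a) sm ε 0<ε =
    let B , 0<B , a≤B = cauchy⇒bounded (cauchy (M zero zero))
    in ev-zip step δ≤a (small-* (λ m → ∣ a m ∣) 0<B (λ m → ℚ.0≤∣p∣ (a m)) a≤B sm ε 0<ε)
    where
    a : ℕ → ℚ
    a = seq (M zero zero)
    step : ∀ m → δ ≤ a m → ∣ a m ∣ * form (atM (schurᴿ M) m) (atV x m) < ε →
           form (atM M m) (atV (extendᴿ M x) m) < ε
    step m δ≤am lt = subst (_< ε)
      (trans (cong (_* form (atM (schurᴿ M) m) (atV x m)) (ℚ.0≤p⇒∣p∣≡p (ℚ.≤-trans (ℚ.<⇒≤ 0<δ) δ≤am)))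
             (sym (form-extendᴿ M x m)))
      lt

  schurᴿ-witness : ∀ (M : Matrix (suc n)) → AwayPositive (seq (M zero zero)) →
    Eventually (λ m → NonPosWitness (atM M m)) → Eventually (λ m → NonPosWitness (atM (schurᴿ M) m))
  schurᴿ-witness M (δ , 0<δ , δ≤a) wit =
    ev-zip (λ m δ≤am w → schur-witness (atM M m) (ℚ.<-≤-trans 0<δ δ≤am) w) δ≤a wit

  -- Elimination on a real matrix: whether a pivot is positive is only known
  -- up to double negation.
  isotropic : ∀ (M : Matrix n) → Eventually (λ m → NonPosWitness (atM M m)) →
    ¬ ¬ (Σ (Vector ℝ n) λ x → NonZeroᴿ x × Isotropic M x)
  isotropic {zero} M wit _ with ev-witness wit
  ... | _ , _ , (() , _) , _
  -- The first unit vector is offered. It is isotropic once the pivot is not bounded away from 0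
  -- from above, and a pivot that is so bounded permits elimination, whose result contradicts
  -- `none`.
  isotropic {suc n} M wit none = none (unit₀ᴿ , unit₀ᴿ-nonzero , unit₀ᴿ-isotropic M
    (not-away⇒small (cauchy (M zero zero)) λ away →
      isotropic (schurᴿ M) (schurᴿ-witness M away wit) λ (x , x≢0 , iso) →
        none (extendᴿ M x , extendᴿ-nonzero M x away x≢0 , extendᴿ-isotropic M x away iso)))

  -- Largest eigenvalues

  diagonal : ℚ → Mat n
  diagonal q zero    zero    = q
  diagonal q zero    (suc j) = 0ℚ
  diagonal q (suc i) zero    = 0ℚ
  diagonal q (suc i) (suc j) = diagonal q i j

  diagonalᴿ : ℝ → Matrix n
  diagonalᴿ x zero    zero    = x
  diagonalᴿ x zero    (suc j) = 0ℝ
  diagonalᴿ x (suc i) zero    = 0ℝ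
  diagonalᴿ x (suc i) (suc j) = diagonalᴿ x i j

  diagonalᴿ-at : ∀ x m (i j : Fin n) → seq (diagonalᴿ x i j) m ≡ diagonal (seq x m) i j
  diagonalᴿ-at x m zero    zero    = refl
  diagonalᴿ-at x m zero    (suc j) = refl
  diagonalᴿ-at x m (suc i) zero    = refl
  diagonalᴿ-at x m (suc i) (suc j) = diagonalᴿ-at x m i j

  diagonal-⊛ : ∀ q (y : Vector ℚ n) i → (diagonal q ⊛ y) i ≡ q * y i
  diagonal-⊛ q y zero = trans
    (cong (q * y zero +_) (sum-zero (λ j → ℚ.*-zeroˡ (y (suc j)))))
    (ℚ.+-identityʳ (q * y zero))
  diagonal-⊛ q y (suc i) = trans
    (cong₂ _+_ (ℚ.*-zeroˡ (y zero)) (diagonal-⊛ q (y ∘ suc) i))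
    (ℚ.+-identityˡ (q * y (suc i)))

  diagonal-sym : ∀ q → Symmetric {n} (diagonal q)
  diagonal-sym q zero    zero    = refl
  diagonal-sym q zero    (suc j) = refl
  diagonal-sym q (suc i) zero    = refl
  diagonal-sym q (suc i) (suc j) = diagonal-sym q i j

  shift : ℚ → Mat n → Mat n
  shift q A i j = diagonal q i j - A i j

  defect : Mat n → ℚ → Vector ℚ n → ℚ
  defect A q y = q * (y ∙ y) - y ∙ (A ⊛ y)

  residual : Mat n → ℚ → Vector ℚ n → Vector ℚ n
  residual A q x i = q * x i - (A ⊛ x) i

  ∙-residual : ∀ (A : Mat n) q x y → y ∙ residual A q x ≡ q * (y ∙ x) - y ∙ (A ⊛ x)
  ∙-residual A q x y = trans
    (sum-cong (λ i → e₁ (y i) q (x i) ((A ⊛ x) i)))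
    (trans (sum-linear -1ℚ (λ i → q * (y i * x i)) (λ i → y i * (A ⊛ x) i))
      (trans (cong (_+ -1ℚ * (y ∙ (A ⊛ x))) (sym (∑ℚ.*-distribˡ-sum q (λ i → y i * x i))))
        (e₂ (q * (y ∙ x)) (y ∙ (A ⊛ x)))))
    where
    e₁ : ∀ y q x a → y * (q * x - a) ≡ q * (y * x) + -1ℚ * (y * a)
    e₁ = solve-∀ ℚ-ring
    e₂ : ∀ a b → a + -1ℚ * b ≡ a - b
    e₂ = solve-∀ ℚ-ring

  shift-⊛ : ∀ (A : Mat n) q y i → (shift q A ⊛ y) i ≡ residual A q y i
  shift-⊛ A q y i = trans
    (sum-cong (λ j → e₁ (diagonal q i j) (A i j) (y j)))
    (trans (sum-linear -1ℚ (λ j → diagonal q i j * y j) (λ j → A i j * y j))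
      (trans (cong (_+ -1ℚ * (A ⊛ y) i) (diagonal-⊛ q y i)) (e₂ (q * y i) ((A ⊛ y) i))))
    where
    e₁ : ∀ d a y → (d - a) * y ≡ d * y + -1ℚ * (a * y)
    e₁ = solve-∀ ℚ-ring
    e₂ : ∀ a b → a + -1ℚ * b ≡ a - b
    e₂ = solve-∀ ℚ-ring

  form-shift : ∀ (A : Mat n) → Symmetric A → ∀ q y → form (shift q A) y ≡ defect A q y
  form-shift A A-sym q y = trans
    (form≡∙⊛ (shift q A) (λ i j → cong₂ _-_ (diagonal-sym q i j) (A-sym i j)) y)
    (trans (∙-cong {x = y} {x′ = y} (λ _ → refl) (shift-⊛ A q y)) (∙-residual A q y y))

  defect-expand : ∀ (A : Mat n) → Symmetric A → ∀ q z c x → defect A q (z +[ c ] x) ≡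
    defect A q z + (c + c) * (z ∙ residual A q x) + c * c * defect A q x
  defect-expand A A-sym q z c x = begin
    q * (w ∙ w) - w ∙ (A ⊛ w)
      ≡⟨ cong₂ (λ a b → q * a - b) (pair z x) (trans
           (∙-cong {x = w} {x′ = w} (λ _ → refl) (⊛-linear A z c x))
           (pair (A ⊛ z) (A ⊛ x))) ⟩
    q * ((z ∙ z + c * (x ∙ z)) + c * (z ∙ x + c * (x ∙ x)))
      - ((z ∙ (A ⊛ z) + c * (x ∙ (A ⊛ z))) + c * (z ∙ (A ⊛ x) + c * (x ∙ (A ⊛ x))))
      ≡⟨ cong₂ (λ a b → q * ((z ∙ z + c * a) + c * (z ∙ x + c * (x ∙ x)))
           - ((z ∙ (A ⊛ z) + c * b) + c * (z ∙ (A ⊛ x) + c * (x ∙ (A ⊛ x)))))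
           (∙-comm x z) (trans (adjoint A A-sym x z) (∙-comm (A ⊛ x) z)) ⟩
    q * ((z ∙ z + c * (z ∙ x)) + c * (z ∙ x + c * (x ∙ x)))
      - ((z ∙ (A ⊛ z) + c * (z ∙ (A ⊛ x))) + c * (z ∙ (A ⊛ x) + c * (x ∙ (A ⊛ x))))
      ≡⟨ e q c (z ∙ z) (z ∙ x) (x ∙ x) (z ∙ (A ⊛ z)) (z ∙ (A ⊛ x)) (x ∙ (A ⊛ x)) ⟩
    defect A q z + (c + c) * (q * (z ∙ x) - z ∙ (A ⊛ x)) + c * c * defect A q x
      ≡⟨ cong (λ a → defect A q z + (c + c) * a + c * c * defect A q x) (∙-residual A q x z) ⟨
    defect A q z + (c + c) * (z ∙ residual A q x) + c * c * defect A q x ∎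
    where
    open ≡-Reasoning
    w = z +[ c ] x
    pair : ∀ u v → w ∙ (u +[ c ] v) ≡ (z ∙ u + c * (x ∙ u)) + c * (z ∙ v + c * (x ∙ v))
    pair u v = trans (∙-linearʳ u c v w) (cong₂ (λ a b → a + c * b) (∙-linearˡ z c x u) (∙-linearˡ z c x v))
    e : ∀ q c zz zx xx azz azx axx →
      q * ((zz + c * zx) + c * (zx + c * xx)) - ((azz + c * azx) + c * (azx + c * axx))
      ≡ q * zz - azz + (c + c) * (q * zx - azx) + c * c * (q * xx - axx)
    e = solve-∀ ℚ-ring

  -- Expanding the form of a positive semidefinite N at N x - C x bounds N x by the form at x.
  residual-bound : ∀ (A : Mat n) → Symmetric A → ∀ q C → 1ℚ ≤ C →
    (∀ w → 0ℚ ≤ defect A q w) → (∀ w → defect A q w ≤ C * (w ∙ w)) →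
    ∀ x → residual A q x ∙ residual A q x ≤ C * C * defect A q x
  residual-bound A A-sym q C 1≤C psd bnd x = ℚ.≤-trans zz≤Czz (diff⇒≤ Czz≤)
    where
    z = residual A q x
    zz≤Czz : z ∙ z ≤ C * (z ∙ z)
    zz≤Czz = subst₂ _≤_ (ℚ.*-identityʳ (z ∙ z)) (ℚ.*-comm (z ∙ z) C) (*-monoˡ-≤ (norm-nonneg z) 1≤C)
    e : ∀ C zz dz dx → (C * zz - dz) + (dz + (- C + - C) * zz + - C * - C * dx) ≡ C * C * dx - C * zz
    e = solve-∀ ℚ-ring
    Czz≤ : 0ℚ ≤ C * C * defect A q x - C * (z ∙ z)
    Czz≤ = subst (0ℚ ≤_) (e C (z ∙ z) (defect A q z) (defect A q x))
      (+-nonneg (0≤diff (bnd z)) (subst (0ℚ ≤_) (defect-expand A A-sym q z (- C) x) (psd (z +[ - C ] x))))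

  midpoint : ℚ → ℚ → ℚ
  midpoint l h = ½ * (l + h)

  upper-half : ∀ l h → h - ½ * (l + h) ≡ ½ * (h - l)
  upper-half = solve-∀ ℚ-ring

  lower-half : ∀ l h → ½ * (l + h) - l ≡ ½ * (h - l)
  lower-half = solve-∀ ℚ-ring

  ≤midpoint : p ≤ q → p ≤ midpoint p q
  ≤midpoint {p} {q} h = ≤-by (sym (lower-half p q)) (*-nonneg 0≤½ (0≤diff h))

  midpoint≤ : p ≤ q → midpoint p q ≤ q
  midpoint≤ {p} {q} h = ≤-by (sym (upper-half p q)) (*-nonneg 0≤½ (0≤diff h))

  -- The largest eigenvalue is enclosed: a witness in `low` is a vector with Rayleigh quotient at
  -- least `lo`, and `high` says that no quotient exceeds `hi`. Starting at the lower end `t`, for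
  -- which `y₀` is the witness, makes the limit at least `t`.
  module Bisection (A : Mat n) (A-sym : Symmetric A) (B : ℚ) (1≤B : 1ℚ ≤ B)
    (upper : ∀ w → w ∙ (A ⊛ w) ≤ B * (w ∙ w))
    (lower : ∀ w → - (w ∙ (A ⊛ w)) ≤ B * (w ∙ w))
    (t : ℚ) (y₀ : Vector ℚ n) (y₀≢0 : NonZero y₀) (t-low : defect A t y₀ ≤ 0ℚ) where

    record Bracket : Set where
      constructor bracket
      field
        lo hi   : ℚ
        low     : NonPosWitness (shift lo A)
        high    : ∀ y → 0ℚ ≤ form (shift hi A) y

    open Bracket

    width : Bracket → ℚ
    width b = hi b - lo b

    mid : Bracket → ℚ
    mid b = midpoint (lo b) (hi b)

    refine-with : ∀ b → NonPosWitness (shift (mid b) A) ⊎ (∀ y → 0ℚ ≤ form (shift (mid b) A) y) → Bracket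
    refine-with b (inj₁ w)   = bracket (mid b) (hi b) w (high b)
    refine-with b (inj₂ psd) = bracket (lo b) (mid b) (low b) psd

    refine : Bracket → Bracket
    refine b = refine-with b (semidefinite? (shift (mid b) A))

    width-refine : ∀ b → width (refine b) ≡ ½ * width b
    width-refine b = go (semidefinite? (shift (mid b) A))
      where
      go : ∀ s → width (refine-with b s) ≡ ½ * width b
      go (inj₁ _) = upper-half (lo b) (hi b)
      go (inj₂ _) = lower-half (lo b) (hi b)

    lo-refine : ∀ b → 0ℚ ≤ width b → lo b ≤ lo (refine b)
    lo-refine b 0≤w = go (semidefinite? (shift (mid b) A))
      where
      go : ∀ s → lo b ≤ lo (refine-with b s)
      go (inj₁ _) = ≤midpoint (diff⇒≤ 0≤w)
      go (inj₂ _) = ℚ.≤-refl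

    hi-refine : ∀ b → 0ℚ ≤ width b → hi (refine b) ≤ hi b
    hi-refine b 0≤w = go (semidefinite? (shift (mid b) A))
      where
      go : ∀ s → hi (refine-with b s) ≤ hi b
      go (inj₁ _) = ℚ.≤-refl
      go (inj₂ _) = midpoint≤ (diff⇒≤ 0≤w)

    brackets : ℕ → Bracket
    brackets zero    = bracket t B
      (y₀ , y₀≢0 , subst (_≤ 0ℚ) (sym (form-shift A A-sym t y₀)) t-low)
      (λ y → subst (0ℚ ≤_) (sym (form-shift A A-sym B y)) (0≤diff (upper y)))
    brackets (suc m) = refine (brackets m)

    los his widths : ℕ → ℚ
    los m    = lo (brackets m)
    his m    = hi (brackets m)
    widths m = width (brackets m)

    t≤B : t ≤ B
    t≤B = ℚ.≮⇒≥ λ B<t → <⇒≱ (ℚ.*-monoˡ-<-pos (y₀ ∙ y₀) {{ℚ.positive (norm-pos y₀≢0)}} B<t)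
      (ℚ.≤-trans (≤-by (e t (y₀ ∙ y₀) (y₀ ∙ (A ⊛ y₀))) (0≤diff t-low)) (upper y₀))
      where
      e : ∀ t a b → 0ℚ - (t * a - b) ≡ b - t * a
      e = solve-∀ ℚ-ring

    0≤widths : ∀ m → 0ℚ ≤ widths m
    0≤widths zero    = 0≤diff t≤B
    0≤widths (suc m) = subst (0ℚ ≤_) (sym (width-refine (brackets m))) (*-nonneg 0≤½ (0≤widths m))

    widths-small : Small widths
    widths-small = halving-small widths (λ m → width-refine (brackets m)) (0≤widths 0)

    los-mono : ∀ {a b} → a ℕ.≤′ b → los a ≤ los b
    los-mono ℕ.≤′-refl = ℚ.≤-refl
    los-mono {a} (ℕ.≤′-step {b} a≤b) = ℚ.≤-trans (los-mono {a} {b} a≤b) (lo-refine (brackets b) (0≤widths b))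

    his-mono : ∀ {a b} → a ℕ.≤′ b → his b ≤ his a
    his-mono ℕ.≤′-refl = ℚ.≤-refl
    his-mono {a} (ℕ.≤′-step {b} a≤b) = ℚ.≤-trans (hi-refine (brackets b) (0≤widths b)) (his-mono {a} {b} a≤b)

    los≤his : ∀ m → los m ≤ his m
    los≤his m = diff⇒≤ (0≤widths m)

    abstract
      los-cauchy : IsCauchy los
      los-cauchy ε 0<ε = close (widths-small ε 0<ε)
        where
        e : ∀ a b → a - b ≡ - (b - a)
        e = solve-∀ ℚ-ring
        close : Eventually (λ m → widths m < ε) →
                ∃[ N ] (∀ a b → N ℕ.≤ a → N ℕ.≤ b → ∣ los a - los b ∣ < ε)
        close (N , w<ε) = N , λ a b N≤a N≤b →
          ∣∣-< (diff a b N≤a N≤b) (subst (_< ε) (e (los b) (los a)) (diff b a N≤b N≤a))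
          where
          diff : ∀ a b → N ℕ.≤ a → N ℕ.≤ b → los a - los b < ε
          diff a b N≤a N≤b = ℚ.≤-<-trans
            (ℚ.+-mono-≤ (ℚ.≤-trans (los≤his a) (his-mono {N} {a} (ℕ.≤⇒≤′ N≤a)))
                        (ℚ.neg-antimono-≤ (los-mono {N} {b} (ℕ.≤⇒≤′ N≤b))))
            (w<ε N ℕ.≤-refl)

    μ : ℝ
    μ = mkℝ los los-cauchy

    t≤μ : ∀ m → t ≤ los m
    t≤μ m = los-mono {0} {m} (ℕ.≤⇒≤′ ℕ.z≤n)

    -- As `μ` is the sequence of lower ends, the term of index m of this matrix is exactly
    -- `shift (los m) A`, for which the bracket stores a witness. This supplies the hypothesis of
    -- `isotropic`.
    shiftᴿ : Matrix n
    shiftᴿ i j = diagonalᴿ μ i j +ᴿ fromℚ (- A i j)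

    shiftᴿ-at : ∀ m i j → atM shiftᴿ m i j ≡ shift (los m) A i j
    shiftᴿ-at m i j = cong (_- A i j) (diagonalᴿ-at μ m i j)

    form-shiftᴿ : ∀ m y → form (atM shiftᴿ m) y ≡ form (shift (los m) A) y
    form-shiftᴿ m y = form-cong {M = atM shiftᴿ m} {M′ = shift (los m) A} {y = y} {y′ = y}
      (shiftᴿ-at m) (λ _ → refl)

    lower-witness : Eventually (λ m → NonPosWitness (atM shiftᴿ m))
    lower-witness = 0 , λ m _ → let y , y≢0 , h = low (brackets m) in
      y , y≢0 , subst (_≤ 0ℚ) (sym (form-shiftᴿ m y)) h

    normᴿ : Vector ℝ n → ℝ
    normᴿ x = foldr _+ᴿ_ 0ℝ (λ i → x i *ᴿ x i)

    defect-his : ∀ m w → 0ℚ ≤ defect A (his m) w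
    defect-his m w = subst (0ℚ ≤_) (form-shift A A-sym (his m) w) (high (brackets m) w)

    defect-his-≤ : ∀ m w → defect A (his m) w ≤ (B + B) * (w ∙ w)
    defect-his-≤ m w = ℚ.≤-trans
      (ℚ.+-mono-≤ (subst₂ _≤_ (ℚ.*-comm (w ∙ w) (his m)) (ℚ.*-comm (w ∙ w) B)
        (*-monoˡ-≤ (norm-nonneg w) (his-mono {0} {m} (ℕ.≤⇒≤′ ℕ.z≤n)))) (lower w))
      (ℚ.≤-reflexive (sym (ℚ.*-distribʳ-+ (w ∙ w) B B)))

    1≤2B : 1ℚ ≤ B + B
    1≤2B = ℚ.≤-trans 1≤B (subst (_≤ B + B) (ℚ.+-identityʳ B) (ℚ.+-monoʳ-≤ B (ℚ.≤-trans 0≤1 1≤B)))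

    -- The lower ends produced the isotropic vector, while semidefiniteness, which `residual-bound`
    -- needs, holds at the upper ends. The two forms differ by the width times the squared norm, a
    -- null sequence.
    module _ (x : Vector ℝ n) (iso : Isotropic shiftᴿ x) where

      xs : ℕ → Vector ℚ n
      xs = atV x

      width-norm-null : Null (λ m → widths m * (xs m ∙ xs m))
      width-norm-null = null-* {b = λ m → xs m ∙ xs m} (small-nonneg⇒null 0≤widths widths-small)
        (let N , 0<N , b = cauchy⇒bounded (cauchy (normᴿ x))
         in N , 0<N , ev-map (λ m → subst (λ a → ∣ a ∣ ≤ N) (seq-sum (λ i → x i *ᴿ x i) m)) b)

      defect-small : Small (λ m → defect A (his m) (xs m))
      defect-small = small-mono (λ m → ℚ.≤-reflexive (e₀ m))
        (small-+ {z = λ m → form (atM shiftᴿ m) (xs m)} iso (null⇒small width-norm-null))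
        where
        e : ∀ h l a b → h * a - b ≡ l * a - b + (h - l) * a
        e = solve-∀ ℚ-ring
        e₀ : ∀ m → defect A (his m) (xs m) ≡ form (atM shiftᴿ m) (xs m) + widths m * (xs m ∙ xs m)
        e₀ m = trans (e (his m) (los m) (xs m ∙ xs m) (xs m ∙ (A ⊛ xs m)))
          (cong (_+ widths m * (xs m ∙ xs m))
            (sym (trans (form-shiftᴿ m (xs m)) (form-shift A A-sym (los m) (xs m)))))

      residual-null : ∀ i → Null (λ m → residual A (his m) (xs m) i)
      residual-null i = null-square
        (0 , λ m _ → ℚ.≤-trans (term≤sum (λ j → square-nonneg (residual A (his m) (xs m) j)) i)
          (residual-bound A A-sym (his m) (B + B) 1≤2B (defect-his m) (defect-his-≤ m) (xs m)))
        (small-* {r = C²} {z = λ m → defect A (his m) (xs m)} (λ _ → C²)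
          (*-pos 0<2B 0<2B) (λ _ → ℚ.<⇒≤ (*-pos 0<2B 0<2B)) (0 , λ _ _ → ℚ.≤-refl) defect-small)
        where
        C² = (B + B) * (B + B)
        0<2B : 0ℚ < B + B
        0<2B = ℚ.<-≤-trans 0<1 1≤2B

      eigen-null : ∀ i → Null (λ m → (A ⊛ xs m) i - los m * xs m i)
      eigen-null i = null-cong (λ m → e (his m) (los m) (xs m i) ((A ⊛ xs m) i))
        (null-+ (null-* {b = λ m → xs m i} (small-nonneg⇒null 0≤widths widths-small) (cauchy⇒bounded (cauchy (x i))))
                (null-- (residual-null i)))
        where
        e : ∀ h l x a → (h - l) * x + - (h * x - a) ≡ a - l * x
        e = solve-∀ ℚ-ring

    eigenvalue : ∀ (A′ : Matrix n) → (∀ i j m → seq (A′ i j) m ≡ A i j) → ¬ ¬ (IsEigenvalue A′ μ)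
    eigenvalue A′ A′≡A none = isotropic shiftᴿ lower-witness λ (x , x≢0 , iso) →
      none (x , x≢0 , λ i → null-cong
        (λ m → cong (_- los m * seq (x i) m) (sym (trans (seq-sum (λ j → A′ i j *ᴿ x j) m)
           (sum-cong (λ j → cong (_* seq (x j) m) (A′≡A i j m))))))
        (eigen-null x iso i))

  -- Pairing C v - s v with v gives a null sequence `X`. If s ≥ t > τ eventually, then (t - τ) (v ∙
  -- v) ≤ - X, so v would tend to 0.
  eigenvalue-upper : ∀ (C : Mat n) (C′ : Matrix n) → (∀ i j m → seq (C′ i j) m ≡ C i j) →
    ∀ τ → (∀ y → y ∙ (C ⊛ y) ≤ τ * (y ∙ y)) →
    ∀ s → IsEigenvalue C′ s → ∀ t → τ < t → ¬ Eventually (λ m → t ≤ seq s m)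
  eigenvalue-upper C C′ C′≡C τ bnd s (v , v≢0 , eig) t τ<t t≤s = v≢0 λ i → null⇒≈0 (v i) (v-null i)
    where
    vs : ℕ → Vector ℚ _
    vs = atV v
    σ : ℕ → ℚ
    σ = seq s
    X : ℕ → ℚ
    X m = ∑ℚ.sum (λ i → ((C ⊛ vs m) i - σ m * vs m i) * vs m i)
    X-null : Null X
    X-null = null-sum (λ i m → ((C ⊛ vs m) i - σ m * vs m i) * vs m i) λ i →
      null-* {b = λ m → vs m i}
        (null-cong (λ m → cong (_- σ m * vs m i) (trans (seq-sum (λ j → C′ i j *ᴿ v j) m)
           (sum-cong (λ j → cong (_* vs m j) (C′≡C i j m))))) (eig i))
        (cauchy⇒bounded (cauchy (v i)))
    X≡ : ∀ m → X m ≡ vs m ∙ (C ⊛ vs m) - σ m * (vs m ∙ vs m)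
    X≡ m = trans (sum-cong (λ i → e₁ ((C ⊛ vs m) i) (σ m) (vs m i)))
      (trans (sum-linear (- σ m) (λ i → vs m i * (C ⊛ vs m) i) (λ i → vs m i * vs m i))
        (e₂ (vs m ∙ (C ⊛ vs m)) (σ m) (vs m ∙ vs m)))
      where
      e₁ : ∀ a s v → (a - s * v) * v ≡ v * a + - s * (v * v)
      e₁ = solve-∀ ℚ-ring
      e₂ : ∀ a s v → a + - s * v ≡ a - s * v
      e₂ = solve-∀ ℚ-ring
    inverse : ∃[ κ ] (0ℚ < κ × (t - τ) * κ ≡ 1ℚ)
    inverse = quotient (0<diff τ<t) 0<1
    κ : ℚ
    κ = proj₁ inverse
    0≤κ : 0ℚ ≤ κ
    0≤κ = ℚ.<⇒≤ (proj₁ (proj₂ inverse))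
    norm≤ : ∀ m → t ≤ σ m → vs m ∙ vs m ≤ κ * - X m
    norm≤ m t≤s = subst (_≤ κ * - X m) cancel (*-monoˡ-≤ 0≤κ (≤-by
        (trans (e t τ (σ m) N F) (cong (λ a → - a - (t - τ) * N) (sym (X≡ m))))
        (+-nonneg (0≤diff (bnd (vs m))) (*-nonneg (0≤diff t≤s) (norm-nonneg (vs m))))))
      where
      N F : ℚ
      N = vs m ∙ vs m
      F = vs m ∙ (C ⊛ vs m)
      e : ∀ t τ s n f → (τ * n - f) + (s - t) * n ≡ - (f - s * n) - (t - τ) * n
      e = solve-∀ ℚ-ring
      e₃ : ∀ k d n → k * (d * n) ≡ d * k * n
      e₃ = solve-∀ ℚ-ring
      cancel : κ * ((t - τ) * N) ≡ N
      cancel = trans (e₃ κ (t - τ) N) (trans (cong (_* N) (proj₂ (proj₂ inverse))) (ℚ.*-identityˡ N))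
    v-null : ∀ i → Null (λ m → vs m i)
    v-null i = null-square
      (ev-map (λ m t≤s → ℚ.≤-trans (term≤sum (λ j → square-nonneg (vs m j)) i) (norm≤ m t≤s)) t≤s)
      (small-* {r = κ} {z = λ m → - X m} (λ _ → κ) (proj₁ (proj₂ inverse)) (λ _ → 0≤κ) (0 , λ _ _ → ℚ.≤-refl)
        (null⇒small (null-- X-null)))

  module _ (A : Mat n) (A-sym : Symmetric A) (c : ℚ) (bnd : ∀ y → (A ⊛ y) ∙ (A ⊛ y) ≤ c * (y ∙ y)) where

    -- Expansion of the squared norm of A y - t y. The sign of t is free: t gives the upper bound
    -- `form≤`, and - t gives the lower bound `-form≤`.
    2t-form≤ : ∀ t y → (t + t) * (y ∙ (A ⊛ y)) ≤ (t * t + c) * (y ∙ y)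
    2t-form≤ t y = ≤-by e
        (+-nonneg (norm-nonneg ((A ⊛ y) +[ - t ] y)) (0≤diff (bnd y)))
      where
      expand : ((A ⊛ y) +[ - t ] y) ∙ ((A ⊛ y) +[ - t ] y) ≡
        ((A ⊛ y) ∙ (A ⊛ y) + - t * (y ∙ (A ⊛ y))) + - t * (y ∙ (A ⊛ y) + - t * (y ∙ y))
      expand = trans (∙-linearˡ (A ⊛ y) (- t) y ((A ⊛ y) +[ - t ] y))
        (cong₂ (λ a b → a + - t * b)
          (trans (∙-linearʳ (A ⊛ y) (- t) y (A ⊛ y)) (cong (λ a → (A ⊛ y) ∙ (A ⊛ y) + - t * a) (∙-comm (A ⊛ y) y)))
          (∙-linearʳ (A ⊛ y) (- t) y y))
      e₀ : ∀ t c a b d → ((a + - t * b) + - t * (b + - t * d)) + (c * d - a) ≡ (t * t + c) * d - (t + t) * b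
      e₀ = solve-∀ ℚ-ring
      e : ((A ⊛ y) +[ - t ] y) ∙ ((A ⊛ y) +[ - t ] y) + (c * (y ∙ y) - (A ⊛ y) ∙ (A ⊛ y))
          ≡ (t * t + c) * (y ∙ y) - (t + t) * (y ∙ (A ⊛ y))
      e = trans (cong (_+ (c * (y ∙ y) - (A ⊛ y) ∙ (A ⊛ y))) expand)
            (e₀ t c ((A ⊛ y) ∙ (A ⊛ y)) (y ∙ (A ⊛ y)) (y ∙ y))

    form≤ : ∀ t → 0ℚ < t → c ≤ t * t → ∀ y → y ∙ (A ⊛ y) ≤ t * (y ∙ y)
    form≤ t 0<t c≤t² y = diff⇒≤ (*-cancelˡ-nonneg (ℚ.+-mono-< 0<t 0<t) (subst (0ℚ ≤_)
        (e t c (y ∙ y) (y ∙ (A ⊛ y)))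
        (+-nonneg (0≤diff (2t-form≤ t y)) (*-nonneg (0≤diff c≤t²) (norm-nonneg y)))))
      where
      e : ∀ t c n f → ((t * t + c) * n - (t + t) * f) + (t * t - c) * n ≡ (t + t) * (t * n - f)
      e = solve-∀ ℚ-ring

    -form≤ : ∀ t → 0ℚ < t → c ≤ t * t → ∀ y → - (y ∙ (A ⊛ y)) ≤ t * (y ∙ y)
    -form≤ t 0<t c≤t² y = diff⇒≤ (*-cancelˡ-nonneg (ℚ.+-mono-< 0<t 0<t) (subst (0ℚ ≤_)
        (e t c (y ∙ y) (y ∙ (A ⊛ y)))
        (+-nonneg (0≤diff (2t-form≤ (- t) y)) (*-nonneg (0≤diff c≤t²) (norm-nonneg y)))))
      where
      e : ∀ t c n f → ((- t * - t + c) * n - (- t + - t) * f) + (t * t - c) * n ≡ (t + t) * (t * n - - f)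
      e = solve-∀ ℚ-ring

    -- Dividing `2t-form≤` by 2 t gives τ = (t² + c) / (2 t), Heron's step towards the root of c,
    -- which lies below t because c < t². The gap absorbs the ε in comparisons of reals.
    form≤-strict : ∀ t → 0ℚ < t → 0ℚ ≤ c → c < t * t →
      ∃[ τ ] (τ < t × (∀ y → y ∙ (A ⊛ y) ≤ τ * (y ∙ y)))
    form≤-strict t 0<t 0≤c c<t² with quotient (ℚ.+-mono-< 0<t 0<t) (ℚ.<-≤-trans (*-pos 0<t 0<t)
        (subst (_≤ t * t + c) (ℚ.+-identityʳ (t * t)) (ℚ.+-monoʳ-≤ (t * t) 0≤c)))
    ... | τ , _ , 2tτ≡ = τ , τ<t , bound
      where
      0<2t : 0ℚ < t + t
      0<2t = ℚ.+-mono-< 0<t 0<t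
      τ<t : τ < t
      τ<t = ℚ.*-cancelˡ-<-nonNeg (t + t) {{ℚ.nonNegative (ℚ.<⇒≤ 0<2t)}}
        (subst₂ _<_ (sym 2tτ≡) (sym (ℚ.*-distribʳ-+ t t t)) (ℚ.+-monoʳ-< (t * t) c<t²))
      bound : ∀ y → y ∙ (A ⊛ y) ≤ τ * (y ∙ y)
      bound y = ℚ.*-cancelˡ-≤-pos (t + t) {{ℚ.positive 0<2t}}
        (subst ((t + t) * (y ∙ (A ⊛ y)) ≤_)
          (trans (cong (_* (y ∙ y)) (sym 2tτ≡)) (ℚ.*-assoc (t + t) τ (y ∙ y))) (2t-form≤ t y))

  defect-zero : ∀ (A : Mat n) q {y} → (∀ i → y i ≡ 0ℚ) → defect A q y ≡ 0ℚ
  defect-zero A q {y} y≡0 = trans (cong₂ (λ a b → q * a - b)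
      (sum-zero (λ i → trans (cong (_* y i) (y≡0 i)) (ℚ.*-zeroˡ (y i))))
      (sum-zero (λ i → trans (cong (_* (A ⊛ y) i) (y≡0 i)) (ℚ.*-zeroˡ ((A ⊛ y) i)))))
    (e q)
    where
    e : ∀ q → q * 0ℚ - 0ℚ ≡ 0ℚ
    e = solve-∀ ℚ-ring

  nonzero? : (y : Vector ℚ n) → NonZero y ⊎ (∀ i → y i ≡ 0ℚ)
  nonzero? y with any? (λ i → ¬? (y i ℚ.≟ 0ℚ))
  ... | yes found = inj₁ found
  ... | no none   = inj₂ zeros
    where
    zeros : ∀ i → y i ≡ 0ℚ
    zeros i with y i ℚ.≟ 0ℚ
    ... | yes eq = eq
    ... | no neq = contradiction (i , neq) none

  -- Were the quotient at `y` above `t`, bisection from `t` would give an eigenvalue μ ≥ t of A,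
  -- whence t ≤ μ ≤ r ≤ s; but the norm bound on C keeps its eigenvalue s below t. `B` only has to
  -- provide some finite upper end for the bisection.
  rayleigh : ∀ (A : Mat n) → Symmetric A → (A′ : Matrix n) → (∀ i j m → seq (A′ i j) m ≡ A i j) →
    ∀ B → 1ℚ ≤ B → (∀ y → (A ⊛ y) ∙ (A ⊛ y) ≤ (B * B) * (y ∙ y)) →
    ∀ (C : Mat k) → Symmetric C → (C′ : Matrix k) → (∀ i j m → seq (C′ i j) m ≡ C i j) →
    ∀ c → 0ℚ ≤ c → (∀ y → (C ⊛ y) ∙ (C ⊛ y) ≤ c * (y ∙ y)) →
    ∀ r s → IsLargestEigenvalue A′ r → IsEigenvalue C′ s → r ≤ᴿ s →
    ∀ t → 0ℚ < t → c < t * t → ∀ y → y ∙ (A ⊛ y) ≤ t * (y ∙ y)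
  rayleigh A A-sym A′ A′≡A B 1≤B A-bnd C C-sym C′ C′≡C c 0≤c C-bnd r s (_ , r-top) s-eig r≤s t 0<t c<t² y
    with y ∙ (A ⊛ y) ℚ.≤? t * (y ∙ y)
  ... | yes h = h
  ... | no h = contradiction (λ (eig : IsEigenvalue A′ μ) → absurd (r-top μ eig)) (eigenvalue A′ A′≡A)
    where
    0<B : 0ℚ < B
    0<B = ℚ.<-≤-trans 0<1 1≤B
    d<0 : defect A t y < 0ℚ
    d<0 = subst (_< 0ℚ) (e (t * (y ∙ y)) (y ∙ (A ⊛ y))) (ℚ.neg-antimono-< (0<diff (ℚ.≰⇒> h)))
      where
      e : ∀ a b → - (b - a) ≡ a - b
      e = solve-∀ ℚ-ring
    y≢0 : NonZero y
    y≢0 with nonzero? y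
    ... | inj₁ nz = nz
    ... | inj₂ z = contradiction (defect-zero A t z) (ℚ.<⇒≢ d<0)
    open Bisection A A-sym B 1≤B
      (form≤ A A-sym (B * B) A-bnd B 0<B ℚ.≤-refl)
      (-form≤ A A-sym (B * B) A-bnd B 0<B ℚ.≤-refl)
      t y y≢0 (ℚ.<⇒≤ d<0)
    strict : ∃[ τ ] (τ < t × (∀ z → z ∙ (C ⊛ z) ≤ τ * (z ∙ z)))
    strict = form≤-strict C C-sym c C-bnd t 0<t 0≤c c<t²
    τ τ′ ε : ℚ
    τ = proj₁ strict
    τ<t : τ < t
    τ<t = proj₁ (proj₂ strict)
    -- The two comparisons μ ≤ r and r ≤ s each lose ε, a quarter of t - τ, so together they leave s
    -- at or above the midpoint τ′, still above τ.
    τ′ = ½ * (τ + t)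
    ε = ½ * (½ * (t - τ))
    0<ε : 0ℚ < ε
    0<ε = ½-pos (½-pos (0<diff τ<t))
    τ<τ′ : τ < τ′
    τ<τ′ = diff⇒< (subst (0ℚ <_) (e τ t) (½-pos (0<diff τ<t)))
      where
      e : ∀ τ t → ½ * (t - τ) ≡ ½ * (τ + t) - τ
      e = solve-∀ ℚ-ring
    absurd : ¬ (μ ≤ᴿ r)
    absurd μ≤r = eigenvalue-upper C C′ C′≡C τ (proj₂ (proj₂ strict)) s s-eig τ′ τ<τ′
      (ev-zip bound (μ≤r ε 0<ε) (r≤s ε 0<ε))
      where
      e : ∀ τ t m r s → (m - t) + (r + ½ * (½ * (t - τ)) - m) + (s + ½ * (½ * (t - τ)) - r) ≡ s - ½ * (τ + t)
      e = solve-∀ ℚ-ring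
      bound : ∀ m → los m < seq r m + ε → seq r m < seq s m + ε → τ′ ≤ seq s m
      bound m μ<r r<s = ≤-by (e τ t (los m) (seq r m) (seq s m))
        (+-nonneg (+-nonneg (0≤diff (t≤μ m)) (0≤diff (ℚ.<⇒≤ μ<r))) (0≤diff (ℚ.<⇒≤ r<s)))

  -- Rational stand-ins for the root of c, from above. The fixed range from 1 to c + 1 lets
  -- `two-step-bound` choose its ε before t is known.
  module SquareRoot (c : ℚ) (1≤c : 1ℚ ≤ c) where

    record Enclosure : Set where
      constructor enclosure
      field
        a b  : ℚ
        1≤a  : 1ℚ ≤ a
        a≤b  : a ≤ b
        b≤   : b ≤ c + 1ℚ
        a²≤c : a * a ≤ c
        c<b² : c < b * b

    open Enclosure

    middle : Enclosure → ℚ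
    middle E = midpoint (a E) (b E)

    a≤middle : ∀ E → a E ≤ middle E
    a≤middle E = ≤midpoint (a≤b E)

    middle≤b : ∀ E → middle E ≤ b E
    middle≤b E = midpoint≤ (a≤b E)

    improve-with : ∀ E → Dec (c < middle E * middle E) → Enclosure
    improve-with E (yes c<m²) = enclosure (a E) (middle E) (1≤a E) (a≤middle E)
      (ℚ.≤-trans (middle≤b E) (b≤ E)) (a²≤c E) c<m²
    improve-with E (no c≮m²) = enclosure (middle E) (b E) (ℚ.≤-trans (1≤a E) (a≤middle E)) (middle≤b E)
      (b≤ E) (ℚ.≮⇒≥ c≮m²) (c<b² E)

    improve : Enclosure → Enclosure
    improve E = improve-with E (c ℚ.<? middle E * middle E)

    gap : Enclosure → ℚ
    gap E = b E - a E

    gap-improve : ∀ E → gap (improve E) ≡ ½ * gap E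
    gap-improve E = go (c ℚ.<? middle E * middle E)
      where
      go : ∀ d → gap (improve-with E d) ≡ ½ * gap E
      go (yes _) = lower-half (a E) (b E)
      go (no _)  = upper-half (a E) (b E)

    enclosures : ℕ → Enclosure
    enclosures zero    = enclosure 1ℚ (c + 1ℚ) ℚ.≤-refl
      (≤-by (e₁ c) 0≤c) ℚ.≤-refl 1≤c
      (diff⇒< (subst (0ℚ <_) (e₂ c) (ℚ.+-mono-≤-< (+-nonneg 0≤c (*-nonneg 0≤c 0≤c)) 0<1)))
      where
      0≤c : 0ℚ ≤ c
      0≤c = ℚ.≤-trans 0≤1 1≤c
      e₁ : ∀ c → c ≡ c + 1ℚ - 1ℚ
      e₁ = solve-∀ ℚ-ring
      e₂ : ∀ c → c + c * c + 1ℚ ≡ (c + 1ℚ) * (c + 1ℚ) - c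
      e₂ = solve-∀ ℚ-ring
    enclosures (suc m) = improve (enclosures m)

    gap-small : Small (λ m → gap (enclosures m))
    gap-small = halving-small (λ m → gap (enclosures m)) (λ m → gap-improve (enclosures m))
      (0≤diff (a≤b (enclosures 0)))

    approximate : ∀ ε → 0ℚ < ε → ∃[ t ] (1ℚ ≤ t × t ≤ c + 1ℚ × c < t * t × t * t - c ≤ ε)
    approximate ε 0<ε =
      let m , gap<δ = ev-witness (gap-small (proj₁ δ) (proj₁ (proj₂ δ)))
          E = enclosures m
      in b E , ℚ.≤-trans (1≤a E) (a≤b E) , b≤ E , c<b² E , close E (ℚ.<⇒≤ gap<δ)
      where
      D : ℚ
      -- From a² ≤ c follows b² - c ≤ (b - a) (a + b), and a + b ≤ `D`.
      D = (c + 1ℚ) + (c + 1ℚ)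
      0≤c+1 : 0ℚ ≤ c + 1ℚ
      0≤c+1 = +-nonneg (ℚ.≤-trans 0≤1 1≤c) 0≤1
      0<D : 0ℚ < D
      0<D = ℚ.+-mono-<-≤ (ℚ.+-mono-<-≤ (ℚ.<-≤-trans 0<1 1≤c) 0≤1) 0≤c+1
      δ : ∃[ δ ] (0ℚ < δ × D * δ ≡ ε)
      δ = quotient 0<D 0<ε
      e : ∀ c a b δ → ((c - a * a) + (b - a) * ((c + 1ℚ - b) + ((c + 1ℚ - b) + (b - a)))) + ((c + 1ℚ) + (c + 1ℚ)) * (δ - (b - a))
        ≡ ((c + 1ℚ) + (c + 1ℚ)) * δ - (b * b - c)
      e = solve-∀ ℚ-ring
      close : ∀ E → gap E ≤ proj₁ δ → b E * b E - c ≤ ε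
      close E h = subst (b E * b E - c ≤_) (proj₂ (proj₂ δ)) (≤-by (e c (a E) (b E) (proj₁ δ))
        (+-nonneg (+-nonneg (0≤diff (a²≤c E)) (*-nonneg 0≤gap (+-nonneg b≤′ (+-nonneg b≤′ 0≤gap))))
                  (*-nonneg (ℚ.<⇒≤ 0<D) (0≤diff h))))
        where
        0≤gap : 0ℚ ≤ gap E
        0≤gap = 0≤diff (a≤b E)
        b≤′ : 0ℚ ≤ c + 1ℚ - b E
        b≤′ = 0≤diff (b≤ E)

  -- With y = A x + t x and t² slightly above c, the bound y ∙ A y ≤ t (y ∙ y)
  -- becomes y ∙ A² x ≤ t² (y ∙ x).
  two-step-bound : ∀ (A : Mat n) → Symmetric A → (∀ i j → 0ℚ ≤ A i j) → ∀ c → 1ℚ ≤ c →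
    (∀ t → 0ℚ < t → c < t * t → ∀ y → y ∙ (A ⊛ y) ≤ t * (y ∙ y)) →
    ∀ x → (∀ i → 0ℚ ≤ x i) → (∀ i → c * x i ≤ (A ⊛ (A ⊛ x)) i) →
    x ∙ (A ⊛ (A ⊛ x)) ≤ c * (x ∙ x)
  two-step-bound A A-sym 0≤A c 1≤c bnd x 0≤x cx≤ = ℚ.≮⇒≥ λ h → absurd (0<diff h)
    where
    Ax A²x : Vector ℚ _
    Ax = A ⊛ x
    A²x = A ⊛ (A ⊛ x)
    α K : ℚ
    α = x ∙ Ax
    -- With κ the supposed excess, the choice ε = κ / K is contradictory: for t² - c ≤ ε, `core`
    -- gives κ ≤ t κ ≤ ε (α + (c + 1) (x ∙ x)) = κ - ε.
    K = α + (c + 1ℚ) * (x ∙ x) + 1ℚ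
    0≤α : 0ℚ ≤ α
    0≤α = ∙-nonneg 0≤x (⊛-nonneg 0≤A 0≤x)
    0≤c : 0ℚ ≤ c
    0≤c = ℚ.≤-trans 0≤1 1≤c
    0<K : 0ℚ < K
    0<K = ℚ.+-mono-≤-< (+-nonneg 0≤α (*-nonneg (+-nonneg 0≤c 0≤1) (norm-nonneg x))) 0<1
    -- The bound on y ∙ A² x contains the term Ax ∙ A² x, which is at least c α: pair c x ≤ A² x
    -- with the nonnegative vector A x. Subtracting leaves the factor t² - c on the right.
    core : ∀ t → 1ℚ ≤ t → c < t * t → t * (x ∙ A²x - c * (x ∙ x)) ≤ (t * t - c) * (α + t * (x ∙ x))
    core t 1≤t c<t² = ≤-by (e t c (x ∙ A²x) (x ∙ x) α (Ax ∙ A²x))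
        (+-nonneg (0≤diff yA²x≤) (0≤diff cα≤))
      where
      y : Vector ℚ _
      y = Ax +[ t ] x
      e : ∀ t c β n α γ → (t * t * (α + t * n) - (γ + t * β)) + (γ - c * α) ≡ (t * t - c) * (α + t * n) - t * (β - c * n)
      e = solve-∀ ℚ-ring
      cα≤ : c * α ≤ Ax ∙ A²x
      cα≤ = subst (_≤ Ax ∙ A²x) (trans (sum-cong (λ i → e₃ (Ax i) c (x i))) (sym (∑ℚ.*-distribˡ-sum c (λ i → x i * Ax i))))
        (sum-mono (λ i → *-monoˡ-≤ (⊛-nonneg 0≤A 0≤x i) (cx≤ i)))
        where
        e₃ : ∀ a c x → a * (c * x) ≡ c * (x * a)
        e₃ = solve-∀ ℚ-ring
      yAy : y ∙ (A ⊛ y) ≡ y ∙ A²x + t * (y ∙ Ax)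
      yAy = trans (∙-cong {x = y} {x′ = y} (λ _ → refl) (⊛-linear A Ax t x)) (∙-linearʳ A²x t Ax y)
      yy : y ∙ y ≡ y ∙ Ax + t * (y ∙ x)
      yy = ∙-linearʳ Ax t x y
      e₄ : ∀ t a b d → t * (b + t * d) - (a + t * b) ≡ t * t * d - a
      e₄ = solve-∀ ℚ-ring
      yx : y ∙ x ≡ α + t * (x ∙ x)
      yx = trans (∙-linearˡ Ax t x x) (cong (_+ t * (x ∙ x)) (∙-comm Ax x))
      yA²x : y ∙ A²x ≡ Ax ∙ A²x + t * (x ∙ A²x)
      yA²x = ∙-linearˡ Ax t x A²x
      yA²x≤ : Ax ∙ A²x + t * (x ∙ A²x) ≤ t * t * (α + t * (x ∙ x))
      yA²x≤ = subst₂ (λ a b → a ≤ t * t * b) yA²x yx (≤-by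
        (trans (cong₂ (λ a b → t * a - b) yy yAy) (e₄ t (y ∙ A²x) (y ∙ Ax) (y ∙ x)))
        (0≤diff (bnd t (ℚ.<-≤-trans 0<1 1≤t) c<t² y)))
    absurd : ¬ (0ℚ < x ∙ A²x - c * (x ∙ x))
    absurd 0<κ =
      let ε , 0<ε , Kε≡κ = quotient 0<K 0<κ
          t , 1≤t , t≤ , c<t² , η≤ε = SquareRoot.approximate c 1≤c ε 0<ε
      in collapse ε 0<ε Kε≡κ t 1≤t t≤ η≤ε (core t 1≤t c<t²)
      where
      κ N : ℚ
      κ = x ∙ A²x - c * (x ∙ x)
      N = x ∙ x
      e : ∀ t c κ α n ε →
        ((t * t - c) * (α + t * n) - t * κ) + (t - 1ℚ) * κ + (ε - (t * t - c)) * (α + t * n) + ε * (c + 1ℚ - t) * n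
        ≡ ((α + (c + 1ℚ) * n + 1ℚ) * ε - κ) + (0ℚ - ε)
      e = solve-∀ ℚ-ring
      collapse : ∀ ε → 0ℚ < ε → K * ε ≡ κ → ∀ t → 1ℚ ≤ t → t ≤ c + 1ℚ → t * t - c ≤ ε →
                 t * κ ≤ (t * t - c) * (α + t * N) → ⊥
      collapse ε 0<ε Kε≡κ t 1≤t t≤ η≤ε h = <⇒≱ 0<ε (≤-by final (+-nonneg (+-nonneg (+-nonneg
              (0≤diff h)
              (*-nonneg (0≤diff 1≤t) (ℚ.<⇒≤ 0<κ)))
              (*-nonneg (0≤diff η≤ε) (+-nonneg 0≤α (*-nonneg 0≤t (norm-nonneg x)))))
              (*-nonneg (*-nonneg (ℚ.<⇒≤ 0<ε) (0≤diff t≤)) (norm-nonneg x))))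
        where
        0≤t : 0ℚ ≤ t
        0≤t = ℚ.≤-trans 0≤1 1≤t
        final : ((t * t - c) * (α + t * N) - t * κ) + (t - 1ℚ) * κ + (ε - (t * t - c)) * (α + t * N)
                + ε * (c + 1ℚ - t) * N ≡ 0ℚ - ε
        final = trans (e t c κ α N ε)
          (trans (cong (λ a → (a - κ) + (0ℚ - ε)) Kε≡κ)
            (trans (cong (_+ (0ℚ - ε)) (ℚ.+-inverseʳ κ)) (ℚ.+-identityˡ (0ℚ - ε))))

  -- The numbers x j (A² x - c x) j are nonnegative, and by `two-step-bound` their sum is at most 0,
  -- so each of them is at most 0.
  two-step-tight : ∀ (A : Mat n) → Symmetric A → (∀ i j → 0ℚ ≤ A i j) → ∀ c → 1ℚ ≤ c →
    (∀ t → 0ℚ < t → c < t * t → ∀ y → y ∙ (A ⊛ y) ≤ t * (y ∙ y)) →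
    ∀ x → (∀ i → 0ℚ ≤ x i) → (∀ i → c * x i ≤ (A ⊛ (A ⊛ x)) i) →
    ∀ i → x i * (A ⊛ (A ⊛ x)) i ≤ x i * (c * x i)
  two-step-tight A A-sym 0≤A c 1≤c bnd x 0≤x cx≤ i = ≤-by (e (x i) ((A ⊛ (A ⊛ x)) i) (c * x i))
      (0≤diff (ℚ.≤-trans (term≤sum (λ j → *-nonneg (0≤x j) (0≤diff (cx≤ j))) i) total≤0))
    where
    A²x : Vector ℚ _
    A²x = A ⊛ (A ⊛ x)
    e : ∀ x a d → 0ℚ - x * (a - d) ≡ x * d - x * a
    e = solve-∀ ℚ-ring
    e₁ : ∀ x a c → x * (a - c * x) ≡ x * a + - c * (x * x)
    e₁ = solve-∀ ℚ-ring
    e₂ : ∀ a c n → c * n - a ≡ 0ℚ - (a + - c * n)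
    e₂ = solve-∀ ℚ-ring
    total≤0 : ∑ℚ.sum (λ j → x j * (A²x j - c * x j)) ≤ 0ℚ
    total≤0 = subst (_≤ 0ℚ) (sym (trans (sum-cong (λ j → e₁ (x j) (A²x j) c))
        (sum-linear (- c) (λ j → x j * A²x j) (λ j → x j * x j))))
      (≤-by (e₂ (x ∙ A²x) c (x ∙ x))
        (0≤diff (two-step-bound A A-sym 0≤A c 1≤c bnd x 0≤x cx≤)))

  -- Walks in graphs

  0≤ι : ∀ a → 0ℚ ≤ ι a
  0≤ι zero    = ℚ.≤-refl
  0≤ι (suc a) = +-nonneg 0≤1 (0≤ι a)

  ι-+ : ∀ a b → ι (a ℕ.+ b) ≡ ι a + ι b
  ι-+ zero    b = sym (ℚ.+-identityˡ (ι b))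
  ι-+ (suc a) b = trans (cong (1ℚ +_) (ι-+ a b)) (sym (ℚ.+-assoc 1ℚ (ι a) (ι b)))

  ι-* : ∀ a b → ι (a ℕ.* b) ≡ ι a * ι b
  ι-* zero    b = sym (ℚ.*-zeroˡ (ι b))
  ι-* (suc a) b = trans (ι-+ b (a ℕ.* b)) (trans (cong (ι b +_) (ι-* a b)) (e (ι a) (ι b)))
    where
    e : ∀ a b → b + a * b ≡ (1ℚ + a) * b
    e = solve-∀ ℚ-ring

  ι-sum : ∀ (f : Vector ℕ n) → ι (∑ℕ.sum f) ≡ ∑ℚ.sum (λ i → ι (f i))
  ι-sum {zero}  f = refl
  ι-sum {suc n} f = trans (ι-+ (f zero) (∑ℕ.sum (f ∘ suc))) (cong (ι (f zero) +_) (ι-sum (f ∘ suc)))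

  ι-mono : ∀ {a b} → a ℕ.≤ b → ι a ≤ ι b
  ι-mono {b = b} ℕ.z≤n = 0≤ι b
  ι-mono (ℕ.s≤s a≤b)   = ℚ.+-monoʳ-≤ 1ℚ (ι-mono a≤b)

  ι-cancel : ∀ {a b} → ι a ≤ ι b → a ℕ.≤ b
  ι-cancel {a} {b} h = ℕ.≮⇒≥ λ b<a → <⇒≱
    (subst (_< 1ℚ + ι b) (ℚ.+-identityˡ (ι b)) (ℚ.+-monoˡ-< (ι b) 0<1))
    (ℚ.≤-trans (ι-mono b<a) h)

  -- With d the total weight, s = `a ∙ y` and P the weighted sum of squares, the sum of a i (d y i -
  -- s)² equals d (d P - s²); this form avoids dividing by d. If d is not positive, all weights
  -- vanish.
  weighted-cauchy-schwarz : ∀ (a y : Vector ℚ n) → (∀ i → 0ℚ ≤ a i) →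
    (a ∙ y) * (a ∙ y) ≤ ∑ℚ.sum a * ∑ℚ.sum (λ i → a i * (y i * y i))
  weighted-cauchy-schwarz a y 0≤a with 0ℚ ℚ.<? ∑ℚ.sum a
  ... | no d≯0 = ℚ.≤-reflexive (trans
      (cong (λ s → s * s) (sum-zero (λ i → trans (cong (_* y i) (a≡0 i)) (ℚ.*-zeroˡ (y i)))))
      (sym (trans (cong (_* ∑ℚ.sum (λ i → a i * (y i * y i))) (sum-zero a≡0))
        (ℚ.*-zeroˡ (∑ℚ.sum (λ i → a i * (y i * y i)))))))
    where
    a≡0 : ∀ i → a i ≡ 0ℚ
    a≡0 i = ℚ.≤-antisym (ℚ.≤-trans (term≤sum 0≤a i) (ℚ.≮⇒≥ d≯0)) (0≤a i)
  ... | yes 0<d = diff⇒≤ (*-cancelˡ-nonneg 0<d (subst (0ℚ ≤_) total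
      (sum-nonneg (λ i → *-nonneg (0≤a i) (square-nonneg (d * y i - s))))))
    where
    d s P : ℚ
    d = ∑ℚ.sum a
    s = a ∙ y
    P = ∑ℚ.sum (λ i → a i * (y i * y i))
    e₁ : ∀ a y d s → a * ((d * y - s) * (d * y - s)) ≡ (s * s * a + - (d * s + d * s) * (a * y)) + d * d * (a * (y * y))
    e₁ = solve-∀ ℚ-ring
    e₂ : ∀ d s P → (s * s * d + - (d * s + d * s) * s) + d * d * P ≡ d * (d * P - s * s)
    e₂ = solve-∀ ℚ-ring
    total : ∑ℚ.sum (λ i → a i * ((d * y i - s) * (d * y i - s))) ≡ d * (d * P - s * s)
    total = trans (sum-cong (λ i → e₁ (a i) (y i) d s))
      (trans (sum-linear (d * d) (λ i → s * s * a i + - (d * s + d * s) * (a i * y i)) (λ i → a i * (y i * y i)))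
        (trans (cong (_+ d * d * P) (trans (sum-linear (- (d * s + d * s)) (λ i → s * s * a i) (λ i → a i * y i))
                 (cong (_+ - (d * s + d * s) * s) (sym (∑ℚ.*-distribˡ-sum (s * s) a)))))
          (e₂ d s P)))

  matrix : Relation n → Mat n
  matrix D u v = ι ⟦ D u v ⟧

  -- A Schur test: the hypothesis bounds the row sums of A². Cauchy-Schwarz is applied in each row
  -- with the entries as weights, and exchanging the summations makes these row sums the
  -- coefficients of the squares.
  norm-bound : ∀ (D : Relation n) → (∀ u v → D u v ≡ D v u) → ∀ c →
    (∀ u → ∑ℕ.sum (λ v → ⟦ D u v ⟧ ℕ.* count (D v)) ℕ.≤ c) →
    ∀ y → (matrix D ⊛ y) ∙ (matrix D ⊛ y) ≤ ι c * (y ∙ y)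
  norm-bound D D-sym c bnd y = begin
    ∑ℚ.sum (λ u → (A ⊛ y) u * (A ⊛ y) u)
      ≤⟨ sum-mono (λ u → weighted-cauchy-schwarz (A u) y (λ v → 0≤ι ⟦ D u v ⟧)) ⟩
    ∑ℚ.sum (λ u → d u * ∑ℚ.sum (λ v → A u v * (y v * y v)))
      ≡⟨ sum-cong (λ u → ∑ℚ.*-distribˡ-sum (d u) (λ v → A u v * (y v * y v))) ⟩
    ∑ℚ.sum (λ u → ∑ℚ.sum (λ v → d u * (A u v * (y v * y v))))
      ≡⟨ ∑ℚ.∑-comm (λ u v → d u * (A u v * (y v * y v))) ⟩
    ∑ℚ.sum (λ v → ∑ℚ.sum (λ u → d u * (A u v * (y v * y v))))
      ≡⟨ sum-cong (λ v → trans (sum-cong (λ u → trans (e (d u) (A u v) (y v * y v))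
           (cong (λ b → ι ⟦ b ⟧ * d u * (y v * y v)) (D-sym u v))))
           (sym (∑ℚ.*-distribʳ-sum (y v * y v) (λ u → A v u * d u)))) ⟩
    ∑ℚ.sum (λ v → ∑ℚ.sum (λ u → A v u * d u) * (y v * y v))
      ≤⟨ sum-mono (λ v → subst₂ _≤_ (ℚ.*-comm (y v * y v) _) (ℚ.*-comm (y v * y v) (ι c))
           (*-monoˡ-≤ (square-nonneg (y v)) (row-bound v))) ⟩
    ∑ℚ.sum (λ v → ι c * (y v * y v))
      ≡⟨ ∑ℚ.*-distribˡ-sum (ι c) (λ v → y v * y v) ⟨
    ι c * (y ∙ y) ∎
    where
    open ℚ.≤-Reasoning
    A = matrix D
    d : Fin _ → ℚ
    d u = ∑ℚ.sum (A u)
    e : ∀ d a y → d * (a * y) ≡ a * d * y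
    e = solve-∀ ℚ-ring
    row-bound : ∀ v → ∑ℚ.sum (λ u → A v u * d u) ≤ ι c
    row-bound v = subst (_≤ ι c) (trans (ι-sum (λ u → ⟦ D v u ⟧ ℕ.* count (D u)))
        (sum-cong (λ u → trans (ι-* ⟦ D v u ⟧ (count (D u))) (cong (A v u *_) (ι-sum (λ x → ⟦ D u x ⟧))))))
      (ι-mono (bnd v))

  adjacency-seq : ∀ (G : Graph n) i j m → seq (adjacencyMatrix G i j) m ≡ matrix (adj G) i j
  adjacency-seq G i j m with adj G i j
  ... | true  = refl
  ... | false = refl

  -- The test vector x is the indicator of `w`. The assumption on walks says c x ≤ A² x, and
  -- `two-step-tight` turns this into equality on the support of x.
  spectral⇒tight : ∀ (G : Graph n) (F : Graph k) r s → IsSpectralRadius G r → IsSpectralRadius F s → r ≤ᴿ s →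
    ∀ c → 1 ℕ.≤ c → (∀ u → ∑ℕ.sum (λ v → ⟦ adj F u v ⟧ ℕ.* count (adj F v)) ℕ.≤ c) → Tight (adj G) c
  spectral⇒tight {n} G F r s ρG ρF r≤s c 1≤c bnd w many u wu = ℕ.≤-antisym
    (ι-cancel (subst₂ _≤_ (xA²x≡ u wu) (xcx≡ u wu) (two-step-tight A A-sym (λ i j → 0≤ι ⟦ adj G i j ⟧) (ι c) (ι-mono 1≤c)
      (rayleigh A A-sym (adjacencyMatrix G) (adjacency-seq G) (ι (suc n)) (ι-mono {1} {suc n} (ℕ.s≤s ℕ.z≤n))
        (λ y → subst (λ b → (A ⊛ y) ∙ (A ⊛ y) ≤ b * (y ∙ y)) (ι-* (suc n) (suc n))
          (norm-bound (adj G) (symmetric G) (suc n ℕ.* suc n) crude y))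
        (matrix (adj F)) (λ i j → cong (λ b → ι ⟦ b ⟧) (symmetric F i j)) (adjacencyMatrix F) (adjacency-seq F)
        (ι c) (0≤ι c) (norm-bound (adj F) (symmetric F) c bnd) r s ρG (proj₁ ρF) r≤s)
      x (λ i → 0≤ι ⟦ w i ⟧) cx≤ u)))
    (many u wu)
    where
    A : Mat n
    A = matrix (adj G)
    A-sym : Symmetric A
    A-sym i j = cong (λ b → ι ⟦ b ⟧) (symmetric G i j)
    x : Vector ℚ n
    x i = ι ⟦ w i ⟧
    -- Any bound starts the bisection. The successor keeps it at least 1 even when n = 0.
    crude : ∀ u → ∑ℕ.sum (λ v → ⟦ adj G u v ⟧ ℕ.* count (adj G v)) ℕ.≤ suc n ℕ.* suc n
    crude u = ℕ.≤-trans (∑-mono (λ v → ℕ.*-mono-≤ (⟦⟧≤1 (adj G u v)) (count≤n (adj G v))))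
      (ℕ.≤-trans (ℕ.≤-reflexive (trans (∑-const n (1 ℕ.* n)) (cong (n ℕ.*_) (ℕ.*-identityˡ n))))
        (ℕ.*-mono-≤ (ℕ.n≤1+n n) (ℕ.n≤1+n n)))
    A²x≡ : ∀ i → ι (twoWalks (adj G) w i) ≡ (A ⊛ (A ⊛ x)) i
    A²x≡ i = trans (ι-sum (λ v → ⟦ adj G i v ⟧ ℕ.* ∑ℕ.sum (walks v)))
      (sum-cong λ v → trans (ι-* ⟦ adj G i v ⟧ (∑ℕ.sum (walks v)))
        (cong (A i v *_) (trans (ι-sum (walks v)) (sum-cong λ z → ι-* ⟦ adj G v z ⟧ ⟦ w z ⟧))))
      where
      walks : Fin n → Fin n → ℕ
      walks v z = ⟦ adj G v z ⟧ ℕ.* ⟦ w z ⟧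
    T⇒x≡1 : ∀ i → T (w i) → x i ≡ 1ℚ
    T⇒x≡1 i wi with w i
    ... | true = refl
    cx≤ : ∀ i → ι c * x i ≤ (A ⊛ (A ⊛ x)) i
    cx≤ i = subst (ι c * x i ≤_) (A²x≡ i) (go (w i) refl)
      where
      go : ∀ b → w i ≡ b → ι c * ι ⟦ w i ⟧ ≤ ι (twoWalks (adj G) w i)
      go true  e = subst (_≤ ι (twoWalks (adj G) w i))
        (sym (trans (cong (λ b → ι c * ι ⟦ b ⟧) e) (ℚ.*-identityʳ (ι c)))) (ι-mono (many i (subst T (sym e) _)))
      go false e = subst (_≤ ι (twoWalks (adj G) w i))
        (sym (trans (cong (λ b → ι c * ι ⟦ b ⟧) e) (ℚ.*-zeroʳ (ι c)))) (0≤ι (twoWalks (adj G) w i))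
    xA²x≡ : ∀ i → T (w i) → x i * (A ⊛ (A ⊛ x)) i ≡ ι (twoWalks (adj G) w i)
    xA²x≡ i wi = trans (cong₂ _*_ (T⇒x≡1 i wi) (sym (A²x≡ i))) (ℚ.*-identityˡ (ι (twoWalks (adj G) w i)))
    xcx≡ : ∀ i → T (w i) → x i * (ι c * x i) ≡ ι c
    xcx≡ i wi = trans (cong₂ (λ a b → a * (ι c * b)) (T⇒x≡1 i wi) (T⇒x≡1 i wi))
      (trans (ℚ.*-identityˡ (ι c * 1ℚ)) (ℚ.*-identityʳ (ι c)))

open import Defs
open import Data.Nat using (ℕ; _+_; _*_; _≤_; _≥_)
open import Data.Nat.Base using (_∸_; _<_; z≤n; s≤s; ⌊_/2⌋; ⌈_/2⌉)
open import Data.Product using (_×_)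
open import Data.Sum using (_⊎_)
open import Relation.Binary.PropositionalEquality using (_≡_)

private
  variable
    A : Set

-- Paths and cycles

module _ where
  private
    variable
      R S : A → A → Set
      a b c d : A
      xs ys : List A

  infixr 5 _◂_

  -- Endpoints and vertex list are indices, so that cutting, reversing and regluing paths act on the
  -- list by `_++_` and `reverse`, and being Hamiltonian is a permutation statement about that list.
  data Path {A : Set} (R : A → A → Set) : A → A → List A → Set where
    end : ∀ a → Path R a a [ a ]
    _◂_ : ∀ {a b c xs} → R a b → Path R b c xs → Path R a c (a ∷ xs)

  Path-map : (∀ {a b} → R a b → S a b) → Path R a b xs → Path S a b xs
  Path-map f (end a) = end a
  Path-map f (r ◂ p) = f r ◂ Path-map f p

  join : Path R a b xs → R b c → Path R c d ys → Path R a d (xs ++ ys)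
  join (end a) s q = s ◂ q
  join (r ◂ p) s q = r ◂ join p s q

  Path-reverse : (∀ {a b} → R a b → R b a) → Path R a b xs → Path R b a (reverse xs)
  Path-reverse sm (end a) = end a
  Path-reverse {R = R} {b = b} sm (_◂_ {a} {xs = xs} r p) =
    subst (Path R b a) (sym (unfold-reverse a xs)) (join (Path-reverse sm p) (sm r) (end a))

  head-∈ : Path R a b xs → a ∈ xs
  head-∈ (end a) = here refl
  head-∈ (r ◂ p) = here refl

  last-∈ : Path R a b xs → b ∈ xs
  last-∈ (end a) = here refl
  last-∈ (r ◂ p) = there (last-∈ p)

  Path-uncons : Path R a b xs → ∃[ ys ] xs ≡ a ∷ ys
  Path-uncons (end a) = [] , refl
  Path-uncons (r ◂ p) = _ , refl

  Path⇒Linked : Path R a b xs → R b c → Linked R (xs ++ [ c ])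
  Path⇒Linked (end a) s = s ∷ [-]
  Path⇒Linked (r ◂ end a) s = r ∷ s ∷ [-]
  Path⇒Linked (r ◂ (r′ ◂ p)) s = r ∷ Path⇒Linked (r′ ◂ p) s

  Path⇒Linked′ : Path R a b xs → Linked R xs
  Path⇒Linked′ (end a) = [-]
  Path⇒Linked′ (r ◂ end a) = r ∷ [-]
  Path⇒Linked′ (r ◂ (r′ ◂ p)) = r ∷ Path⇒Linked′ (r′ ◂ p)

  splitBefore : ∀ {v} → Path R a b xs → v ∈ xs → v ≡ a ⊎
    (∃[ l ] ∃[ ys ] ∃[ zs ] (Path R a l ys × R l v × Path R v b zs × xs ≡ ys ++ zs))
  splitBefore p (here refl) with Path-uncons p
  ... | _ , refl = inj₁ refl
  splitBefore (_◂_ {a} r p) (there v∈) with splitBefore p v∈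
  ... | inj₁ refl = inj₂ (a , [ a ] , _ , end a , r , p , refl)
  ... | inj₂ (l , ys , zs , q , s , q′ , refl) = inj₂ (l , a ∷ ys , zs , r ◂ q , s , q′ , refl)

  splitAfter : ∀ {v} → Path R a b xs → v ∈ xs → v ≡ b ⊎
    (∃[ h ] ∃[ ys ] ∃[ zs ] (Path R a v ys × R v h × Path R h b zs × xs ≡ ys ++ zs))
  splitAfter (end a) (here refl) = inj₁ refl
  splitAfter (_◂_ {a} {b} r p) (here refl) = inj₂ (b , [ a ] , _ , end a , r , p , refl)
  splitAfter (_◂_ {a} r p) (there v∈) with splitAfter p v∈
  ... | inj₁ refl = inj₁ refl
  ... | inj₂ (h , ys , zs , q , s , q′ , refl) = inj₂ (h , a ∷ ys , zs , r ◂ q , s , q′ , refl)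

  Path-singleton : Path R a b xs → xs ≡ [ c ] → a ≡ b
  Path-singleton (end a) _ = refl
  Path-singleton (_ ◂ end _) ()
  Path-singleton (_ ◂ (_ ◂ _)) ()

  unsnoc : Path R a b xs → xs ≡ [ b ] ⊎
    (∃[ l ] ∃[ ys ] (Path R a l ys × R l b × xs ≡ ys ++ [ b ]))
  unsnoc (end a) = inj₁ refl
  unsnoc (_◂_ {a} r p) with unsnoc p
  ... | inj₂ (l , ys , q , s , refl) = inj₂ (l , a ∷ ys , r ◂ q , s , refl)
  ... | inj₁ refl with Path-singleton p refl
  ...   | refl = inj₂ (a , [ a ] , end a , r , refl)

  breakEdge : {P Q : A → A → Set} → (∀ {a b} → R a b → P a b ⊎ Q a b) → Path R a b xs →
    Path P a b xs ⊎
    (∃[ c ] ∃[ d ] ∃[ ys ] ∃[ zs ] (Path P a c ys × R c d × Q c d × Path R d b zs × xs ≡ ys ++ zs))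
  breakEdge f (end a) = inj₁ (end a)
  breakEdge f (_◂_ {a} {b} r p) with f r
  ... | inj₂ q = inj₂ (a , b , [ a ] , _ , end a , r , q , p , refl)
  ... | inj₁ q with breakEdge f p
  ...   | inj₁ p′ = inj₁ (q ◂ p′)
  ...   | inj₂ (c , d , ys , zs , p₁ , s , t , p₂ , refl) = inj₂ (c , d , a ∷ ys , zs , q ◂ p₁ , s , t , p₂ , refl)

  breakVertex : {P : A → Set} → (∀ a → Dec (P a)) → P a → Path R a b xs →
    All P xs ⊎
    (∃[ c ] ∃[ d ] ∃[ ys ] ∃[ zs ] (Path R a c ys × All P ys × R c d × ¬ P d × Path R d b zs × xs ≡ ys ++ zs))
  breakVertex P? pa (end a) = inj₁ (pa ∷ [])
  breakVertex P? pa (_◂_ {a} {b} r p) with P? b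
  ... | no ¬pb = inj₂ (a , b , [ a ] , _ , end a , pa ∷ [] , r , ¬pb , p , refl)
  ... | yes pb with breakVertex P? pb p
  ...   | inj₁ ps = inj₁ (pa ∷ ps)
  ...   | inj₂ (c , d , ys , zs , p₁ , ps , s , t , p₂ , refl) = inj₂ (c , d , a ∷ ys , zs , r ◂ p₁ , pa ∷ ps , s , t , p₂ , refl)

-- Booleans, counting and degrees

T⇒≡ : ∀ {b} → T b → b ≡ true
T⇒≡ {true} _ = refl

¬T⇒≡ : ∀ {b} → ¬ T b → b ≡ false
¬T⇒≡ {true}  h = contradiction tt h
¬T⇒≡ {false} h = refl

≡⇒T : ∀ {b} → b ≡ true → T b
≡⇒T refl = tt

≡⇒¬T : ∀ {b} → b ≡ false → ¬ T b
≡⇒¬T refl ()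

not-T : ∀ {b} → ¬ T b → T (not b)
not-T {true}  h = contradiction tt h
not-T {false} h = tt

T-not : ∀ {b} → T (not b) → ¬ T b
T-not {false} _ ()

⟦⟧-mono : ∀ {a b} → (T a → T b) → ⟦ a ⟧ ≤ ⟦ b ⟧
⟦⟧-mono {true}  h rewrite T⇒≡ (h tt) = ℕ.≤-refl
⟦⟧-mono {false} h = z≤n

T⇒⟦⟧ : ∀ {b} → T b → ⟦ b ⟧ ≡ 1
T⇒⟦⟧ {true} _ = refl

¬T⇒⟦⟧ : ∀ {b} → ¬ T b → ⟦ b ⟧ ≡ 0
¬T⇒⟦⟧ h = cong ⟦_⟧ (¬T⇒≡ h)

∑-tight : ∀ {f g : Fin n → ℕ} → (∀ i → f i ≤ g i) → ∑ℕ.sum g ≤ ∑ℕ.sum f → ∀ i → f i ≡ g i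
∑-tight {suc n} {f} {g} f≤g h zero = ℕ.≤-antisym (f≤g zero) (ℕ.+-cancelʳ-≤ (∑ℕ.sum (f ∘ suc)) (g zero) (f zero)
  (ℕ.≤-trans (ℕ.+-monoʳ-≤ (g zero) (∑-mono (f≤g ∘ suc))) h))
∑-tight {suc n} {f} {g} f≤g h (suc i) = ∑-tight (f≤g ∘ suc) (ℕ.+-cancelˡ-≤ (f zero) _ _
  (ℕ.≤-trans (ℕ.+-monoˡ-≤ (∑ℕ.sum (g ∘ suc)) (f≤g zero)) h)) i

count-mono : ∀ {f g : Fin n → Bool} → (∀ i → T (f i) → T (g i)) → count f ≤ count g
count-mono h = ∑-mono (λ i → ⟦⟧-mono (h i))

count-cong : ∀ {f g : Fin n → Bool} → (∀ i → f i ≡ g i) → count f ≡ count g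
count-cong h = ∑ℕ.sum-cong-≗ (λ i → cong ⟦_⟧ (h i))

count-tight : ∀ {f g : Fin n → Bool} → (∀ i → T (f i) → T (g i)) → count g ≤ count f → ∀ i → T (g i) → T (f i)
count-tight {f = f} {g} f⊆g h i gi with f i in e
... | true  = tt
... | false = contradiction (trans (sym (cong ⟦_⟧ e)) (trans (∑-tight (λ j → ⟦⟧-mono (f⊆g j)) h i) (T⇒⟦⟧ gi))) λ ()

count-not : ∀ (f : Fin n → Bool) → count (not ∘ f) + count f ≡ n
count-not {n} f = trans (sym (∑ℕ.∑-distrib-+ (λ i → ⟦ not (f i) ⟧) (λ i → ⟦ f i ⟧)))
  (trans (∑ℕ.sum-cong-≗ (λ i → e (f i))) (trans (∑-const n 1) (ℕ.*-identityʳ n)))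
  where
  e : ∀ b → ⟦ not b ⟧ + ⟦ b ⟧ ≡ 1
  e true  = refl
  e false = refl

count-disjoint : ∀ (f g : Fin n → Bool) → (∀ i → T (f i) → ¬ T (g i)) → count f + count g ≤ n
count-disjoint {n} f g h = ℕ.≤-trans
  (ℕ.+-monoˡ-≤ (count g) (count-mono {f = f} {g = not ∘ g} (λ i fi → not-T (h i fi))))
  (ℕ.≤-reflexive (count-not g))

_==_ : Fin n → Fin n → Bool
i == j = ⌊ i ≟ j ⌋

==-refl : ∀ (i : Fin n) → T (i == i)
==-refl i with i ≟ i
... | yes _ = tt
... | no h  = contradiction refl h

==⇒≡ : ∀ {i j : Fin n} → T (i == j) → i ≡ j
==⇒≡ {i = i} {j} h with i ≟ j
... | yes e = e

≢⇒¬== : ∀ {i j : Fin n} → i ≢ j → ¬ T (i == j)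
≢⇒¬== h = h ∘ ==⇒≡

count-none : ∀ (f : Fin n → Bool) → (∀ i → ¬ T (f i)) → count f ≡ 0
count-none {zero}  f h = refl
count-none {suc n} f h = cong₂ _+_ (¬T⇒⟦⟧ (h zero)) (count-none (f ∘ suc) (h ∘ suc))

count-== : ∀ (i : Fin n) → count (i ==_) ≡ 1
count-== {suc n} zero = cong suc (count-none {n} (λ j → zero == suc j) (λ j ()))
count-== {suc n} (suc i) = trans (count-cong {f = λ j → suc i == suc j} {g = i ==_} (λ j → e i j)) (count-== i)
  where
  e : ∀ (i j : Fin n) → (suc i == suc j) ≡ (i == j)
  e i j with i ≟ j
  ... | yes _ = refl
  ... | no _  = refl

0<count⇒∃ : ∀ (f : Fin n → Bool) → 0 < count f → ∃[ i ] T (f i)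
0<count⇒∃ f h with any? (λ i → T? (f i))
... | yes found = found
... | no none = contradiction h (ℕ.≤⇒≯ (ℕ.≤-reflexive (count-none f (λ i fi → none (i , fi)))))

∃⇒0<count : ∀ (f : Fin n → Bool) i → T (f i) → 0 < count f
∃⇒0<count f i fi = ℕ.≤-trans (ℕ.≤-reflexive (sym (count-== i)))
  (count-mono {f = i ==_} {g = f} (λ j e → subst (T ∘ f) (==⇒≡ e) fi))

degree≡count : ∀ (G : Graph n) u → degree G u ≡ count (adj G u)
degree≡count G u = go (adj G u)
  where
  go : ∀ {n} (f : Fin n → Bool) → Data.Fin.Subset.∣ Vec.tabulate f ∣ ≡ count f
  go {zero}  f = refl
  go {suc n} f with f zero
  ... | true  = cong suc (go (f ∘ suc))
  ... | false = go (f ∘ suc)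

deg : Graph n → Fin n → ℕ
deg G u = count (adj G u)

δ≤deg : ∀ (G : Graph n) u → δ G ≤ deg G u
δ≤deg {n} G u = ℕ.≤-trans (min≤ (∈-map⁺ (degree G) (∈-allFin u))) (ℕ.≤-reflexive (degree≡count G u))
  where
  open import Data.List.Extrema.Nat using (min; min≤v⁺)
  open import Data.List.Relation.Unary.Any using (Any)
  import Data.List.Relation.Unary.Any as Any
  min≤ : ∀ {v xs} → v ∈ xs → min n xs ≤ v
  min≤ {v} {xs} v∈ = min≤v⁺ n xs (inj₂ (Any.map (λ e → ℕ.≤-reflexive (sym e)) v∈))

Adj-sym : ∀ (G : Graph n) {u v} → Adj G u v → Adj G v u
Adj-sym G {u} {v} = subst T (symmetric G u v)

Adj-irrefl : ∀ (G : Graph n) {u} → ¬ Adj G u u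
Adj-irrefl G {u} = ≡⇒¬T (loopless G u)

Adj⇒≢ : ∀ (G : Graph n) {u v} → Adj G u v → u ≢ v
Adj⇒≢ G h refl = Adj-irrefl G h

complement⇒ : ∀ (G : Graph n) {u v} → Adj (complement G) u v → u ≢ v × ¬ Adj G u v
complement⇒ G {u} {v} h with adj G u v | u ≟ v
... | false | no u≢v = u≢v , id

complement⇐ : ∀ (G : Graph n) {u v} → u ≢ v → ¬ Adj G u v → Adj (complement G) u v
complement⇐ G {u} {v} u≢v ¬uv with adj G u v | u ≟ v
... | true  | _       = contradiction tt ¬uv
... | false | yes u≡v = contradiction u≡v u≢v
... | false | no _    = tt

deg-complement : ∀ (G : Graph n) u → deg (complement G) u + deg G u + 1 ≡ n
deg-complement {n} G u = begin
  deg (complement G) u + deg G u + 1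
    ≡⟨ cong (deg (complement G) u + deg G u +_) (count-== u) ⟨
  deg (complement G) u + deg G u + count (u ==_)
    ≡⟨ cong (_+ count (u ==_)) (∑ℕ.∑-distrib-+ (λ v → ⟦ adj (complement G) u v ⟧) (λ v → ⟦ adj G u v ⟧)) ⟨
  ∑ℕ.sum (λ v → ⟦ adj (complement G) u v ⟧ + ⟦ adj G u v ⟧) + count (u ==_)
    ≡⟨ ∑ℕ.∑-distrib-+ (λ v → ⟦ adj (complement G) u v ⟧ + ⟦ adj G u v ⟧) (λ v → ⟦ u == v ⟧) ⟨
  ∑ℕ.sum (λ v → ⟦ adj (complement G) u v ⟧ + ⟦ adj G u v ⟧ + ⟦ u == v ⟧)
    ≡⟨ ∑ℕ.sum-cong-≗ one ⟩
  ∑ℕ.sum {n} (λ _ → 1)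
    ≡⟨ trans (∑-const n 1) (ℕ.*-identityʳ n) ⟩
  n ∎
  where
  open ≡-Reasoning
  one : ∀ v → ⟦ adj (complement G) u v ⟧ + ⟦ adj G u v ⟧ + ⟦ u == v ⟧ ≡ 1
  one v with u ≟ v
  ... | no _ with adj G u v
  ...   | true  = refl
  ...   | false = refl
  one v | yes refl rewrite loopless G u = refl

-- Counting along lists and spanning lists

cnt : (A → Bool) → List A → ℕ
cnt f []       = 0
cnt f (x ∷ xs) = ⟦ f x ⟧ + cnt f xs

cnt-++ : ∀ (f : A → Bool) xs ys → cnt f (xs ++ ys) ≡ cnt f xs + cnt f ys
cnt-++ f []       ys = refl
cnt-++ f (x ∷ xs) ys = trans (cong (⟦ f x ⟧ +_) (cnt-++ f xs ys)) (sym (ℕ.+-assoc ⟦ f x ⟧ (cnt f xs) (cnt f ys)))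

cnt-↭ : ∀ (f : A → Bool) {xs ys} → xs ↭ ys → cnt f xs ≡ cnt f ys
cnt-↭ f _↭_.refl         = refl
cnt-↭ f (prep x p)       = cong (⟦ f x ⟧ +_) (cnt-↭ f p)
cnt-↭ f (swap {ys = ys} x y p) = trans (cong (λ a → ⟦ f x ⟧ + (⟦ f y ⟧ + a)) (cnt-↭ f p))
  (trans (sym (ℕ.+-assoc ⟦ f x ⟧ ⟦ f y ⟧ (cnt f ys)))
    (trans (cong (_+ cnt f ys) (ℕ.+-comm ⟦ f x ⟧ ⟦ f y ⟧)) (ℕ.+-assoc ⟦ f y ⟧ ⟦ f x ⟧ (cnt f ys))))
cnt-↭ f (_↭_.trans p q)  = trans (cnt-↭ f p) (cnt-↭ f q)

cnt-tabulate : ∀ (f : A → Bool) (g : Fin n → A) → cnt f (tabulate g) ≡ count (f ∘ g)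
cnt-tabulate {n = zero}  f g = refl
cnt-tabulate {n = suc n} f g = cong (⟦ f (g zero) ⟧ +_) (cnt-tabulate f (g ∘ suc))

Spanning : List (Fin n) → Set
Spanning {n} xs = xs ↭ allFin n

cnt-spanning : ∀ (f : Fin n → Bool) {xs} → Spanning xs → cnt f xs ≡ count f
cnt-spanning f p = trans (cnt-↭ f p) (cnt-tabulate f id)

spanning-length : ∀ {xs : List (Fin n)} → Spanning xs → length xs ≡ n
spanning-length {n} p = trans (↭-length p) (length-tabulate {n = n} id)

spanning-∈ : ∀ {xs : List (Fin n)} → Spanning xs → ∀ v → v ∈ xs
spanning-∈ p v = ∈-resp-↭ (↭-sym p) (∈-allFin v)

spanning-unique : ∀ {xs : List (Fin n)} → Spanning xs → Unique xs
spanning-unique {n} p = Permutationₛ.Unique-resp-↭ (setoid (Fin n)) (↭⇒↭ₛ (↭-sym p)) (allFin⁺ n)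

unique-disjoint : ∀ (xs : List A) {ys v} → Unique (xs ++ ys) → v ∈ xs → v ∈ ys → ⊥
unique-disjoint (x ∷ xs) (x∉ ∷ u) (here refl) v∈ys = All.lookup x∉ (∈-++⁺ʳ xs v∈ys) refl
unique-disjoint (x ∷ xs) (_ ∷ u) (there v∈xs) v∈ys = unique-disjoint xs u v∈xs v∈ys

unique-prefix : ∀ (xs : List A) {ys} → Unique (xs ++ ys) → Unique xs
unique-prefix []       u        = []
unique-prefix (x ∷ xs) (x∉ ∷ u) = All.tabulate (λ v∈ → All.lookup x∉ (∈-++⁺ˡ v∈)) ∷ unique-prefix xs u

unique-suffix : ∀ (xs : List A) {ys} → Unique (xs ++ ys) → Unique ys
unique-suffix []       u       = u
unique-suffix (x ∷ xs) (_ ∷ u) = unique-suffix xs u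

closed-path-trivial : ∀ {R : A → A → Set} {a xs} → Path R a a xs → Unique xs → xs ≡ [ a ]
closed-path-trivial (end a) _ = refl
closed-path-trivial (r ◂ p) (a∉ ∷ _) = contradiction refl (All.lookup a∉ (last-∈ p))

-- A Hamilton path with an edge from its last vertex back to its first. For n = 2 a single edge
-- qualifies, which is why `hamCycle⇒Hamiltonian` asks for 3 ≤ n.
HamCycle : Graph n → Set
HamCycle {n} G = ∃[ a ] ∃[ b ] ∃[ xs ] (Path (Adj G) a b xs × Adj G b a × Spanning xs)

HamPath : Graph n → Fin n → Fin n → Set
HamPath G a b = ∃[ xs ] (Path (Adj G) a b xs × Spanning xs)

hamCycle⇒Hamiltonian : ∀ {G : Graph n} → 3 ≤ n → HamCycle G → Hamiltonian G
hamCycle⇒Hamiltonian 3≤n (a , b , xs , p , ba , sp) with Path-uncons p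
... | vs , refl = a , vs , subst (3 ≤_) (sym (spanning-length sp)) 3≤n ,
  spanning-unique sp , Path⇒Linked p ba , spanning-∈ sp

-- The cycle is a ... b d ... c a, with the second path traversed backwards.
crossing⇒hamCycle : ∀ (G : Graph n) {a b c d xs ys} → Path (Adj G) a b xs → Path (Adj G) c d ys →
  Adj G b d → Adj G a c → Spanning (xs ++ ys) → HamCycle G
crossing⇒hamCycle G {a} {b} {c} {d} {xs} {ys} p q bd ac sp =
  a , c , xs ++ reverse ys , join p bd (Path-reverse (Adj-sym G) q) , Adj-sym G ac ,
  ↭-trans (++⁺ˡ xs (↭-reverse ys)) sp

not-both : ∀ x y → ¬ (T x × T y) → ⟦ x ⟧ + ⟦ y ⟧ ≤ 1
not-both true  true  h = contradiction (tt , tt) h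
not-both true  false h = ℕ.≤-refl
not-both false true  h = ℕ.≤-refl
not-both false false h = z≤n

module _ (f g : A → Bool) where
  -- An edge a → b of a path u … z is a crossing when b is a neighbour of u
  -- (f) and a is a neighbour of z (g).
  NoCrossing Exact : A → A → Set
  NoCrossing a b = ¬ (T (g a) × T (f b))
  Exact a b = f b ≡ not (g a)

  -- Each edge a → b has ⟦ g a ⟧ + ⟦ f b ⟧ ≤ 1. Summed over the length - 1 edges, the left side
  -- misses only f at the first vertex and g at the last.
  noCrossing-count : ∀ {R : A → A → Set} {u z xs} → Path (λ a b → R a b × NoCrossing a b) u z xs →
    cnt f xs + cnt g xs + 1 ≤ length xs + ⟦ f u ⟧ + ⟦ g z ⟧
  noCrossing-count (end a) = ℕ.≤-reflexive (e ⟦ f a ⟧ ⟦ g a ⟧)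
    where
    e : ∀ x y → x + 0 + (y + 0) + 1 ≡ 1 + x + y
    e = ℕ.solve-∀
  noCrossing-count (_◂_ {a} {b} {c} {xs} (_ , nc) p) = begin
    ⟦ f a ⟧ + cnt f xs + (⟦ g a ⟧ + cnt g xs) + 1
      ≡⟨ e₁ ⟦ f a ⟧ ⟦ g a ⟧ (cnt f xs) (cnt g xs) ⟩
    ⟦ f a ⟧ + ⟦ g a ⟧ + (cnt f xs + cnt g xs + 1)
      ≤⟨ ℕ.+-monoʳ-≤ (⟦ f a ⟧ + ⟦ g a ⟧) (noCrossing-count p) ⟩
    ⟦ f a ⟧ + ⟦ g a ⟧ + (length xs + ⟦ f b ⟧ + ⟦ g c ⟧)
      ≡⟨ e₂ ⟦ f a ⟧ ⟦ g a ⟧ (length xs) ⟦ f b ⟧ ⟦ g c ⟧ ⟩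
    ⟦ g a ⟧ + ⟦ f b ⟧ + length xs + ⟦ f a ⟧ + ⟦ g c ⟧
      ≤⟨ ℕ.+-monoˡ-≤ ⟦ g c ⟧ (ℕ.+-monoˡ-≤ ⟦ f a ⟧ (ℕ.+-monoˡ-≤ (length xs) one)) ⟩
    suc (length xs) + ⟦ f a ⟧ + ⟦ g c ⟧ ∎
    where
    open ℕ.≤-Reasoning
    e₁ : ∀ x y F G → x + F + (y + G) + 1 ≡ x + y + (F + G + 1)
    e₁ = ℕ.solve-∀
    e₂ : ∀ x y l b c → x + y + (l + b + c) ≡ y + b + l + x + c
    e₂ = ℕ.solve-∀
    one : ⟦ g a ⟧ + ⟦ f b ⟧ ≤ 1
    one = not-both (g a) (f b) nc

  -- Equality in `noCrossing-count` leaves no edge with ⟦ g a ⟧ + ⟦ f b ⟧ = 0.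
  noCrossing-exact : ∀ {R : A → A → Set} {u z xs} → Path (λ a b → R a b × NoCrossing a b) u z xs →
    length xs + ⟦ f u ⟧ + ⟦ g z ⟧ ≤ cnt f xs + cnt g xs + 1 → Path (λ a b → R a b × Exact a b) u z xs
  noCrossing-exact (end a) _ = end a
  noCrossing-exact (_◂_ {a} {b} {c} {xs} (r , nc) p) h = (r , proj₁ step) ◂ noCrossing-exact p (proj₂ step)
    where
    open ℕ.≤-Reasoning
    e₁ : ∀ x l c → x + (l + c + 1) ≡ suc l + x + c
    e₁ = ℕ.solve-∀
    e₂ : ∀ x y F G → x + F + (y + G) + 1 ≡ x + (y + (F + G + 1))
    e₂ = ℕ.solve-∀
    e₃ : ∀ l c → suc (l + 0 + c) ≡ l + c + 1
    e₃ = ℕ.solve-∀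
    e₄ : ∀ l c → l + 1 + c ≡ l + c + 1
    e₄ = ℕ.solve-∀
    h′ : length xs + ⟦ g c ⟧ + 1 ≤ ⟦ g a ⟧ + (cnt f xs + cnt g xs + 1)
    h′ = ℕ.+-cancelˡ-≤ ⟦ f a ⟧ _ _ (begin
      ⟦ f a ⟧ + (length xs + ⟦ g c ⟧ + 1)             ≡⟨ e₁ ⟦ f a ⟧ (length xs) ⟦ g c ⟧ ⟩
      suc (length xs) + ⟦ f a ⟧ + ⟦ g c ⟧             ≤⟨ h ⟩
      ⟦ f a ⟧ + cnt f xs + (⟦ g a ⟧ + cnt g xs) + 1   ≡⟨ e₂ ⟦ f a ⟧ ⟦ g a ⟧ (cnt f xs) (cnt g xs) ⟩
      ⟦ f a ⟧ + (⟦ g a ⟧ + (cnt f xs + cnt g xs + 1)) ∎)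
    go : ∀ x y s → ¬ (T x × T y) → length xs + ⟦ g c ⟧ + 1 ≤ ⟦ x ⟧ + s → s ≤ length xs + ⟦ y ⟧ + ⟦ g c ⟧ →
         y ≡ not x × length xs + ⟦ y ⟧ + ⟦ g c ⟧ ≤ s
    go true  true  s nc _ _ = contradiction (tt , tt) nc
    go true  false s _ h _ = refl , ℕ.≤-pred (ℕ.≤-trans (ℕ.≤-reflexive (e₃ (length xs) ⟦ g c ⟧)) h)
    go false true  s _ h _ = refl , ℕ.≤-trans (ℕ.≤-reflexive (e₄ (length xs) ⟦ g c ⟧)) h
    go false false s _ h k = contradiction (ℕ.≤-trans h k) (ℕ.<⇒≱ (ℕ.≤-reflexive (e₃ (length xs) ⟦ g c ⟧)))
    step : Exact a b × length xs + ⟦ f b ⟧ + ⟦ g c ⟧ ≤ cnt f xs + cnt g xs + 1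
    step = go (g a) (f b) _ nc h′ (noCrossing-count p)

noCrossing? : ∀ (f g : A → Bool) {R : A → A → Set} {a b} → R a b →
  (R a b × NoCrossing f g a b) ⊎ (T (g a) × T (f b))
noCrossing? f g {a = a} {b} r with g a | f b
... | true  | true  = inj₂ (tt , tt)
... | true  | false = inj₁ (r , proj₂)
... | false | _     = inj₁ (r , proj₁)

-- Ore's argument, with the equality case kept.
ore : ∀ (G : Graph n) {u z xs} → Path (Adj G) u z xs → Spanning xs →
  HamCycle G ⊎ Path (λ a b → Adj G a b × NoCrossing (adj G u) (adj G z) a b) u z xs
ore G {u} {z} p sp with breakEdge (noCrossing? (adj G u) (adj G z) {R = Adj G}) p
... | inj₁ q = inj₂ q
... | inj₂ (c , d , ys , zs , q , _ , (zc , ud) , q′ , refl) =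
  inj₁ (crossing⇒hamCycle G (Path-map proj₁ q) q′ (Adj-sym G zc) ud sp)

hamPath⇒hamCycle : ∀ (G : Graph n) {u z} → HamPath G u z → n ≤ deg G u + deg G z → HamCycle G
hamPath⇒hamCycle {n} G {u} {z} (xs , p , sp) h with ore G p sp
... | inj₁ hc = hc
... | inj₂ q = contradiction (noCrossing-count (adj G u) (adj G z) q) (ℕ.<⇒≱ (begin-strict
    length xs + ⟦ adj G u u ⟧ + ⟦ adj G z z ⟧
      ≡⟨ cong₂ _+_ (cong₂ _+_ (spanning-length sp) (cong ⟦_⟧ (loopless G u))) (cong ⟦_⟧ (loopless G z)) ⟩
    n + 0 + 0                ≡⟨ trans (ℕ.+-identityʳ (n + 0)) (ℕ.+-identityʳ n) ⟩
    n                        <⟨ ℕ.n<1+n n ⟩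
    suc n                    ≡⟨ ℕ.+-comm 1 n ⟩
    n + 1                    ≤⟨ ℕ.+-monoˡ-≤ 1 h ⟩
    deg G u + deg G z + 1    ≡⟨ cong₂ (λ a b → a + b + 1) (cnt-spanning (adj G u) sp) (cnt-spanning (adj G z) sp) ⟨
    cnt (adj G u) xs + cnt (adj G z) xs + 1 ∎))
  where open ℕ.≤-Reasoning

-- Closure

_⊆ᴳ_ : Graph n → Graph n → Set
G ⊆ᴳ H = ∀ {u v} → Adj G u v → Adj H u v

deg-mono : ∀ {G H : Graph n} → G ⊆ᴳ H → ∀ u → deg G u ≤ deg H u
deg-mono {G = G} {H = H} G⊆H u = count-mono {f = adj G u} {g = adj H u} (λ v → G⊆H)

∧-split : ∀ {a b} → T (a ∧ b) → T a × T b
∧-split {true} {true} _ = tt , tt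

∧-join : ∀ {a b} → T a → T b → T (a ∧ b)
∧-join {true} {true} _ _ = tt

∨-split : ∀ {a b} → T (a ∨ b) → T a ⊎ T b
∨-split {true}  _ = inj₁ tt
∨-split {false} h = inj₂ h

∨-left : ∀ {a b} → T a → T (a ∨ b)
∨-left {true} _ = tt

∨-right : ∀ {a b} → T b → T (a ∨ b)
∨-right {true}  _ = tt
∨-right {false} h = h

module AddEdge (G : Graph n) (u v : Fin n) (u≢v : u ≢ v) where

  IsNew : Fin n → Fin n → Set
  IsNew i j = (i ≡ u × j ≡ v) ⊎ (i ≡ v × j ≡ u)

  new : Fin n → Fin n → Bool
  new i j = ((i == u) ∧ (j == v)) ∨ ((i == v) ∧ (j == u))

  new⇒ : ∀ {i j} → T (new i j) → IsNew i j
  new⇒ h with ∨-split h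
  ... | inj₁ k = inj₁ (==⇒≡ (proj₁ (∧-split k)) , ==⇒≡ (proj₂ (∧-split k)))
  ... | inj₂ k = inj₂ (==⇒≡ (proj₁ (∧-split k)) , ==⇒≡ (proj₂ (∧-split k)))

  G⁺ : Graph n
  G⁺ = record
    { adj       = λ i j → adj G i j ∨ new i j
    ; symmetric = λ i j → cong₂ _∨_ (symmetric G i j)
        (trans (∨-comm ((i == u) ∧ (j == v)) ((i == v) ∧ (j == u)))
          (cong₂ _∨_ (∧-comm (i == v) (j == u)) (∧-comm (i == u) (j == v))))
    ; loopless  = λ i → ¬T⇒≡ (λ h → irreflexive {i} (∨-split h))
    }
    where
    irreflexive : ∀ {i} → ¬ (Adj G i i ⊎ T (new i i))
    irreflexive (inj₁ h) = Adj-irrefl G h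
    irreflexive {i} (inj₂ h) with new⇒ {i} {i} h
    ... | inj₁ (p , q) = u≢v (trans (sym p) q)
    ... | inj₂ (p , q) = u≢v (trans (sym q) p)

  G⊆G⁺ : G ⊆ᴳ G⁺
  G⊆G⁺ = ∨-left

  uv∈G⁺ : Adj G⁺ u v
  uv∈G⁺ = ∨-right {adj G u v} (∨-left (∧-join (==-refl u) (==-refl v)))

  separate : ∀ {i j} → Adj G⁺ i j → Adj G i j ⊎ IsNew i j
  separate h with ∨-split h
  ... | inj₁ k = inj₁ k
  ... | inj₂ k = inj₂ (new⇒ k)

  module _ (3≤n : 3 ≤ n) (n≤ : n ≤ deg G u + deg G v) where

    -- A Hamilton path of `G⁺` between the ends of the new edge cannot use that edge: it would be
    -- the whole path, against 3 ≤ n, or an endpoint would lie in both halves. So the path lies in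
    -- G, and its endpoints have degree sum at least n.
    close-new : ∀ {c d xs} → Path (Adj G⁺) c d xs → Spanning xs → IsNew d c → HamCycle G
    close-new {c} {d} {xs} p sp new with breakEdge separate p
    ... | inj₁ q = hamPath⇒hamCycle G (xs , q , sp) (bound new)
      where
      bound : ∀ {c d} → IsNew d c → n ≤ deg G c + deg G d
      bound (inj₁ (refl , refl)) = ℕ.≤-trans n≤ (ℕ.≤-reflexive (ℕ.+-comm (deg G u) (deg G v)))
      bound (inj₂ (refl , refl)) = n≤
    ... | inj₂ (c′ , d′ , ys , zs , q , _ , new′ , q′ , refl) = ⊥-elim (same-or-flipped new new′)
      where
      uniq : Unique (ys ++ zs)
      uniq = spanning-unique sp
      same : c′ ≡ c → d′ ≡ d → ⊥
      same refl refl = ℕ.<⇒≢ 3≤n (sym (trans (sym (spanning-length sp)) (cong₂ (λ a b → length (a ++ b))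
        (closed-path-trivial q (unique-prefix ys uniq)) (closed-path-trivial q′ (unique-suffix ys uniq)))))
      flipped : c′ ≡ d → d′ ≡ c → ⊥
      flipped refl refl = unique-disjoint ys uniq (head-∈ q) (head-∈ q′)
      same-or-flipped : IsNew d c → IsNew c′ d′ → ⊥
      same-or-flipped (inj₁ (refl , refl)) (inj₁ (p , q)) = flipped p q
      same-or-flipped (inj₁ (refl , refl)) (inj₂ (p , q)) = same p q
      same-or-flipped (inj₂ (refl , refl)) (inj₁ (p , q)) = same p q
      same-or-flipped (inj₂ (refl , refl)) (inj₂ (p , q)) = flipped p q

    -- If the path part of the cycle uses the new edge, rotation makes it the closing edge, and
    -- `close-new` applies.
    remove-new : HamCycle G⁺ → HamCycle G
    remove-new (a , b , xs , p , ba , sp) with breakEdge separate p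
    ... | inj₂ (c , d , ys , zs , q , _ , new , q′ , refl) =
      close-new (join q′ ba (Path-map G⊆G⁺ q)) (↭-trans (++-comm zs ys) sp) new
    ... | inj₁ q with separate ba
    ...   | inj₁ ba′ = a , b , xs , q , ba′ , sp
    ...   | inj₂ new = close-new p sp new

Closed : Graph n → Set
Closed {n} H = ∀ {u v} → u ≢ v → ¬ Adj H u v → deg H u + deg H v < n

record Closure (G : Graph n) : Set where
  field
    H       : Graph n
    G⊆H     : G ⊆ᴳ H
    closed  : Closed H
    reflect : HamCycle H → HamCycle G

closure : 3 ≤ n → (G : Graph n) → Closure G
closure {n} 3≤n G = go (n * n) G (ℕ.m≤m+n (n * n) (∑ℕ.sum (deg G)))
  where
  Violation : Graph n → Fin n → Fin n → Set
  Violation G u v = u ≢ v × ¬ Adj G u v × n ≤ deg G u + deg G v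
  violation? : ∀ G → Dec (∃[ u ] ∃[ v ] Violation G u v)
  violation? G = any? λ u → any? λ v →
    ¬? (u ≟ v) ×-dec (¬? (T? (adj G u v)) ×-dec (n ℕ.≤? deg G u + deg G v))
  degrees≤ : ∀ G → ∑ℕ.sum (deg G) ≤ n * n
  degrees≤ G = ℕ.≤-trans (∑-mono (λ u → count≤n (adj G u))) (ℕ.≤-reflexive (∑-const n n))
  grows : ∀ G u v (u≢v : u ≢ v) → ¬ Adj G u v →
          ∑ℕ.sum (deg G) < ∑ℕ.sum (deg (AddEdge.G⁺ G u v u≢v))
  grows G u v u≢v ¬uv = ℕ.≰⇒> λ h → ¬uv (count-tight {f = adj G u} {g = adj G⁺ u} (λ w → G⊆G⁺)
      (ℕ.≤-reflexive (sym (∑-tight (deg-mono {G = G} {H = G⁺} G⊆G⁺) h u))) v uv∈G⁺)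
    where open AddEdge G u v u≢v
  -- `fuel` bounds the distance of the degree sum from n², a bound that no graph exceeds; each added
  -- edge increases the sum.
  go : ∀ fuel G → n * n ≤ fuel + ∑ℕ.sum (deg G) → Closure G
  go fuel G h with violation? G
  ... | no none = record
    { H = G ; G⊆H = id ; reflect = id
    ; closed = λ {u} {v} u≢v ¬uv → ℕ.≰⇒> (λ n≤ → none (u , v , u≢v , ¬uv , n≤)) }
  go zero G h | yes (u , v , u≢v , ¬uv , n≤) =
    contradiction (ℕ.≤-trans (grows G u v u≢v ¬uv) (degrees≤ (AddEdge.G⁺ G u v u≢v))) (ℕ.≤⇒≯ h)
  go (suc fuel) G h | yes (u , v , u≢v , ¬uv , n≤) = record
      { H = Closure.H C ; G⊆H = λ e → Closure.G⊆H C (G⊆G⁺ e)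
      ; closed = Closure.closed C ; reflect = λ hc → remove-new 3≤n n≤ (Closure.reflect C hc) }
    where
    open AddEdge G u v u≢v
    C : Closure G⁺
    C = go fuel G⁺ (ℕ.≤-trans h (ℕ.≤-trans (ℕ.≤-reflexive (sym (ℕ.+-suc fuel _))) (ℕ.+-monoʳ-≤ fuel (grows G u v u≢v ¬uv))))

-- Complete graphs, cones and Hamilton paths

Complete : Graph n → Set
Complete H = ∀ {u v} → u ≢ v → Adj H u v

unique-path : ∀ {H : Graph n} → Complete H → ∀ x xs → Unique (x ∷ xs) → ∃[ z ] Path (Adj H) x z (x ∷ xs)
unique-path K x [] u = x , end x
unique-path {H = H} K x (y ∷ xs) ((x≢y ∷ _) ∷ u) with unique-path {H = H} K y xs u
... | z , p = z , K x≢y ◂ p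

complete⇒hamCycle : 3 ≤ n → (H : Graph n) → Complete H → HamCycle H
complete⇒hamCycle (s≤s (s≤s (s≤s {n = n} _))) H K with unique-path {H = H} K zero (tabulate suc) (allFin⁺ (3 + n))
... | z , _◂_ {b = b} r p = zero , z , _ , r ◂ p ,
  K (λ { refl → unique-disjoint [ zero ] (allFin⁺ (3 + n)) (here refl) (last-∈ p) }) , ↭-refl

cone : Graph n → Graph (1 + n)
cone G = K 1 ∨ᴳ G

cone-lower : ∀ {G : Graph n} {c d ws} → Path (Adj (cone G)) c d ws → All (zero ≢_) ws →
  ∃[ c′ ] ∃[ d′ ] ∃[ ws′ ] (c ≡ suc c′ × ws ≡ map suc ws′ × Path (Adj G) c′ d′ ws′)
cone-lower (end zero)    (0≢0 ∷ _) = contradiction refl 0≢0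
cone-lower (end (suc c)) _         = c , c , [ c ] , refl , refl , end c
cone-lower (_◂_ {zero} _ _) (0≢0 ∷ _) = contradiction refl 0≢0
cone-lower (_◂_ {suc c} r p) (_ ∷ nz) with cone-lower p nz
... | c′ , d′ , ws′ , refl , refl , p′ = c , d′ , c ∷ ws′ , refl , refl , r ◂ p′

cone-hamPath : ∀ (G : Graph n) → 1 ≤ n → ∀ {z ws} → Path (Adj (cone G)) zero z ws → Spanning ws →
  ∃[ a ] ∃[ b ] HamPath G a b
cone-hamPath G 1≤n (end _) sp = contradiction (spanning-length sp) (ℕ.<⇒≢ (s≤s 1≤n))
cone-hamPath G 1≤n (r ◂ p) sp with spanning-unique sp
... | 0∉ ∷ _ with cone-lower {G = G} p 0∉
...   | c , d , ws , refl , refl , p′ = c , d , ws , p′ , spans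
  where
  spans : Spanning ws
  spans with ↭-map-inv suc (↭-trans (drop-∷ sp) (↭-reflexive (sym (map-tabulate id suc))))
  ... | vs , eq , perm = subst (ws ↭_) (sym (map-injective suc-injective eq)) perm

-- Rotated to begin at the apex `zero`, the cycle becomes a Hamilton path of G once the apex is
-- dropped.
cone-hamCycle : ∀ (G : Graph n) → 1 ≤ n → HamCycle (cone G) → ∃[ a ] ∃[ b ] HamPath G a b
cone-hamCycle {n} G 1≤n (a , b , xs , p , ba , sp) with splitBefore p (spanning-∈ sp zero)
... | inj₁ refl = cone-hamPath G 1≤n p sp
... | inj₂ (l , ys , zs , q , l0 , q′ , refl) = cone-hamPath G 1≤n (join q′ ba q) (↭-trans (++-comm zs ys) sp)

-- The closure of the cone is complete.
dirac-path : ∀ (G : Graph n) → 2 ≤ n → (∀ u v → n ≤ suc (deg G u + deg G v)) → ∃[ a ] ∃[ b ] HamPath G a b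
dirac-path {n} G 2≤n h = cone-hamCycle G (ℕ.≤-trans (s≤s z≤n) 2≤n)
    (Closure.reflect C (complete⇒hamCycle (s≤s 2≤n) H (λ {u} {v} → complete u v)))
  where
  C : Closure (cone G)
  C = closure (s≤s 2≤n) (cone G)
  H : Graph (suc n)
  H = Closure.H C
  complete : ∀ u v → u ≢ v → Adj H u v
  complete zero    zero    u≢v = contradiction refl u≢v
  complete zero    (suc v) u≢v = Closure.G⊆H C tt
  complete (suc u) zero    u≢v = Closure.G⊆H C tt
  complete (suc u) (suc v) u≢v with T? (adj H (suc u) (suc v))
  ... | yes uv = uv
  -- Each of the two degrees gains 1 from the apex, so their sum is at least n + 1, the order of the
  -- cone.
  ... | no ¬uv = contradiction (Closure.closed C u≢v ¬uv) (ℕ.≤⇒≯ (ℕ.≤-trans (s≤s (h u v))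
      (ℕ.≤-trans (ℕ.≤-reflexive (sym (cong suc (ℕ.+-suc (deg G u) (deg G v)))))
        (ℕ.+-mono-≤ (deg-mono {G = cone G} {H = H} (Closure.G⊆H C) (suc u)) (deg-mono {G = cone G} {H = H} (Closure.G⊆H C) (suc v))))))

-- Graphs with minimum degree (n - 1) / 2

count≡1⇒≡ : ∀ (f : Fin n → Bool) → count f ≡ 1 → ∀ {u v} → T (f u) → T (f v) → u ≡ v
count≡1⇒≡ f #f {u} {v} fu fv = ==⇒≡ (count-tight {f = u ==_} {g = f}
  (λ w e → subst (T ∘ f) (==⇒≡ e) fu) (ℕ.≤-reflexive (trans #f (sym (count-== u)))) v fv)

data Side : Set where
  apex left right : Side

_≟ˢ_ : DecidableEquality Side
apex  ≟ˢ apex  = yes refl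
apex  ≟ˢ left  = no λ ()
apex  ≟ˢ right = no λ ()
left  ≟ˢ apex  = no λ ()
left  ≟ˢ left  = yes refl
left  ≟ˢ right = no λ ()
right ≟ˢ apex  = no λ ()
right ≟ˢ left  = no λ ()
right ≟ˢ right = yes refl

isApex isLeft isRight : Side → Bool
isApex s  = ⌊ s ≟ˢ apex ⌋
isLeft s  = ⌊ s ≟ˢ left ⌋
isRight s = ⌊ s ≟ˢ right ⌋

compatible : Side → Side → Bool
compatible left right = false
compatible right left = false
compatible _ _ = true

-- G is K_c ∨ (K_k + K_m).
record TwoCliques (G : Graph n) (c k m : ℕ) : Set where
  field
    side    : Fin n → Side
    #apex   : count (isApex ∘ side) ≡ c
    #left   : count (isLeft ∘ side) ≡ k
    #right  : count (isRight ∘ side) ≡ m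
    joined  : ∀ {u v} → u ≢ v → T (compatible (side u) (side v)) → Adj G u v
    split   : ∀ {u v} → ¬ T (compatible (side u) (side v)) → ¬ Adj G u v

-- G lies between K_{a,b} and K_a ∨ b K₁.
record Unbalanced (G : Graph n) (a b : ℕ) : Set where
  field
    indep      : Fin n → Bool
    #indep     : count indep ≡ b
    #rest      : count (not ∘ indep) ≡ a
    no-edges   : ∀ {u v} → T (indep u) → T (indep v) → ¬ Adj G u v
    all-edges  : ∀ {u v} → T (indep u) → ¬ T (indep v) → Adj G u v

sides-total : ∀ (side : Fin n → Side) →
  count (isApex ∘ side) + count (isLeft ∘ side) + count (isRight ∘ side) ≡ n
sides-total {n} side = begin
  count (isApex ∘ side) + count (isLeft ∘ side) + count (isRight ∘ side)
    ≡⟨ cong (_+ count (isRight ∘ side)) (∑ℕ.∑-distrib-+ (λ v → ⟦ isApex (side v) ⟧) (λ v → ⟦ isLeft (side v) ⟧)) ⟨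
  ∑ℕ.sum (λ v → ⟦ isApex (side v) ⟧ + ⟦ isLeft (side v) ⟧) + count (isRight ∘ side)
    ≡⟨ ∑ℕ.∑-distrib-+ (λ v → ⟦ isApex (side v) ⟧ + ⟦ isLeft (side v) ⟧) (λ v → ⟦ isRight (side v) ⟧) ⟨
  ∑ℕ.sum (λ v → ⟦ isApex (side v) ⟧ + ⟦ isLeft (side v) ⟧ + ⟦ isRight (side v) ⟧)
    ≡⟨ ∑ℕ.sum-cong-≗ (λ v → one (side v)) ⟩
  ∑ℕ.sum {n} (λ _ → 1)
    ≡⟨ trans (∑-const n 1) (ℕ.*-identityʳ n) ⟩
  n ∎
  where
  open ≡-Reasoning
  one : ∀ s → ⟦ isApex s ⟧ + ⟦ isLeft s ⟧ + ⟦ isRight s ⟧ ≡ 1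
  one apex  = refl
  one left  = refl
  one right = refl

¬compatible : ∀ {s t} → ¬ T (compatible s t) → (s ≡ left × t ≡ right) ⊎ (s ≡ right × t ≡ left)
¬compatible {apex}  {apex}  h = contradiction tt h
¬compatible {apex}  {left}  h = contradiction tt h
¬compatible {apex}  {right} h = contradiction tt h
¬compatible {left}  {apex}  h = contradiction tt h
¬compatible {left}  {left}  h = contradiction tt h
¬compatible {left}  {right} h = inj₁ (refl , refl)
¬compatible {right} {apex}  h = contradiction tt h
¬compatible {right} {left}  h = inj₂ (refl , refl)
¬compatible {right} {right} h = contradiction tt h

≡left⇒ : ∀ {s} → s ≡ left → T (isLeft s)
≡left⇒ refl = tt

≡right⇒ : ∀ {s} → s ≡ right → T (isRight s)
≡right⇒ refl = tt

-- With no edges between the sides the degree condition forces all other edges.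
module Cliques (G : Graph n) (k : ℕ) (n≡ : n ≡ suc (k + k)) (δ≥k : ∀ u → k ≤ deg G u)
  (side : Fin n → Side) (#apex : count (isApex ∘ side) ≡ 1) (#left : count (isLeft ∘ side) ≡ k)
  (no-edges : ∀ {u v} → T (isLeft (side u)) → T (isRight (side v)) → ¬ Adj G u v) where

  #right : count (isRight ∘ side) ≡ k
  #right = ℕ.+-cancelˡ-≡ (suc k) _ _ (trans
    (cong (_+ count (isRight ∘ side)) (sym (cong₂ _+_ #apex #left)))
    (trans (sides-total side) n≡))

  -- Without u and the k vertices of `other`, only k of the 2k + 1 vertices remain as possible
  -- neighbours, and u needs k of them.
  saturated : ∀ u (other : Fin n → Bool) → count other ≡ k → ¬ T (other u) →
    (∀ v → T (other v) → ¬ Adj G u v) → ∀ {v} → u ≢ v → ¬ T (other v) → Adj G u v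
  saturated u other #other u∉ none {v} u≢v v∉ =
    count-tight {f = adj G u} {g = candidate} adj⊆candidate
      (ℕ.≤-trans candidate≤k (δ≥k u)) v (∧-join (not-T (≢⇒¬== u≢v)) (not-T v∉))
    where
    candidate : Fin n → Bool
    candidate v = not (u == v) ∧ not (other v)
    adj⊆candidate : ∀ v → Adj G u v → T (candidate v)
    adj⊆candidate v uv = ∧-join (not-T (≢⇒¬== (Adj⇒≢ G uv))) (not-T (λ o → none v o uv))
    candidate≤k : count candidate ≤ k
    candidate≤k = ℕ.+-cancelʳ-≤ (suc k) _ _ (begin
      count candidate + suc k
        ≡⟨ cong (count candidate +_) (cong₂ _+_ (sym (count-== u)) (sym #other)) ⟩
      count candidate + (count (u ==_) + count other)
        ≡⟨ cong (count candidate +_) (∑ℕ.∑-distrib-+ (λ v → ⟦ u == v ⟧) (λ v → ⟦ other v ⟧)) ⟨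
      count candidate + ∑ℕ.sum (λ v → ⟦ u == v ⟧ + ⟦ other v ⟧)
        ≡⟨ ∑ℕ.∑-distrib-+ (λ v → ⟦ candidate v ⟧) (λ v → ⟦ u == v ⟧ + ⟦ other v ⟧) ⟨
      ∑ℕ.sum (λ v → ⟦ candidate v ⟧ + (⟦ u == v ⟧ + ⟦ other v ⟧))
        ≤⟨ ∑-mono (λ v → one v) ⟩
      ∑ℕ.sum {n} (λ _ → 1)
        ≡⟨ trans (∑-const n 1) (ℕ.*-identityʳ n) ⟩
      n ≡⟨ trans n≡ (sym (ℕ.+-suc k k)) ⟩
      k + suc k ∎)
      where
      open ℕ.≤-Reasoning
      one : ∀ v → ⟦ candidate v ⟧ + (⟦ u == v ⟧ + ⟦ other v ⟧) ≤ 1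
      one v with u ≟ v
      ... | yes refl rewrite ¬T⇒≡ u∉ = ℕ.≤-refl
      ... | no _ with other v
      ...   | true  = ℕ.≤-refl
      ...   | false = ℕ.≤-refl

  right⇒¬left : ∀ {s} → T (isRight s) → ¬ T (isLeft s)
  right⇒¬left {right} _ ()

  from-left : ∀ {u v} → T (isLeft (side u)) → u ≢ v → ¬ T (isRight (side v)) → Adj G u v
  from-left {u} lu = saturated u (isRight ∘ side) #right (λ ru → right⇒¬left ru lu) (λ v rv → no-edges lu rv)

  from-right : ∀ {u v} → T (isRight (side u)) → u ≢ v → ¬ T (isLeft (side v)) → Adj G u v
  from-right {u} ru = saturated u (isLeft ∘ side) #left (right⇒¬left ru) (λ v lv uv → no-edges lv ru (Adj-sym G uv))

  joined : ∀ {u v} → u ≢ v → T (compatible (side u) (side v)) → Adj G u v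
  joined {u} {v} u≢v c = go (side u) (side v) refl refl c
    where
    go : ∀ s t → side u ≡ s → side v ≡ t → T (compatible s t) → Adj G u v
    go apex  apex  p q _ = contradiction (count≡1⇒≡ (isApex ∘ side) #apex (subst (T ∘ isApex) (sym p) tt) (subst (T ∘ isApex) (sym q) tt)) u≢v
    go apex  left  p q _ = Adj-sym G (from-left (≡left⇒ q) (u≢v ∘ sym) (subst (¬_ ∘ T ∘ isRight) (sym p) id))
    go apex  right p q _ = Adj-sym G (from-right (≡right⇒ q) (u≢v ∘ sym) (subst (¬_ ∘ T ∘ isLeft) (sym p) id))
    go left  apex  p q _ = from-left (≡left⇒ p) u≢v (subst (¬_ ∘ T ∘ isRight) (sym q) id)
    go left  left  p q _ = from-left (≡left⇒ p) u≢v (subst (¬_ ∘ T ∘ isRight) (sym q) id)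
    go right apex  p q _ = from-right (≡right⇒ p) u≢v (subst (¬_ ∘ T ∘ isLeft) (sym q) id)
    go right right p q _ = from-right (≡right⇒ p) u≢v (subst (¬_ ∘ T ∘ isLeft) (sym q) id)

  twoCliques : TwoCliques G 1 k k
  twoCliques = record
    { side = side ; #apex = #apex ; #left = #left ; #right = #right ; joined = joined
    ; split = λ h uv → apart (¬compatible h) uv }
    where
    apart : ∀ {u v} → (side u ≡ left × side v ≡ right) ⊎ (side u ≡ right × side v ≡ left) → ¬ Adj G u v
    apart (inj₁ (p , q)) uv = no-edges (≡left⇒ p) (≡right⇒ q) uv
    apart (inj₂ (p , q)) uv = no-edges (≡left⇒ q) (≡right⇒ p) (Adj-sym G uv)

module NashWilliams (G : Graph n) (k : ℕ) (1≤k : 1 ≤ k) (n≡ : n ≡ suc (k + k)) (δ≥k : ∀ u → k ≤ deg G u) where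

  private
    -- Along each edge a → b exactly one of "b is adjacent to u" and "a is adjacent to z" holds.
    -- With u = z = w this says that neighbours and non-neighbours of w alternate.
    ExactPath : Fin n → Fin n → Fin n → Fin n → List (Fin n) → Set
    ExactPath u z = Path (λ a b → Adj G a b × Exact (adj G u) (adj G z) a b)
    Outcome : Set
    Outcome = HamCycle G ⊎ (TwoCliques G 1 k k ⊎ Unbalanced G k (suc k))

  -- `C`, closed by the edge `yx`, is a cycle of length 2k that misses only `w`, and `w` has at
  -- least k neighbours on it. Two consecutive ones allow `w` to be inserted; otherwise they must be
  -- every second vertex.
  module NearCycle {w x y : Fin n} {C : List (Fin n)} (sp : Spanning (C ++ [ w ])) (yx : Adj G y x) where

    h : Fin n → Bool
    h = adj G w

    length-C : length C ≡ k + k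
    length-C = ℕ.suc-injective (trans (trans (ℕ.+-comm 1 (length C)) (sym (length-++ C)))
      (trans (spanning-length sp) n≡))

    cnt-C : cnt h C ≡ deg G w
    cnt-C = trans (sym (ℕ.+-identityʳ (cnt h C))) (trans
      (trans (cong (λ a → cnt h C + (⟦ a ⟧ + 0)) (sym (loopless G w))) (sym (cnt-++ h C [ w ])))
      (cnt-spanning h sp))

    cycle : ∀ {D} → D ↭ C → ∀ {o l} → Path (Adj G) o l D → Adj G w o → Adj G w l → HamCycle G
    cycle {D} perm {o} {l} p wo wl = o , w , D ++ [ w ] , join p (Adj-sym G wl) (end w) , wo ,
      ↭-trans (++⁺ʳ [ w ] perm) sp

    module Alternating (p : ExactPath w w x y C) (wx : Adj G w x) (deg-w : deg G w ≡ k) where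

      q : ∀ {a b D} → ExactPath w w a b D → Path (Adj G) a b D
      q = Path-map proj₁

      next : ∀ {e o} → Exact h h e o → ¬ T (h e) → Adj G w o
      next {e} {o} ex ¬he = ≡⇒T (trans ex (cong not (¬T⇒≡ ¬he)))

      -- The cycle is w o ... y e ... x w.
      chord-to-end : ∀ {e o A₁ M} → Path (Adj G) x e A₁ → Adj G w o → Path (Adj G) o y M → C ≡ A₁ ++ M →
        Adj G y e → HamCycle G
      chord-to-end {A₁ = A₁} {M} p₁ wo p₂ refl ye =
        cycle (↭-trans (++⁺ˡ M (↭-reverse A₁)) (++-comm M A₁)) (join p₂ ye (Path-reverse (Adj-sym G) p₁)) wo wx

      -- The cycle is w o ... e′ e ... x y ... o′ w, which uses the closing edge between x and y.
      chord-inside : ∀ {e o e′ o′ A₁ M D} → Path (Adj G) x e A₁ → Adj G w o → Path (Adj G) o e′ M →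
        Adj G w o′ → Path (Adj G) o′ y D → C ≡ A₁ ++ (M ++ D) → Adj G e′ e → HamCycle G
      chord-inside {A₁ = A₁} {M} {D} p₁ wo p₂ wo′ p₃ refl e′e = cycle perm
        (join p₂ e′e (join (Path-reverse (Adj-sym G) p₁) (Adj-sym G yx) (Path-reverse (Adj-sym G) p₃))) wo wo′
        where
        perm : M ++ (reverse A₁ ++ reverse D) ↭ A₁ ++ (M ++ D)
        perm = ↭-trans (++⁺ˡ M (++⁺ (↭-reverse A₁) (↭-reverse D)))
          (↭-trans (↭-reflexive (sym (++-assoc M A₁ D)))
            (↭-trans (++⁺ʳ D (++-comm M A₁)) (↭-reflexive (++-assoc A₁ M D))))

      in-C : ∀ {v} → v ≢ w → v ∈ C
      in-C {v} v≢w with ∈-++⁻ C (spanning-∈ sp v)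
      ... | inj₁ v∈ = v∈
      ... | inj₂ (here v≡w) = contradiction v≡w v≢w

      -- Both ends lie on `C`, and their cyclic successors are neighbours of w by alternation. The
      -- cases record which end comes first and whether one of them is y, whose cyclic successor is
      -- x.
      chord : ∀ {e e′} → ¬ T (h e) → ¬ T (h e′) → Adj G e e′ → HamCycle G
      chord {e} {e′} ¬he ¬he′ ee′ = go (splitAfter p (in-C e≢w))
        where
        e≢w : e ≢ w
        e≢w refl = ¬he′ ee′
        e′≢w : e′ ≢ w
        e′≢w refl = ¬he (Adj-sym G ee′)
        e≢e′ : e ≢ e′
        e≢e′ = Adj⇒≢ G ee′
        Split : Fin n → Fin n → Fin n → List (Fin n) → Set
        Split a v b D = v ≡ b ⊎ (∃[ o ] ∃[ ys ] ∃[ zs ]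
          (ExactPath w w a v ys × (Adj G v o × Exact h h v o) ×
           ExactPath w w o b zs × D ≡ ys ++ zs))
        go : Split x e y C → HamCycle G
        go (inj₁ refl) with splitAfter p (in-C e′≢w)
        ... | inj₁ e′≡y = contradiction (sym e′≡y) e≢e′
        ... | inj₂ (o , A₁ , M , p₁ , (_ , ex) , p₂ , eq) = chord-to-end (q p₁) (next ex ¬he′) (q p₂) eq ee′
        go (inj₂ (o , Z₁ , Z₂ , p₁ , (_ , ex) , p₂ , eq)) with ∈-++⁻ Z₁ (subst (e′ ∈_) eq (in-C e′≢w))
        ... | inj₁ e′∈Z₁ with splitAfter p₁ e′∈Z₁
        ...   | inj₁ e′≡e = contradiction (sym e′≡e) e≢e′
        ...   | inj₂ (o′ , W₁ , W₂ , p₃ , (_ , ex′) , p₄ , refl) =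
          chord-inside (q p₃) (next ex′ ¬he′) (q p₄) (next ex ¬he) (q p₂) (trans eq (++-assoc W₁ W₂ Z₂)) ee′
        go (inj₂ (o , Z₁ , Z₂ , p₁ , (_ , ex) , p₂ , eq)) | inj₂ e′∈Z₂ with splitAfter p₂ e′∈Z₂
        ...   | inj₁ refl = chord-to-end (q p₁) (next ex ¬he) (q p₂) eq (Adj-sym G ee′)
        ...   | inj₂ (o′ , W₁ , W₂ , p₃ , (_ , ex′) , p₄ , refl) =
          chord-inside (q p₁) (next ex ¬he) (q p₃) (next ex′ ¬he′) (q p₄) eq (Adj-sym G ee′)

      outcome : Outcome
      outcome with any? (λ e → any? λ e′ → ¬? (T? (h e)) ×-dec (¬? (T? (h e′)) ×-dec T? (adj G e e′)))
      ... | yes (e , e′ , ¬he , ¬he′ , ee′) = inj₁ (chord ¬he ¬he′ ee′)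
      -- The k + 1 non-neighbours of w, among them w itself, are independent. All their neighbours
      -- are therefore among the k neighbours of w, and the degree condition makes each of them
      -- adjacent to all of these.
      ... | no none = inj₂ (inj₂ (record
        { indep     = not ∘ h
        ; #indep    = ℕ.+-cancelʳ-≡ k _ _ (trans (cong (count (not ∘ h) +_) (sym deg-w)) (trans (count-not h) n≡))
        ; #rest     = trans (count-cong {f = not ∘ not ∘ h} {g = h} (λ v → not-not (h v))) deg-w
        ; no-edges  = λ {u} {v} iu iv uv → none (u , v , T-not iu , T-not iv , uv)
        ; all-edges = λ {u} {v} iu iv → count-tight {f = adj G u} {g = h}
            (λ z uz → T-stable (λ ¬hz → none (u , z , T-not iu , ¬hz , uz)))
            (ℕ.≤-trans (ℕ.≤-reflexive deg-w) (δ≥k u)) v (T-stable (iv ∘ not-T)) }))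
        where
        not-not : ∀ b → not (not b) ≡ b
        not-not true  = refl
        not-not false = refl
        T-stable : ∀ {b} → ¬ ¬ T b → T b
        T-stable {true}  _ = tt
        T-stable {false} ¬¬t = ¬¬t id

    -- When no crossing occurs and y is not adjacent to w, the count reads 2 d(w) + 1 ≤ 2k + ⟦ h x
    -- ⟧. With d(w) ≥ k this forces w x to be an edge, d(w) = k, and equality, hence alternation.
    outcome : Path (Adj G) x y C → ¬ T (h y) → Outcome
    outcome p ¬hy with breakEdge (noCrossing? h h {R = Adj G}) p
    ... | inj₂ (c , d , Z₁ , Z₂ , p₁ , _ , (wc , wd) , p₂ , refl) =
      inj₁ (cycle (++-comm Z₂ Z₁) (join p₂ yx (Path-map proj₁ p₁)) wd wc)
    ... | inj₁ p′ = Alternating.outcome exact wx deg-w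
      where
      bound : cnt h C + cnt h C + 1 ≤ length C + ⟦ h x ⟧ + ⟦ h y ⟧
      bound = noCrossing-count h h p′
      2deg : deg G w + deg G w + 1 ≤ k + k + ⟦ h x ⟧
      2deg = subst₂ _≤_ (cong (λ a → a + a + 1) cnt-C)
        (trans (cong₂ (λ a b → a + ⟦ h x ⟧ + b) length-C (¬T⇒⟦⟧ ¬hy)) (ℕ.+-identityʳ _)) bound
      wx : Adj G w x
      wx with T? (h x)
      ... | yes hx = hx
      ... | no ¬hx = contradiction (ℕ.≤-trans (ℕ.+-monoˡ-≤ 1 (ℕ.+-mono-≤ (δ≥k w) (δ≥k w))) 2deg)
        (ℕ.<⇒≱ (ℕ.≤-reflexive (trans (cong (λ a → suc (k + k + a)) (¬T⇒⟦⟧ ¬hx)) (e (k + k)))))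
        where
        e : ∀ a → suc (a + 0) ≡ a + 1
        e = ℕ.solve-∀
      deg-w : deg G w ≡ k
      deg-w = ℕ.≤-antisym (ℕ.+-cancelʳ-≤ k _ _ (ℕ.≤-trans (ℕ.+-monoʳ-≤ (deg G w) (δ≥k w))
        (ℕ.+-cancelʳ-≤ 1 _ _ (ℕ.≤-trans 2deg (ℕ.+-monoʳ-≤ (k + k) (⟦⟧≤1 (h x))))))) (δ≥k w)
      exact : ExactPath w w x y C
      exact = noCrossing-exact h h p′ (begin
        length C + ⟦ h x ⟧ + ⟦ h y ⟧     ≡⟨ cong₂ _+_ (cong₂ _+_ length-C (T⇒⟦⟧ wx)) (¬T⇒⟦⟧ ¬hy) ⟩
        k + k + 1 + 0                    ≡⟨ ℕ.+-identityʳ _ ⟩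
        k + k + 1                        ≡⟨ cong (λ a → a + a + 1) (trans (sym deg-w) (sym cnt-C)) ⟩
        cnt h C + cnt h C + 1            ∎)
        where open ℕ.≤-Reasoning

  -- The cycle is cut so that its last vertex is not adjacent to w: if y is adjacent to w and x is
  -- not, rotating by one step makes x the last vertex. If both are adjacent, w closes the cycle
  -- directly.
  near-cycle : ∀ {w x y C} → Path (Adj G) x y C → Adj G y x → Spanning (C ++ [ w ]) → Outcome
  near-cycle {w} {x} {y} {C} p yx sp with T? (adj G w y)
  ... | no ¬wy = NearCycle.outcome sp yx p ¬wy
  ... | yes wy with T? (adj G w x)
  ...   | yes wx = inj₁ (NearCycle.cycle {y = y} sp yx ↭-refl p wx wy)
  near-cycle {w} {x} {y} {C} (end _) yx sp | yes wy | no ¬wx = contradiction wy ¬wx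
  near-cycle {w} {x} {y} {C} (_◂_ {xs = xs} r p) yx sp | yes wy | no ¬wx =
    NearCycle.outcome (↭-trans (++⁺ʳ [ w ] (++-comm xs [ x ])) sp) r (join p yx (end x)) ¬wx

  -- A Hamilton path u … c d … z whose first half consists of u and all its neighbours.
  module Blocks {u b c d z : Fin n} {X Y : List (Fin n)}
    (spn : Spanning ((u ∷ X) ++ Y))
    (p₁ : ExactPath u z u c (u ∷ X))
    (X⊆N : All (λ v → Adj G u v) X)
    (cd : Adj G c d × Exact (adj G u) (adj G z) c d)
    (p₂ : ExactPath u z d z Y)
    (Y∩N : All (λ v → ¬ Adj G u v) Y)
    (uc : Adj G u c) (deg-u : deg G u ≡ k) where

    uniq : Unique ((u ∷ X) ++ Y)
    uniq = spanning-unique spn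

    side : Fin n → Side
    side v = if v == c then apex else (if (v == u) ∨ adj G u v then left else right)

    left⇒ : ∀ {v} → T (isLeft (side v)) → v ≢ c × (v ≡ u ⊎ Adj G u v)
    left⇒ {v} h with v ≟ c
    ... | no v≢c with v ≟ u
    ...   | yes v≡u = v≢c , inj₁ v≡u
    ...   | no v≢u with adj G u v
    ...     | true = v≢c , inj₂ tt

    right⇒ : ∀ {v} → T (isRight (side v)) → v ≢ u × ¬ Adj G u v
    right⇒ {v} h with v ≟ c
    ... | no v≢c with v ≟ u
    ...   | no v≢u with adj G u v
    ...     | false = v≢u , id

    #apex : count (isApex ∘ side) ≡ 1
    #apex = trans (count-cong {f = isApex ∘ side} {g = c ==_} same) (count-== c)
      where
      same : ∀ v → isApex (side v) ≡ (c == v)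
      same v with v ≟ c | c ≟ v
      ... | yes _   | yes _   = refl
      ... | yes v≡c | no c≢v  = contradiction (sym v≡c) c≢v
      ... | no v≢c  | yes c≡v = contradiction (sym c≡v) v≢c
      ... | no _    | no _ with (v == u) ∨ adj G u v
      ...   | true  = refl
      ...   | false = refl

    #left : count (isLeft ∘ side) ≡ k
    #left = ℕ.+-cancelʳ-≡ 1 _ _ (begin
      count (isLeft ∘ side) + 1
        ≡⟨ cong (count (isLeft ∘ side) +_) (count-== c) ⟨
      count (isLeft ∘ side) + count (c ==_)
        ≡⟨ ∑ℕ.∑-distrib-+ (λ v → ⟦ isLeft (side v) ⟧) (λ v → ⟦ c == v ⟧) ⟨
      ∑ℕ.sum (λ v → ⟦ isLeft (side v) ⟧ + ⟦ c == v ⟧)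
        ≡⟨ ∑ℕ.sum-cong-≗ same ⟩
      ∑ℕ.sum (λ v → ⟦ adj G u v ⟧ + ⟦ u == v ⟧)
        ≡⟨ ∑ℕ.∑-distrib-+ (λ v → ⟦ adj G u v ⟧) (λ v → ⟦ u == v ⟧) ⟩
      deg G u + count (u ==_)
        ≡⟨ cong₂ _+_ deg-u (count-== u) ⟩
      k + 1 ∎)
      where
      open ≡-Reasoning
      same : ∀ v → ⟦ isLeft (side v) ⟧ + ⟦ c == v ⟧ ≡ ⟦ adj G u v ⟧ + ⟦ u == v ⟧
      same v with v ≟ c | c ≟ v | v ≟ u | u ≟ v
      ... | yes v≡c | no c≢v  | _ | _ = contradiction (sym v≡c) c≢v
      ... | no v≢c  | yes c≡v | _ | _ = contradiction (sym c≡v) v≢c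
      ... | _ | _ | yes v≡u | no u≢v  = contradiction (sym v≡u) u≢v
      ... | _ | _ | no v≢u  | yes u≡v = contradiction (sym u≡v) v≢u
      ... | yes refl | yes _ | yes refl | yes _ = contradiction uc (Adj-irrefl G)
      ... | yes refl | yes _ | no _ | no _ rewrite T⇒≡ uc = refl
      ... | no _ | no _ | yes refl | yes _ rewrite loopless G v = refl
      ... | no _ | no _ | no _ | no _ with adj G u v
      ...   | true  = refl
      ...   | false = refl

    -- Let s follow a and l precede b on the path u ... a s ... l b ... z. Then s is adjacent to u
    -- as a vertex of the first block, and l is adjacent to z by exactness, because b is not
    -- adjacent to u. The cycle is a ... u s ... l z ... b a.
    crossing-edge : ∀ {a b} → T (isLeft (side a)) → T (isRight (side b)) → Adj G a b → HamCycle G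
    crossing-edge {a} {b} la rb ab with splitAfter p₁ a∈
      where
      a∈ : a ∈ u ∷ X
      a∈ with ∈-++⁻ (u ∷ X) (spanning-∈ spn a)
      ... | inj₁ a∈ = a∈
      ... | inj₂ a∈Y with proj₂ (left⇒ la)
      ...   | inj₁ a≡u = here a≡u
      ...   | inj₂ ua  = contradiction ua (All.lookup Y∩N a∈Y)
    ... | inj₁ a≡c = contradiction a≡c (proj₁ (left⇒ la))
    ... | inj₂ (s , A₁ , M₁ , q₁ , _ , q₂ , eq) with splitBefore (join q₂ cd p₂) b∈
      where
      b∈ : b ∈ M₁ ++ Y
      b∈ with ∈-++⁻ (u ∷ X) (spanning-∈ spn b)
      ... | inj₁ (here b≡u)  = contradiction b≡u (proj₁ (right⇒ rb))
      ... | inj₁ (there b∈X) = contradiction (All.lookup X⊆N b∈X) (proj₂ (right⇒ rb))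
      ... | inj₂ b∈Y         = ∈-++⁺ʳ M₁ b∈Y
    ...   | inj₁ refl = contradiction us (proj₂ (right⇒ rb))
      where
      us : Adj G u b
      us with subst (b ∈_) (sym eq) (∈-++⁺ʳ A₁ (head-∈ q₂))
      ... | here b≡u  = contradiction b≡u (proj₁ (right⇒ rb))
      ... | there b∈X = All.lookup X⊆N b∈X
    ...   | inj₂ (l , B₁ , B₂ , q₃ , (_ , ex) , q₄ , eq′) =
      crossing⇒hamCycle G (join (Path-reverse (Adj-sym G) (Path-map proj₁ q₁)) us (Path-map proj₁ q₃))
        (Path-map proj₁ q₄) lz ab perm
      where
      us : Adj G u s
      us with subst (s ∈_) (sym eq) (∈-++⁺ʳ A₁ (head-∈ q₂))
      ... | here refl = ⊥-elim (unique-disjoint A₁ (subst Unique eq (unique-prefix (u ∷ X) uniq)) (head-∈ q₁) (head-∈ q₂))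
      ... | there s∈X = All.lookup X⊆N s∈X
      lz : Adj G l z
      lz with adj G z l in zl
      ... | true  = Adj-sym G (≡⇒T zl)
      ... | false = contradiction (≡⇒T ex) (proj₂ (right⇒ rb))
      perm : Spanning ((reverse A₁ ++ B₁) ++ B₂)
      perm = ↭-trans (↭-reflexive (++-assoc (reverse A₁) B₁ B₂))
        (↭-trans (++⁺ʳ (B₁ ++ B₂) (↭-reverse A₁))
          (↭-trans (↭-reflexive (trans (cong (A₁ ++_) (sym eq′))
            (trans (sym (++-assoc A₁ M₁ Y)) (cong (_++ Y) (sym eq))))) spn))

    outcome : Outcome
    outcome with any? (λ a → any? λ b → T? (isLeft (side a)) ×-dec (T? (isRight (side b)) ×-dec T? (adj G a b)))
    ... | yes (a , b , la , rb , ab) = inj₁ (crossing-edge la rb ab)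
    ... | no none = inj₂ (inj₁ (Cliques.twoCliques G k n≡ δ≥k side #apex #left
            (λ {a} {b} la rb ab → none (a , b , la , rb , ab))))

  -- The path starts with u and a run of its neighbours ending at c. If u has no neighbour after
  -- that, `Blocks` applies. Otherwise let e be the next neighbour and w, a non-neighbour, its
  -- predecessor. By exactness the vertex a before w is adjacent to z, so u ... a z ... e u is a
  -- cycle missing only w.
  exact-path : ∀ {u z xs} → Spanning xs → deg G u ≡ k →
    ExactPath u z u z xs → Outcome
  exact-path sp deg-u (end u) = contradiction (trans (spanning-length sp) n≡)
    (ℕ.<⇒≢ (s≤s (ℕ.≤-trans 1≤k (ℕ.m≤m+n k k))))
  exact-path {u} {z} sp deg-u (_◂_ {b = b₁} r p) with breakVertex (λ v → T? (adj G u v)) (proj₁ r) p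
  ... | inj₁ all = inj₁ (u , z , _ , Path-map proj₁ (r ◂ p) , Adj-sym G (All.lookup all (last-∈ p)) , sp)
  ... | inj₂ (c , d , X , Y , q₁ , X⊆N , cd , ¬ud , q₂ , refl) with breakVertex (λ v → ¬? (T? (adj G u v))) ¬ud q₂
  ...   | inj₁ Y∩N = Blocks.outcome {b = b₁} sp (r ◂ q₁) X⊆N cd q₂ Y∩N (All.lookup X⊆N (last-∈ q₁)) deg-u
  ...   | inj₂ (w , e , Y₁ , Y₂ , q₃ , Y₁∩N , we , ¬¬ue , q₄ , refl) with unsnoc (join (r ◂ q₁) cd q₃)
  ...     | inj₁ single = contradiction single (too-long q₁)
    where
    too-long : ∀ {a b X} → ExactPath u z a b X → (u ∷ X) ++ Y₁ ≢ [ w ]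
    too-long (end _) ()
    too-long (_ ◂ _) ()
  ...     | inj₂ (a , Z , q₅ , (_ , ex) , eq) =
    near-cycle (join (Path-map proj₁ q₅) az (Path-reverse (Adj-sym G) (Path-map proj₁ q₄))) eu perm
    where
    ue : Adj G u e
    ue with T? (adj G u e)
    ... | yes h = h
    ... | no h  = contradiction h ¬¬ue
    eu : Adj G e u
    eu = Adj-sym G ue
    az : Adj G a z
    az with adj G z a in za
    ... | true  = Adj-sym G (≡⇒T za)
    ... | false = contradiction (≡⇒T ex) (All.lookup Y₁∩N (last-∈ q₃))
    perm : Spanning ((Z ++ reverse Y₂) ++ [ w ])
    perm = ↭-trans (↭-reflexive (++-assoc Z (reverse Y₂) [ w ]))
      (↭-trans (++⁺ˡ Z (↭-trans (++⁺ʳ [ w ] (↭-reverse Y₂)) (++-comm Y₂ [ w ])))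
        (↭-trans (↭-reflexive (trans (sym (++-assoc Z [ w ] Y₂))
          (trans (cong (_++ Y₂) (sym eq)) (cong (u ∷_) (++-assoc X Y₁ Y₂))))) sp))

  -- For a Hamilton path without crossings `noCrossing-count` gives d(u) + d(z) ≤ 2k, so the degree
  -- condition forces equality and the path is exact.
  outcome : Outcome
  outcome with dirac-path G 2≤n (λ u v → ℕ.≤-trans (ℕ.≤-reflexive n≡) (s≤s (ℕ.+-mono-≤ (δ≥k u) (δ≥k v))))
    where
    2≤n : 2 ≤ n
    2≤n = subst (2 ≤_) (sym n≡) (s≤s (ℕ.≤-trans 1≤k (ℕ.m≤m+n k k)))
  ... | u , z , xs , p , sp with ore G p sp
  ...   | inj₁ hc = inj₁ hc
  ...   | inj₂ q = exact-path sp deg-u (noCrossing-exact (adj G u) (adj G z) q exact)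
    where
    ends : length xs + ⟦ adj G u u ⟧ + ⟦ adj G z z ⟧ ≡ suc (k + k)
    ends = trans (cong₂ _+_ (cong₂ _+_ (trans (spanning-length sp) n≡) (cong ⟦_⟧ (loopless G u))) (cong ⟦_⟧ (loopless G z)))
      (trans (ℕ.+-identityʳ _) (ℕ.+-identityʳ _))
    degs : cnt (adj G u) xs + cnt (adj G z) xs + 1 ≡ suc (deg G u + deg G z)
    degs = trans (cong₂ (λ a b → a + b + 1) (cnt-spanning (adj G u) sp) (cnt-spanning (adj G z) sp)) (ℕ.+-comm _ 1)
    exact : length xs + ⟦ adj G u u ⟧ + ⟦ adj G z z ⟧ ≤ cnt (adj G u) xs + cnt (adj G z) xs + 1
    exact = subst₂ _≤_ (sym ends) (sym degs) (s≤s (ℕ.+-mono-≤ (δ≥k u) (δ≥k z)))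
    deg-u : deg G u ≡ k
    deg-u = ℕ.≤-antisym (ℕ.+-cancelʳ-≤ k _ _ (ℕ.≤-trans (ℕ.+-monoʳ-≤ (deg G u) (δ≥k z))
      (ℕ.≤-pred (subst₂ _≤_ degs ends (noCrossing-count (adj G u) (adj G z) q))))) (δ≥k u)

-- The spectral extremal case

≡⇒⌊≟⌋ : ∀ {a b} → a ≡ b → T ⌊ a ℕ.≟ b ⌋
≡⇒⌊≟⌋ {a} {b} e with a ℕ.≟ b
... | yes _ = tt
... | no h  = contradiction e h

⌊≟⌋⇒≡ : ∀ {a b} → T ⌊ a ℕ.≟ b ⌋ → a ≡ b
⌊≟⌋⇒≡ {a} {b} t with a ℕ.≟ b
... | yes e = e

-- The slack variables replace subtraction, so that the product a b becomes k m plus the visibly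
-- nonnegative term i j + (k + i) l; when a b = k m, that term vanishes.
degree-pair : ∀ {k m a b} → a ≤ m → b ≤ m → k + m ≤ a + b →
  ∃[ i ] ∃[ j ] ∃[ l ] (a ≡ k + i × m ≡ k + i + j × b ≡ k + j + l)
degree-pair {k} {m} {a} {b} a≤m b≤m h = i , j , l , a≡ , m≡ , b≡
  where
  k≤a : k ≤ a
  k≤a = ℕ.+-cancelʳ-≤ m _ _ (ℕ.≤-trans h (ℕ.+-monoʳ-≤ a b≤m))
  i j l : ℕ
  i = a ∸ k
  j = m ∸ a
  a≡ : a ≡ k + i
  a≡ = sym (ℕ.m+[n∸m]≡n k≤a)
  m≡ : m ≡ k + i + j
  m≡ = trans (sym (ℕ.m+[n∸m]≡n a≤m)) (cong (_+ j) a≡)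
  e : ∀ k i j → k + (k + i + j) ≡ k + i + (k + j)
  e = ℕ.solve-∀
  k+j≤b : k + j ≤ b
  k+j≤b = ℕ.+-cancelˡ-≤ (k + i) _ _ (subst₂ _≤_ (trans (cong (k +_) m≡) (e k i j)) (cong (_+ b) a≡) h)
  l = b ∸ (k + j)
  b≡ : b ≡ k + j + l
  b≡ = sym (ℕ.m+[n∸m]≡n k+j≤b)

product-≥ : ∀ {k m a b} → a ≤ m → b ≤ m → k + m ≤ a + b → k * m ≤ a * b
product-≥ {k} a≤m b≤m h with degree-pair {k} a≤m b≤m h
... | i , j , l , refl , refl , refl = ℕ.≤-trans (ℕ.m≤m+n (k * (k + i + j)) (i * j + (k + i) * l)) (ℕ.≤-reflexive (e k i j l))
  where
  e : ∀ k i j l → k * (k + i + j) + (i * j + (k + i) * l) ≡ (k + i) * (k + j + l)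
  e = ℕ.solve-∀

product-≡ : ∀ {k m a b} → 1 ≤ k → a ≤ m → b ≤ m → k + m ≤ a + b → a * b ≡ k * m →
  (a ≡ k × b ≡ m) ⊎ (a ≡ m × b ≡ k)
product-≡ {suc k′} 1≤k a≤m b≤m h ab≡ with degree-pair {suc k′} a≤m b≤m h
... | i , j , l , refl , refl , refl = conclude (ℕ.m*n≡0⇒m≡0∨n≡0 i ij≡0) (ℕ.m+n≡0⇒m≡0 l kl≡0)
  where
  k = suc k′
  e : ∀ k i j l → (k + i) * (k + j + l) ≡ k * (k + i + j) + (i * j + (k + i) * l)
  e = ℕ.solve-∀
  rest≡0 : i * j + (k + i) * l ≡ 0
  rest≡0 = ℕ.+-cancelˡ-≡ (k * (k + i + j)) _ _ (trans (sym (e k i j l)) (trans ab≡ (sym (ℕ.+-identityʳ _))))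
  ij≡0 : i * j ≡ 0
  ij≡0 = ℕ.m+n≡0⇒m≡0 (i * j) rest≡0
  kl≡0 : l + (k′ + i) * l ≡ 0
  kl≡0 = ℕ.m+n≡0⇒n≡0 (i * j) rest≡0
  conclude : i ≡ 0 ⊎ j ≡ 0 → l ≡ 0 →
    (k + i ≡ k × k + j + l ≡ k + i + j) ⊎ (k + i ≡ k + i + j × k + j + l ≡ k)
  conclude (inj₁ refl) refl = inj₁ (ℕ.+-identityʳ k , e₀ k j)
    where
    e₀ : ∀ k j → k + j + 0 ≡ k + 0 + j
    e₀ = ℕ.solve-∀
  conclude (inj₂ refl) refl = inj₂ (sym (ℕ.+-identityʳ (k + i)) , e₀ k)
    where
    e₀ : ∀ k → k + 0 + 0 ≡ k
    e₀ = ℕ.solve-∀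

module Extremal (G : Graph n) (k m : ℕ) (1≤k : 1 ≤ k) (k<m : k < m) (n≡ : n ≡ suc (k + m))
  (δ≥k : ∀ u → k ≤ deg G u) (tight : Tight (adj (complement G)) (k * m))
  (H : Graph n) (G⊆H : G ⊆ᴳ H) (closed : Closed H) where

  Ḡ H̄ : Graph n
  Ḡ = complement G
  H̄ = complement H

  H̄⊆Ḡ : H̄ ⊆ᴳ Ḡ
  H̄⊆Ḡ h with complement⇒ H h
  ... | u≢v , ¬uv = complement⇐ G u≢v (¬uv ∘ G⊆H)

  d : Fin n → ℕ
  d = deg H̄

  d+deg : ∀ u → d u + deg H u ≡ k + m
  d+deg u = ℕ.suc-injective (trans (ℕ.+-comm 1 _) (trans (deg-complement H u) n≡))

  d≤m : ∀ u → d u ≤ m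
  d≤m u = ℕ.+-cancelʳ-≤ k _ _ (ℕ.≤-trans (ℕ.+-monoʳ-≤ (d u) (ℕ.≤-trans (δ≥k u) (deg-mono {G = G} {H = H} G⊆H u)))
    (ℕ.≤-reflexive (trans (d+deg u) (ℕ.+-comm k m))))

  edge-sum : ∀ {u v} → Adj H̄ u v → k + m ≤ d u + d v
  edge-sum {u} {v} uv = ℕ.+-cancelʳ-≤ (deg H u + deg H v) _ _ (begin
    k + m + (deg H u + deg H v)         ≤⟨ ℕ.+-monoʳ-≤ (k + m) (ℕ.≤-pred (subst (deg H u + deg H v <_) n≡ degs<n)) ⟩
    k + m + (k + m)                     ≡⟨ cong₂ _+_ (sym (d+deg u)) (sym (d+deg v)) ⟩
    d u + deg H u + (d v + deg H v)     ≡⟨ e (d u) (deg H u) (d v) (deg H v) ⟩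
    d u + d v + (deg H u + deg H v)     ∎)
    where
    open ℕ.≤-Reasoning
    degs<n : deg H u + deg H v < n
    degs<n = closed (proj₁ (complement⇒ H uv)) (proj₂ (complement⇒ H uv))
    e : ∀ a b c d → a + b + (c + d) ≡ a + c + (b + d)
    e = ℕ.solve-∀

  edge-product : ∀ {u v} → Adj H̄ u v → k * m ≤ d u * d v
  edge-product {u} {v} uv = product-≥ (d≤m u) (d≤m v) (edge-sum uv)

  0<d : ∀ {u v} → Adj H̄ u v → 0 < d u
  0<d {u} {v} uv = ∃⇒0<count (adj H̄ u) v uv

  W : Fin n → Bool
  W u = ⌊ any? (λ v → T? (adj H̄ u v)) ⌋

  W⇐ : ∀ {u v} → Adj H̄ u v → T (W u)
  W⇐ {u} {v} uv with any? (λ v → T? (adj H̄ u v))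
  ... | yes _   = tt
  ... | no none = none (v , uv)

  W⇒ : ∀ {u} → T (W u) → ∃[ v ] Adj H̄ u v
  W⇒ {u} h with any? (λ v → T? (adj H̄ u v))
  ... | yes found = found

  into-W : Fin n → ℕ
  into-W v = ∑ℕ.sum (λ x → ⟦ adj Ḡ v x ⟧ * ⟦ W x ⟧)

  d≤into-W : ∀ v → d v ≤ into-W v
  d≤into-W v = ∑-mono λ x → go x (T? (adj H̄ v x))
    where
    go : ∀ x → Dec (Adj H̄ v x) → ⟦ adj H̄ v x ⟧ ≤ ⟦ adj Ḡ v x ⟧ * ⟦ W x ⟧
    go x (yes vx) = ℕ.≤-trans (⟦⟧≤1 (adj H̄ v x))
      (ℕ.≤-reflexive (sym (cong₂ _*_ (T⇒⟦⟧ (H̄⊆Ḡ vx)) (T⇒⟦⟧ (W⇐ (Adj-sym H̄ vx))))))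
    go x (no ¬vx) = ℕ.≤-trans (ℕ.≤-reflexive (¬T⇒⟦⟧ ¬vx)) z≤n

  term : Fin n → Fin n → ℕ
  term u v = ⟦ adj H̄ u v ⟧ * d v

  term≤ : ∀ u v → term u v ≤ ⟦ adj Ḡ u v ⟧ * into-W v
  term≤ u v = ℕ.*-mono-≤ (⟦⟧-mono {adj H̄ u v} H̄⊆Ḡ) (d≤into-W v)

  d*terms : ∀ u → d u * ∑ℕ.sum (term u) ≡ ∑ℕ.sum (λ v → ⟦ adj H̄ u v ⟧ * (d u * d v))
  d*terms u = trans (∑ℕ.*-distribˡ-sum (d u) (term u)) (∑ℕ.sum-cong-≗ (λ v → e (d u) ⟦ adj H̄ u v ⟧ (d v)))
    where
    e : ∀ a b c → a * (b * c) ≡ b * (a * c)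
    e = ℕ.solve-∀

  d*c : ∀ u → d u * (k * m) ≡ ∑ℕ.sum (λ v → ⟦ adj H̄ u v ⟧ * (k * m))
  d*c u = ∑ℕ.*-distribʳ-sum (k * m) (λ v → ⟦ adj H̄ u v ⟧)

  weighted-≤ : ∀ u v → ⟦ adj H̄ u v ⟧ * (k * m) ≤ ⟦ adj H̄ u v ⟧ * (d u * d v)
  weighted-≤ u v with adj H̄ u v in e
  ... | true  = ℕ.*-monoʳ-≤ 1 (edge-product (≡⇒T e))
  ... | false = z≤n

  -- Multiplication by `d u` turns the sum over the `d u` neighbours v of u into a sum of products
  -- `d u * d v`, each at least k m; then the factor `d u`, positive on `W`, is cancelled.
  c≤terms : ∀ u → T (W u) → k * m ≤ ∑ℕ.sum (term u)
  c≤terms u wu = ℕ.*-cancelˡ-≤ (d u) {{ℕ.>-nonZero (0<d (proj₂ (W⇒ wu)))}} (subst₂ _≤_ (sym (d*c u)) (sym (d*terms u))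
    (∑-mono (weighted-≤ u)))

  terms≤walks : ∀ u → ∑ℕ.sum (term u) ≤ twoWalks (adj Ḡ) W u
  terms≤walks u = ∑-mono (term≤ u)

  walks≡c : ∀ u → T (W u) → twoWalks (adj Ḡ) W u ≡ k * m
  walks≡c = tight W (λ u wu → ℕ.≤-trans (c≤terms u wu) (terms≤walks u))

  terms≡c : ∀ u → T (W u) → ∑ℕ.sum (term u) ≡ k * m
  terms≡c u wu = ℕ.≤-antisym (ℕ.≤-trans (terms≤walks u) (ℕ.≤-reflexive (walks≡c u wu))) (c≤terms u wu)

  -- As the walks number exactly k m, `term≤` is an equality in every summand. An edge of Ḡ missing
  -- from H̄ would make the left side 0, while the right side counts at least the walk u v u, which
  -- ends in `W`.
  Ḡ⊆H̄ : ∀ {u v} → T (W u) → Adj Ḡ u v → Adj H̄ u v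
  Ḡ⊆H̄ {u} {v} wu uv with T? (adj H̄ u v)
  ... | yes h = h
  ... | no ¬h = contradiction
      (trans (sym (cong (_* d v) (¬T⇒⟦⟧ ¬h))) (trans same (trans (cong (_* into-W v) (T⇒⟦⟧ uv)) (ℕ.+-identityʳ (into-W v)))))
      (ℕ.<⇒≢ (ℕ.≤-trans (ℕ.≤-reflexive (sym (cong₂ _*_ (T⇒⟦⟧ (Adj-sym Ḡ uv)) (T⇒⟦⟧ wu)))) (term≤∑ u)))
    where
    same : term u v ≡ ⟦ adj Ḡ u v ⟧ * into-W v
    same = ∑-tight (term≤ u) (ℕ.≤-trans (ℕ.≤-reflexive (walks≡c u wu)) (c≤terms u wu)) v
    term≤∑ : ∀ x → ⟦ adj Ḡ v x ⟧ * ⟦ W x ⟧ ≤ into-W v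
    term≤∑ x = ∑-term (λ x → ⟦ adj Ḡ v x ⟧ * ⟦ W x ⟧) x
      where
      ∑-term : ∀ {n} (f : Fin n → ℕ) x → f x ≤ ∑ℕ.sum f
      ∑-term f zero    = ℕ.m≤m+n (f zero) _
      ∑-term f (suc x) = ℕ.≤-trans (∑-term (f ∘ suc) x) (ℕ.m≤n+m _ (f zero))

  -- Equality in the sum behind `c≤terms` is equality in each summand.
  edge-product-≡ : ∀ {u v} → Adj H̄ u v → d u * d v ≡ k * m
  edge-product-≡ {u} {v} uv = sym (trans (sym (ℕ.*-identityˡ (k * m))) (trans
    (subst (λ a → a * (k * m) ≡ a * (d u * d v)) (T⇒⟦⟧ uv) (∑-tight (weighted-≤ u) (ℕ.≤-reflexive
      (trans (sym (d*terms u)) (trans (cong (d u *_) (terms≡c u (W⇐ uv))) (d*c u)))) v))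
    (ℕ.*-identityˡ (d u * d v))))

  edge-degrees : ∀ {u v} → Adj H̄ u v → (d u ≡ k × d v ≡ m) ⊎ (d u ≡ m × d v ≡ k)
  edge-degrees {u} {v} uv = product-≡ 1≤k (d≤m u) (d≤m v) (edge-sum uv) (edge-product-≡ uv)

  k≢m : k ≢ m
  k≢m = ℕ.<⇒≢ k<m

  P Q : Fin n → Bool
  P u = ⌊ d u ℕ.≟ m ⌋
  Q u = ⌊ d u ℕ.≟ k ⌋

  from-Q : ∀ {u} → T (Q u) → ∀ v → Adj H̄ u v → T (P v)
  from-Q qu v uv with edge-degrees uv
  ... | inj₁ (_ , dv≡m) = ≡⇒⌊≟⌋ dv≡m
  ... | inj₂ (du≡m , _) = contradiction (trans (sym (⌊≟⌋⇒≡ qu)) du≡m) k≢m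

  from-P : ∀ {u} → T (P u) → ∀ v → Adj H̄ u v → T (Q v)
  from-P pu v uv with edge-degrees uv
  ... | inj₁ (du≡k , _) = contradiction (trans (sym du≡k) (⌊≟⌋⇒≡ pu)) k≢m
  ... | inj₂ (_ , dv≡k) = ≡⇒⌊≟⌋ dv≡k

  P∩Q : ∀ u → T (P u) → ¬ T (Q u)
  P∩Q u pu qu = k≢m (trans (sym (⌊≟⌋⇒≡ qu)) (⌊≟⌋⇒≡ pu))

  module _ {u₀ v₀ : Fin n} (pu₀ : T (P u₀)) (qv₀ : T (Q v₀)) where

    k≤#P : k ≤ count P
    k≤#P = ℕ.≤-trans (ℕ.≤-reflexive (sym (⌊≟⌋⇒≡ qv₀))) (count-mono {f = adj H̄ v₀} {g = P} (from-Q qv₀))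

    m≤#Q : m ≤ count Q
    m≤#Q = ℕ.≤-trans (ℕ.≤-reflexive (sym (⌊≟⌋⇒≡ pu₀))) (count-mono {f = adj H̄ u₀} {g = Q} (from-P pu₀))

    P⊆N : count P ≤ k → ∀ {v} → T (Q v) → ∀ u → T (P u) → Adj H̄ v u
    P⊆N #P≤k {v} qv = count-tight {f = adj H̄ v} {g = P} (from-Q qv)
      (ℕ.≤-trans #P≤k (ℕ.≤-reflexive (sym (⌊≟⌋⇒≡ qv))))

    Q⊆N : count Q ≤ m → ∀ {u} → T (P u) → ∀ v → T (Q v) → Adj H̄ u v
    Q⊆N #Q≤m {u} pu = count-tight {f = adj H̄ u} {g = Q} (from-P pu)
      (ℕ.≤-trans #Q≤m (ℕ.≤-reflexive (sym (⌊≟⌋⇒≡ pu))))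

    -- Since |P| ≥ k, |Q| ≥ m and |P| + |Q| ≤ k + m + 1, one of the first two is an equality. If |P|
    -- = k, every vertex of Q is adjacent to all of P, so Q consists of neighbours of u₀ and has at
    -- most m vertices; the other case is symmetric.
    sizes : count P ≡ k × count Q ≡ m
    sizes with count P ℕ.≤? k
    ... | yes #P≤k = ℕ.≤-antisym #P≤k k≤#P , ℕ.≤-antisym
      (ℕ.≤-trans (count-mono {f = Q} {g = adj H̄ u₀} (λ v qv → Adj-sym H̄ (P⊆N #P≤k qv u₀ pu₀)))
        (ℕ.≤-reflexive (⌊≟⌋⇒≡ pu₀))) m≤#Q
    ... | no #P≰k = ℕ.≤-antisym
      (ℕ.≤-trans (count-mono {f = P} {g = adj H̄ v₀} (λ u pu → Adj-sym H̄ (Q⊆N #Q≤m pu v₀ qv₀)))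
        (ℕ.≤-reflexive (⌊≟⌋⇒≡ qv₀))) k≤#P , ℕ.≤-antisym #Q≤m m≤#Q
      where
      #Q≤m : count Q ≤ m
      #Q≤m = ℕ.+-cancelˡ-≤ (suc k) _ _ (ℕ.≤-trans (ℕ.+-monoˡ-≤ (count Q) (ℕ.≰⇒> #P≰k))
        (ℕ.≤-trans (count-disjoint P Q P∩Q) (ℕ.≤-reflexive n≡)))

    sideOf : Bool → Bool → Side
    sideOf true  _     = left
    sideOf false true  = right
    sideOf false false = apex

    side : Fin n → Side
    side v = sideOf (P v) (Q v)

    left⇒ : ∀ {v} → side v ≡ left → T (P v)
    left⇒ {v} = go (P v) (Q v)
      where
      go : ∀ p q → sideOf p q ≡ left → T p
      go true  _     _  = tt
      go false true  ()
      go false false ()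

    right⇒ : ∀ {v} → side v ≡ right → T (Q v)
    right⇒ {v} = go (P v) (Q v)
      where
      go : ∀ p q → sideOf p q ≡ right → T q
      go false true  _ = tt
      go true  _     ()
      go false false ()

    side-P : ∀ {v} → T (P v) → side v ≡ left
    side-P {v} pv = cong (λ b → sideOf b (Q v)) (T⇒≡ pv)

    side-Q : ∀ {v} → T (Q v) → side v ≡ right
    side-Q {v} qv = cong₂ sideOf (¬T⇒≡ (λ pv → P∩Q v pv qv)) (T⇒≡ qv)

    #left : count (isLeft ∘ side) ≡ k
    #left = trans (count-cong {f = isLeft ∘ side} {g = P} same) (proj₁ sizes)
      where
      same : ∀ v → isLeft (side v) ≡ P v
      same v with P v | Q v
      ... | true  | _     = refl
      ... | false | true  = refl
      ... | false | false = refl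

    #right : count (isRight ∘ side) ≡ m
    #right = trans (count-cong {f = isRight ∘ side} {g = Q} same) (proj₂ sizes)
      where
      same : ∀ v → isRight (side v) ≡ Q v
      same v with P v in pv | Q v in qv
      ... | true  | true  = contradiction (≡⇒T qv) (P∩Q v (≡⇒T pv))
      ... | true  | false = refl
      ... | false | true  = refl
      ... | false | false = refl

    #apex : count (isApex ∘ side) ≡ 1
    #apex = ℕ.+-cancelʳ-≡ (k + m) _ _ (trans (sym (ℕ.+-assoc (count (isApex ∘ side)) k m))
      (trans (cong₂ (λ a b → count (isApex ∘ side) + a + b) (sym #left) (sym #right)) (trans (sides-total side) n≡)))

    H̄-sides : ∀ {u v} → Adj H̄ u v → ¬ T (compatible (side u) (side v))
    H̄-sides {u} {v} uv c with edge-degrees uv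
    ... | inj₁ (du , dv) rewrite side-Q {u} (≡⇒⌊≟⌋ du) | side-P {v} (≡⇒⌊≟⌋ dv) = c
    ... | inj₂ (du , dv) rewrite side-P {u} (≡⇒⌊≟⌋ du) | side-Q {v} (≡⇒⌊≟⌋ dv) = c

    PQ-edge : ∀ {u v} → T (P u) → T (Q v) → ¬ Adj G u v
    PQ-edge pu qv uv = proj₂ (complement⇒ H (Q⊆N (ℕ.≤-reflexive (proj₂ sizes)) pu _ qv)) (G⊆H uv)

    isolated : ∀ {u} → ¬ T (W u) → T (isApex (side u))
    isolated {u} ¬wu = subst (T ∘ isApex) (sym (cong₂ sideOf
        (¬T⇒≡ (λ pu → positive (⌊≟⌋⇒≡ pu) (ℕ.<-trans 1≤k k<m)))
        (¬T⇒≡ (λ qu → positive (⌊≟⌋⇒≡ qu) 1≤k)))) tt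
      where
      positive : ∀ {x} → d u ≡ x → 0 < x → ⊥
      positive refl 0<x = ¬wu (W⇐ (proj₂ (0<count⇒∃ (adj H̄ u) 0<x)))

    -- A non-edge of G with an end in `W` is an edge of H̄, which runs between the two sides.
    -- Vertices outside `W` are apexes, and there is only one apex.
    joined : ∀ {u v} → u ≢ v → T (compatible (side u) (side v)) → Adj G u v
    joined {u} {v} u≢v c with T? (adj G u v) | T? (W u) | T? (W v)
    ... | yes uv | _      | _      = uv
    ... | no ¬uv | yes wu | _      = contradiction c (H̄-sides (Ḡ⊆H̄ wu (complement⇐ G u≢v ¬uv)))
    ... | no ¬uv | no _   | yes wv = contradiction c
      (H̄-sides (Adj-sym H̄ (Ḡ⊆H̄ wv (Adj-sym Ḡ (complement⇐ G u≢v ¬uv)))))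
    ... | no _   | no ¬wu | no ¬wv = contradiction (count≡1⇒≡ (isApex ∘ side) #apex (isolated ¬wu) (isolated ¬wv)) u≢v

    twoCliques : TwoCliques G 1 k m
    twoCliques = record
      { side = side ; #apex = #apex ; #left = #left ; #right = #right ; joined = joined
      ; split = λ h uv → apart (¬compatible h) uv }
      where
      apart : ∀ {u v} → (side u ≡ left × side v ≡ right) ⊎ (side u ≡ right × side v ≡ left) → ¬ Adj G u v
      apart (inj₁ (p , q)) uv = PQ-edge (left⇒ p) (right⇒ q) uv
      apart (inj₂ (p , q)) uv = PQ-edge (left⇒ q) (right⇒ p) (Adj-sym G uv)

  outcome : HamCycle H ⊎ TwoCliques G 1 k m
  outcome with any? (λ u → any? λ v → T? (adj H̄ u v))
  ... | no none = inj₁ (complete⇒hamCycle 3≤n H (λ {u} {v} u≢v → complete u v u≢v))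
    where
    3≤n : 3 ≤ n
    3≤n = subst (3 ≤_) (sym n≡) (s≤s (ℕ.+-mono-≤ 1≤k (ℕ.≤-trans 1≤k (ℕ.<⇒≤ k<m))))
    complete : ∀ u v → u ≢ v → Adj H u v
    complete u v u≢v with T? (adj H u v)
    ... | yes uv = uv
    ... | no ¬uv = contradiction (u , v , complement⇐ H u≢v ¬uv) none
  ... | yes (u , v , uv) with edge-degrees uv
  ...   | inj₁ (du≡k , dv≡m) = inj₂ (twoCliques {v} {u} (≡⇒⌊≟⌋ dv≡m) (≡⇒⌊≟⌋ du≡k))
  ...   | inj₂ (du≡m , dv≡k) = inj₂ (twoCliques {u} {v} (≡⇒⌊≟⌋ du≡m) (≡⇒⌊≟⌋ dv≡k))

-- The spectral argument tells the two sides apart by the degrees k and m, which fails for k = m.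
-- There the degree condition decides, and it admits the further family `Unbalanced`.
hamiltonian-or-extremal : ∀ (G : Graph n) (k m : ℕ) → 1 ≤ k → k ≤ m → n ≡ suc (k + m) →
  (∀ u → k ≤ deg G u) → Tight (adj (complement G)) (k * m) →
  HamCycle G ⊎ (TwoCliques G 1 k m ⊎ (k ≡ m × Unbalanced G k (suc k)))
hamiltonian-or-extremal {n} G k m 1≤k k≤m n≡ δ≥k tight with k ℕ.≟ m
... | yes refl with NashWilliams.outcome G k 1≤k n≡ δ≥k
...   | inj₁ hc        = inj₁ hc
...   | inj₂ (inj₁ tc) = inj₂ (inj₁ tc)
...   | inj₂ (inj₂ ub) = inj₂ (inj₂ (refl , ub))
hamiltonian-or-extremal {n} G k m 1≤k k≤m n≡ δ≥k tight | no k≢m =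
  conclude (Extremal.outcome G k m 1≤k (ℕ.≤∧≢⇒< k≤m k≢m) n≡ δ≥k tight (Closure.H C) (Closure.G⊆H C) (Closure.closed C))
  where
  C : Closure G
  C = closure (subst (3 ≤_) (sym n≡) (s≤s (ℕ.+-mono-≤ 1≤k (ℕ.≤-trans 1≤k k≤m)))) G
  conclude : HamCycle (Closure.H C) ⊎ TwoCliques G 1 k m → HamCycle G ⊎ (TwoCliques G 1 k m ⊎ (k ≡ m × Unbalanced G k (suc k)))
  conclude (inj₁ hc) = inj₁ (Closure.reflect C hc)
  conclude (inj₂ tc) = inj₂ (inj₁ tc)

-- Isomorphisms

-- Match `zero` with any index of its class, delete both, and recurse; the class sizes stay equal.
class-permutation : ∀ {C : Set} (_≟ᶜ_ : DecidableEquality C) {m n} (f : Fin m → C) (g : Fin n → C) →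
  (∀ c → count (λ i → ⌊ f i ≟ᶜ c ⌋) ≡ count (λ j → ⌊ g j ≟ᶜ c ⌋)) →
  Σ (Permutation m n) λ π → ∀ i → g (π ⟨$⟩ʳ i) ≡ f i
class-permutation {C} _≟ᶜ_ = go
  where
  hit : ∀ {c d : C} → c ≡ d → T ⌊ c ≟ᶜ d ⌋
  hit {c} {d} e with c ≟ᶜ d
  ... | yes _ = tt
  ... | no h  = h e
  hit⇒≡ : ∀ {c d : C} → T ⌊ c ≟ᶜ d ⌋ → c ≡ d
  hit⇒≡ {c} {d} h with c ≟ᶜ d
  ... | yes e = e
  go : ∀ {m n} (f : Fin m → C) (g : Fin n → C) →
    (∀ c → count (λ i → ⌊ f i ≟ᶜ c ⌋) ≡ count (λ j → ⌊ g j ≟ᶜ c ⌋)) →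
    Σ (Permutation m n) λ π → ∀ i → g (π ⟨$⟩ʳ i) ≡ f i
  go {zero}  {zero}  f g same = idₚ , λ ()
  go {zero}  {suc n} f g same = contradiction
    (∃⇒0<count (λ j → ⌊ g j ≟ᶜ g zero ⌋) zero (hit refl)) (ℕ.≤⇒≯ (ℕ.≤-reflexive (sym (same (g zero)))))
  go {suc m} {zero}  f g same = contradiction
    (∃⇒0<count (λ j → ⌊ f j ≟ᶜ f zero ⌋) zero (hit refl)) (ℕ.≤⇒≯ (ℕ.≤-reflexive (same (f zero))))
  go {suc m} {suc n} f g same = insert zero j (proj₁ rest) , λ { zero → gj ; (suc i) → proj₂ rest i }
    where
    found : ∃[ j ] T ⌊ g j ≟ᶜ f zero ⌋
    found = 0<count⇒∃ (λ j → ⌊ g j ≟ᶜ f zero ⌋)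
      (subst (0 <_) (same (f zero)) (∃⇒0<count (λ j → ⌊ f j ≟ᶜ f zero ⌋) zero (hit refl)))
    j : Fin (suc n)
    j = proj₁ found
    gj : g j ≡ f zero
    gj = hit⇒≡ (proj₂ found)
    same-rest : ∀ c → count (λ i → ⌊ f (suc i) ≟ᶜ c ⌋) ≡ count (λ i → ⌊ g (punchIn j i) ≟ᶜ c ⌋)
    same-rest c = ℕ.+-cancelˡ-≡ ⟦ ⌊ f zero ≟ᶜ c ⌋ ⟧ _ _ (trans (same c)
      (trans (∑ℕ.sum-remove {i = j} (λ i → ⟦ ⌊ g i ≟ᶜ c ⌋ ⟧))
        (cong (λ d → ⟦ ⌊ d ≟ᶜ c ⌋ ⟧ + count (λ i → ⌊ g (punchIn j i) ≟ᶜ c ⌋)) gj)))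
    rest : Σ (Permutation m n) λ π → ∀ i → g (punchIn j (π ⟨$⟩ʳ i)) ≡ f (suc i)
    rest = go (f ∘ suc) (g ∘ punchIn j) same-rest

⟨$⟩ʳ-injective : ∀ {m n} (π : Permutation m n) {i j} → π ⟨$⟩ʳ i ≡ π ⟨$⟩ʳ j → i ≡ j
⟨$⟩ʳ-injective π e = trans (sym (inverseˡ π)) (trans (cong (π ⟨$⟩ˡ_) e) (inverseˡ π))

T-ext : ∀ {a b} → (T a → T b) → (T b → T a) → a ≡ b
T-ext {true}  {b}     f g = sym (T⇒≡ (f tt))
T-ext {false} {true}  f g = contradiction (g tt) id
T-ext {false} {false} f g = refl

twoCliques-≅ : ∀ {m n} {G : Graph m} {H : Graph n} {c a b} → TwoCliques G c a b → TwoCliques H c a b → G ≅ H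
twoCliques-≅ {m} {n} {G} {H} {c} {a} {b} S S′ = π , λ i j → T-ext (to i j) (from i j)
  where
  module S = TwoCliques S
  module S′ = TwoCliques S′
  same : ∀ s → count (λ i → ⌊ S.side i ≟ˢ s ⌋) ≡ count (λ i → ⌊ S′.side i ≟ˢ s ⌋)
  same apex  = trans S.#apex (sym S′.#apex)
  same left  = trans S.#left (sym S′.#left)
  same right = trans S.#right (sym S′.#right)
  matched : Σ (Permutation m n) λ π → ∀ i → S′.side (π ⟨$⟩ʳ i) ≡ S.side i
  matched = class-permutation _≟ˢ_ S.side S′.side same
  π : Permutation m n
  π = proj₁ matched
  sides : ∀ i j → compatible (S′.side (π ⟨$⟩ʳ i)) (S′.side (π ⟨$⟩ʳ j)) ≡ compatible (S.side i) (S.side j)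
  sides i j = cong₂ compatible (proj₂ matched i) (proj₂ matched j)
  to : ∀ i j → Adj G i j → Adj H (π ⟨$⟩ʳ i) (π ⟨$⟩ʳ j)
  to i j ij with T? (compatible (S.side i) (S.side j))
  ... | yes h = S′.joined (Adj⇒≢ G ij ∘ ⟨$⟩ʳ-injective π) (subst T (sym (sides i j)) h)
  ... | no h  = contradiction ij (S.split h)
  from : ∀ i j → Adj H (π ⟨$⟩ʳ i) (π ⟨$⟩ʳ j) → Adj G i j
  from i j ij with T? (compatible (S.side i) (S.side j))
  ... | yes h = S.joined (λ e → Adj⇒≢ H ij (cong (π ⟨$⟩ʳ_) e)) h
  ... | no h  = contradiction ij (S′.split (h ∘ subst T (sides i j)))

count-split : ∀ a {b} (f : Fin (a + b) → Bool) → count f ≡ count (λ i → f (i ↑ˡ b)) + count (λ j → f (a ↑ʳ j))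
count-split zero    f = refl
count-split (suc a) f = trans (cong (⟦ f zero ⟧ +_) (count-split a (f ∘ suc)))
  (sym (ℕ.+-assoc ⟦ f zero ⟧ _ _))

count-all : ∀ (f : Fin n → Bool) → (∀ i → T (f i)) → count f ≡ n
count-all {n} f h = trans (∑ℕ.sum-cong-≗ (λ i → T⇒⟦⟧ (h i))) (trans (∑-const n 1) (ℕ.*-identityʳ n))

count-splitAt : ∀ a b (t : Fin a ⊎ Fin b → Bool) →
  count (λ i → t (splitAt a i)) ≡ count (t ∘ inj₁) + count (t ∘ inj₂)
count-splitAt a b t = trans (count-split a (λ i → t (splitAt a i)))
  (cong₂ _+_ (count-cong {f = λ i → t (splitAt a (i ↑ˡ b))} {g = t ∘ inj₁} (λ i → cong t (splitAt-↑ˡ a i b)))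
             (count-cong {f = λ j → t (splitAt a (a ↑ʳ j))} {g = t ∘ inj₂} (λ j → cong t (splitAt-↑ʳ a b j))))

union-twoCliques : ∀ a b → TwoCliques (K a +ᴳ K b) 0 a b
union-twoCliques a b = record
  { side   = λ i → sideOf (splitAt a i)
  ; #apex  = trans (count-splitAt a b (isApex ∘ sideOf)) (cong₂ _+_ (count-none {a} _ (λ _ ())) (count-none {b} _ (λ _ ())))
  ; #left  = trans (count-splitAt a b (isLeft ∘ sideOf))
      (trans (cong₂ _+_ (count-all {a} _ (λ _ → tt)) (count-none {b} _ (λ _ ()))) (ℕ.+-identityʳ a))
  ; #right = trans (count-splitAt a b (isRight ∘ sideOf)) (cong₂ _+_ (count-none {a} _ (λ _ ())) (count-all {b} _ (λ _ → tt)))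
  ; joined = λ {u} {v} u≢v h → within (splitAt a u) (splitAt a v) refl refl u≢v h
  ; split  = λ {u} {v} h → across (splitAt a u) (splitAt a v) h
  }
  where
  sideOf : Fin a ⊎ Fin b → Side
  sideOf = [ const left , const right ]′
  within : ∀ {u v} s t → splitAt a u ≡ s → splitAt a v ≡ t → u ≢ v → T (compatible (sideOf s) (sideOf t)) →
           T (glueAdj false (K a) (K b) s t)
  within (inj₁ i) (inj₁ j) p q u≢v _ = not-T (≢⇒¬== (λ i≡j → u≢v
    (trans (sym (splitAt⁻¹-↑ˡ p)) (trans (cong (_↑ˡ b) i≡j) (splitAt⁻¹-↑ˡ q)))))
  within (inj₂ i) (inj₂ j) p q u≢v _ = not-T (≢⇒¬== (λ i≡j → u≢v
    (trans (sym (splitAt⁻¹-↑ʳ p)) (trans (cong (a ↑ʳ_) i≡j) (splitAt⁻¹-↑ʳ q)))))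
  across : ∀ s t → ¬ T (compatible (sideOf s) (sideOf t)) → ¬ T (glueAdj false (K a) (K b) s t)
  across (inj₁ i) (inj₁ j) h = contradiction tt h
  across (inj₁ i) (inj₂ j) h = id
  across (inj₂ i) (inj₁ j) h = id
  across (inj₂ i) (inj₂ j) h = contradiction tt h

cone-twoCliques : ∀ {G : Graph n} {c a b} → TwoCliques G c a b → TwoCliques (cone G) (suc c) a b
cone-twoCliques {n} {G} {c} {a} {b} S = record
  { side   = side
  ; #apex  = cong suc S.#apex
  ; #left  = S.#left
  ; #right = S.#right
  ; joined = λ {u} {v} → joined u v
  ; split  = λ {u} {v} → split u v
  }
  where
  module S = TwoCliques S
  side : Fin (suc n) → Side
  side zero    = apex
  side (suc i) = S.side i
  joined : ∀ u v → u ≢ v → T (compatible (side u) (side v)) → Adj (cone G) u v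
  joined zero    zero    u≢v _ = contradiction refl u≢v
  joined zero    (suc v) _   _ = tt
  joined (suc u) zero    _   _ = tt
  joined (suc u) (suc v) u≢v h = S.joined (u≢v ∘ cong suc) h
  split : ∀ u v → ¬ T (compatible (side u) (side v)) → ¬ Adj (cone G) u v
  split zero    zero    h = contradiction tt h
  split zero    (suc v) h = contradiction tt h
  split (suc u) zero    h = contradiction (always (S.side u)) h
    where
    always : ∀ s → T (compatible s apex)
    always apex  = tt
    always left  = tt
    always right = tt
  split (suc u) (suc v) h = S.split h

-- The new vertex is adjacent to all others, and both sides are nonempty, so it can lie in neither
-- side and must be an apex.
cone-twoCliques⁻¹ : ∀ {G : Graph n} {c a b} → 1 ≤ a → 1 ≤ b → TwoCliques (cone G) (suc c) a b → TwoCliques G c a b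
cone-twoCliques⁻¹ {n} {G} {c} {a} {b} 1≤a 1≤b S = record
  { side   = S.side ∘ suc
  ; #apex  = ℕ.suc-injective (trans (cong (λ s → ⟦ isApex s ⟧ + count (isApex ∘ S.side ∘ suc)) (sym zero-apex)) S.#apex)
  ; #left  = trans (cong (λ s → ⟦ isLeft s ⟧ + count (isLeft ∘ S.side ∘ suc)) (sym zero-apex)) S.#left
  ; #right = trans (cong (λ s → ⟦ isRight s ⟧ + count (isRight ∘ S.side ∘ suc)) (sym zero-apex)) S.#right
  ; joined = λ u≢v → S.joined (u≢v ∘ suc-injective)
  ; split  = S.split
  }
  where
  module S = TwoCliques S
  ≡left : ∀ {s} → T (isLeft s) → s ≡ left
  ≡left {left} _ = refl
  ≡right : ∀ {s} → T (isRight s) → s ≡ right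
  ≡right {right} _ = refl
  universal : ∀ v → zero ≢ v → T (compatible (S.side zero) (S.side v))
  universal zero    0≢v = contradiction refl 0≢v
  universal (suc v) _ with T? (compatible (S.side zero) (S.side (suc v)))
  ... | yes h = h
  ... | no h  = contradiction tt (S.split h)
  zero-apex : S.side zero ≡ apex
  zero-apex = go (S.side zero) refl (0<count⇒∃ (isLeft ∘ S.side) (subst (0 <_) (sym S.#left) 1≤a))
      (0<count⇒∃ (isRight ∘ S.side) (subst (0 <_) (sym S.#right) 1≤b))
    where
    go : ∀ s → S.side zero ≡ s → ∃[ l ] T (isLeft (S.side l)) → ∃[ r ] T (isRight (S.side r)) → s ≡ apex
    go apex  _ _ _ = refl
    go left  p _ (r , sr) = contradiction
      (subst₂ (λ s t → T (compatible s t)) p (≡right sr) (universal r (λ { refl → ≢right (trans (sym p) (≡right sr)) }))) id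
      where
      ≢right : left ≢ right
      ≢right ()
    go right p (l , sl) _ = contradiction
      (subst₂ (λ s t → T (compatible s t)) p (≡left sl) (universal l (λ { refl → ≢left (trans (sym p) (≡left sl)) }))) id
      where
      ≢left : right ≢ left
      ≢left ()

-- The complement is K_{a,b} with isolated vertices, where two steps from any
-- vertex can be made in at most a b ways.
twoCliques-walks : ∀ {G : Graph n} {c a b} → TwoCliques G c a b →
  ∀ u → ∑ℕ.sum (λ v → ⟦ adj (complement G) u v ⟧ * deg (complement G) v) ≤ a * b
twoCliques-walks {n} {G} {c} {a} {b} S u = go (S.side u) refl
  where
  module S = TwoCliques S
  Ḡ : Graph n
  Ḡ = complement G
  opposite : ∀ {x y} → Adj Ḡ x y → (S.side x ≡ left × S.side y ≡ right) ⊎ (S.side x ≡ right × S.side y ≡ left)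
  opposite xy = ¬compatible (λ h → proj₂ (complement⇒ G xy) (S.joined (proj₁ (complement⇒ G xy)) h))
  left-nbr : ∀ {x y} → S.side x ≡ left → Adj Ḡ x y → S.side y ≡ right
  left-nbr p xy with opposite xy
  ... | inj₁ (_ , q) = q
  ... | inj₂ (p′ , _) = contradiction (trans (sym p) p′) λ ()
  right-nbr : ∀ {x y} → S.side x ≡ right → Adj Ḡ x y → S.side y ≡ left
  right-nbr p xy with opposite xy
  ... | inj₁ (p′ , _) = contradiction (trans (sym p) p′) λ ()
  ... | inj₂ (_ , q) = q
  deg-left : ∀ {x} → S.side x ≡ left → deg Ḡ x ≤ b
  deg-left {x} p = ℕ.≤-trans (count-mono {f = adj Ḡ x} {g = isRight ∘ S.side} (λ y xy → ≡right⇒ (left-nbr p xy)))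
    (ℕ.≤-reflexive S.#right)
  deg-right : ∀ {x} → S.side x ≡ right → deg Ḡ x ≤ a
  deg-right {x} p = ℕ.≤-trans (count-mono {f = adj Ḡ x} {g = isLeft ∘ S.side} (λ y xy → ≡left⇒ (right-nbr p xy)))
    (ℕ.≤-reflexive S.#left)
  bounded-walks : ∀ (t : Side → Bool) d → (∀ v → Adj Ḡ u v → T (t (S.side v)) × deg Ḡ v ≤ d) →
    ∑ℕ.sum (λ v → ⟦ adj Ḡ u v ⟧ * deg Ḡ v) ≤ count (t ∘ S.side) * d
  bounded-walks t d h = ℕ.≤-trans (∑-mono each)
    (ℕ.≤-reflexive (sym (∑ℕ.*-distribʳ-sum d (λ v → ⟦ t (S.side v) ⟧))))
    where
    each : ∀ v → ⟦ adj Ḡ u v ⟧ * deg Ḡ v ≤ ⟦ t (S.side v) ⟧ * d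
    each v with T? (adj Ḡ u v)
    ... | yes uv = ℕ.*-mono-≤ (⟦⟧-mono {adj Ḡ u v} (λ _ → proj₁ (h v uv))) (proj₂ (h v uv))
    ... | no ¬uv = ℕ.≤-trans (ℕ.≤-reflexive (cong (_* deg Ḡ v) (¬T⇒⟦⟧ ¬uv))) z≤n
  go : ∀ s → S.side u ≡ s → ∑ℕ.sum (λ v → ⟦ adj Ḡ u v ⟧ * deg Ḡ v) ≤ a * b
  go apex p = ℕ.≤-trans (bounded-walks isLeft 0 (λ v uv → contradiction (opposite uv) none))
      (ℕ.≤-trans (ℕ.≤-reflexive (ℕ.*-zeroʳ (count (isLeft ∘ S.side)))) z≤n)
    where
    none : ∀ {y} → ¬ ((S.side u ≡ left × S.side y ≡ right) ⊎ (S.side u ≡ right × S.side y ≡ left))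
    none (inj₁ (q , _)) = contradiction (trans (sym p) q) λ ()
    none (inj₂ (q , _)) = contradiction (trans (sym p) q) λ ()
  go left p = ℕ.≤-trans (bounded-walks isRight a (λ v uv → ≡right⇒ (left-nbr p uv) , deg-right (left-nbr p uv)))
    (ℕ.≤-reflexive (trans (cong (_* a) S.#right) (ℕ.*-comm b a)))
  go right p = ℕ.≤-trans (bounded-walks isLeft b (λ v uv → ≡left⇒ (right-nbr p uv) , deg-left (right-nbr p uv)))
    (ℕ.≤-reflexive (cong (_* b) S.#left))

-- The independent set has a second vertex, so the universal new vertex cannot belong to it.
cone-unbalanced⁻¹ : ∀ {G : Graph n} {a b} → 2 ≤ b → Unbalanced (cone G) (suc a) b → Unbalanced G a b
cone-unbalanced⁻¹ {n} {G} {a} {b} 2≤b U = record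
  { indep     = U.indep ∘ suc
  ; #indep    = trans (cong (λ t → ⟦ t ⟧ + count (U.indep ∘ suc)) (sym zero∉)) U.#indep
  ; #rest     = ℕ.suc-injective (trans (cong (λ t → ⟦ not t ⟧ + count (not ∘ U.indep ∘ suc)) (sym zero∉)) U.#rest)
  ; no-edges  = U.no-edges
  ; all-edges = U.all-edges
  }
  where
  module U = Unbalanced U
  zero∉ : U.indep zero ≡ false
  zero∉ = ¬T⇒≡ λ h → U.no-edges h (proj₂ (other h)) tt
    where
    other : T (U.indep zero) → ∃[ v ] T (U.indep (suc v))
    other h = 0<count⇒∃ (U.indep ∘ suc) (ℕ.≤-pred (ℕ.≤-trans 2≤b (ℕ.≤-reflexive
      (trans (sym U.#indep) (cong (_+ count (U.indep ∘ suc)) (T⇒⟦⟧ h))))))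

edgeless : ∀ b i j → adj (b ·ᴳ K 1) i j ≡ false
edgeless (suc b) zero    zero    = refl
edgeless (suc b) zero    (suc j) = refl
edgeless (suc b) (suc i) zero    = refl
edgeless (suc b) (suc i) (suc j) = edgeless b i j

-- Two matchings are needed, because `Kᵇ a b` lives on `a * 1 + b * 1` vertices and the join on
-- `a + b * 1`.
unbalanced-sandwich : ∀ {G : Graph n} {a b} → Unbalanced G a b →
  (Kᵇ a b ⊑ G) × (G ⊑ K a ∨ᴳ (b ·ᴳ K 1))
unbalanced-sandwich {n} {G} {a} {b} U = (proj₁ below , from-bipartite) , (proj₁ above , to-join)
  where
  module U = Unbalanced U
  second : ∀ {p q} → Fin p ⊎ Fin q → Bool
  second = [ const false , const true ]′
  as-true : ∀ {m} (f : Fin m → Bool) → count (λ i → ⌊ f i ≟ᵇ true ⌋) ≡ count f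
  as-true f = count-cong {f = λ i → ⌊ f i ≟ᵇ true ⌋} {g = f} (λ i → h (f i))
    where
    h : ∀ x → ⌊ x ≟ᵇ true ⌋ ≡ x
    h true  = refl
    h false = refl
  as-false : ∀ {m} (f : Fin m → Bool) → count (λ i → ⌊ f i ≟ᵇ false ⌋) ≡ count (not ∘ f)
  as-false f = count-cong {f = λ i → ⌊ f i ≟ᵇ false ⌋} {g = not ∘ f} (λ i → h (f i))
    where
    h : ∀ x → ⌊ x ≟ᵇ false ⌋ ≡ not x
    h true  = refl
    h false = refl
  #second : ∀ p q → count (λ i → second {p} {q} (splitAt p i)) ≡ q
  #second p q = trans (count-splitAt p q second) (cong₂ _+_ (count-none {p} _ (λ _ ())) (count-all {q} _ (λ _ → tt)))
  #first : ∀ p q → count (λ i → not (second {p} {q} (splitAt p i))) ≡ p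
  #first p q = trans (count-splitAt p q (not ∘ second))
    (trans (cong₂ _+_ (count-all {p} _ (λ _ → tt)) (count-none {q} _ (λ _ ()))) (ℕ.+-identityʳ p))
  same : ∀ p q → p ≡ a → q ≡ b → ∀ c →
    count (λ i → ⌊ second {p} {q} (splitAt p i) ≟ᵇ c ⌋) ≡ count (λ i → ⌊ U.indep i ≟ᵇ c ⌋)
  same p q p≡a q≡b true = trans (as-true (λ i → second {p} {q} (splitAt p i)))
    (trans (#second p q) (trans q≡b (trans (sym U.#indep) (sym (as-true U.indep)))))
  same p q p≡a q≡b false = trans (as-false (λ i → second {p} {q} (splitAt p i)))
    (trans (#first p q) (trans p≡a (trans (sym U.#rest) (sym (as-false U.indep)))))
  below : Σ (Permutation (a * 1 + b * 1) n) λ π → ∀ i → U.indep (π ⟨$⟩ʳ i) ≡ second (splitAt (a * 1) i)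
  below = class-permutation _≟ᵇ_ (λ i → second (splitAt (a * 1) i)) U.indep
    (same (a * 1) (b * 1) (ℕ.*-identityʳ a) (ℕ.*-identityʳ b))
  above : Σ (Permutation n (a + b * 1)) λ π → ∀ i → second (splitAt a (π ⟨$⟩ʳ i)) ≡ U.indep i
  above = class-permutation _≟ᵇ_ U.indep (λ i → second (splitAt a i)) (λ c → sym (same a (b * 1) refl (ℕ.*-identityʳ b) c))
  from-bipartite : ∀ i j → Adj (Kᵇ a b) i j → Adj G (proj₁ below ⟨$⟩ʳ i) (proj₁ below ⟨$⟩ʳ j)
  from-bipartite i j = go (splitAt (a * 1) i) (splitAt (a * 1) j) refl refl
    where
    indep-at : ∀ {i s} → splitAt (a * 1) i ≡ s → U.indep (proj₁ below ⟨$⟩ʳ i) ≡ second s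
    indep-at {i} e = trans (proj₂ below i) (cong second e)
    go : ∀ s t → splitAt (a * 1) i ≡ s → splitAt (a * 1) j ≡ t → T (glueAdj true (a ·ᴳ K 1) (b ·ᴳ K 1) s t) →
         Adj G (proj₁ below ⟨$⟩ʳ i) (proj₁ below ⟨$⟩ʳ j)
    go (inj₁ x) (inj₁ y) _ _ h = contradiction h (≡⇒¬T (edgeless a x y))
    go (inj₂ x) (inj₂ y) _ _ h = contradiction h (≡⇒¬T (edgeless b x y))
    go (inj₁ x) (inj₂ y) p q _ = Adj-sym G (U.all-edges (≡⇒T (indep-at q)) (≡⇒¬T (indep-at p)))
    go (inj₂ x) (inj₁ y) p q _ = U.all-edges (≡⇒T (indep-at p)) (≡⇒¬T (indep-at q))
  to-join : ∀ i j → Adj G i j → Adj (K a ∨ᴳ (b ·ᴳ K 1)) (proj₁ above ⟨$⟩ʳ i) (proj₁ above ⟨$⟩ʳ j)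
  to-join i j ij = go (splitAt a (proj₁ above ⟨$⟩ʳ i)) (splitAt a (proj₁ above ⟨$⟩ʳ j)) refl refl
    where
    at-indep : ∀ {i s} → splitAt a (proj₁ above ⟨$⟩ʳ i) ≡ s → U.indep i ≡ second s
    at-indep {i} e = trans (sym (proj₂ above i)) (cong second e)
    go : ∀ s t → splitAt a (proj₁ above ⟨$⟩ʳ i) ≡ s → splitAt a (proj₁ above ⟨$⟩ʳ j) ≡ t →
         T (glueAdj true (K a) (b ·ᴳ K 1) s t)
    go (inj₁ x) (inj₁ y) p q = not-T (≢⇒¬== (λ x≡y → Adj⇒≢ G ij (⟨$⟩ʳ-injective (proj₁ above)
      (trans (sym (splitAt⁻¹-↑ˡ p)) (trans (cong (_↑ˡ (b * 1)) x≡y) (splitAt⁻¹-↑ˡ q))))))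
    go (inj₁ x) (inj₂ y) p q = tt
    go (inj₂ x) (inj₁ y) p q = tt
    go (inj₂ x) (inj₂ y) p q = contradiction ij (U.no-edges (≡⇒T (at-indep p)) (≡⇒T (at-indep q)))

-- The complement of the cone is the complement of G with an isolated vertex.
cone-tight : ∀ (G : Graph n) {c} → 1 ≤ c → Tight (adj (complement G)) c → Tight (adj (complement (cone G))) c
cone-tight {n} G {c} 1≤c tight w many = go
  where
  D : Fin n → Fin n → Bool
  D = adj (complement G)
  D⁺ : Fin (suc n) → Fin (suc n) → Bool
  D⁺ = adj (complement (cone G))
  w′ : Fin n → Bool
  w′ = w ∘ suc
  D⁺-suc : ∀ u v → D⁺ (suc u) (suc v) ≡ D u v
  D⁺-suc u v with u ≟ v
  ... | yes _ = refl
  ... | no _  = refl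
  same : ∀ u → twoWalks D⁺ w (suc u) ≡ twoWalks D w′ u
  same u = ∑ℕ.sum-cong-≗ (λ v → cong₂ (λ a b → ⟦ a ⟧ * b) (D⁺-suc u v)
    (∑ℕ.sum-cong-≗ (λ x → cong (λ a → ⟦ a ⟧ * ⟦ w′ x ⟧) (D⁺-suc v x))))
  from-zero : twoWalks D⁺ w zero ≡ 0
  from-zero = trans (∑-const n 0) (ℕ.*-zeroʳ n)
  go : ∀ u → T (w u) → twoWalks D⁺ w u ≡ c
  go zero    w0 = contradiction (ℕ.≤-trans 1≤c (ℕ.≤-trans (many zero w0) (ℕ.≤-reflexive from-zero))) λ ()
  go (suc u) wu = trans (same u) (tight w′ (λ v wv → ℕ.≤-trans (many (suc v) wv) (ℕ.≤-reflexive (same v))) u wu)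

-- Assembling the two statements

hamPath⇒Traceable : ∀ {G : Graph n} {a b} → HamPath G a b → Traceable G
hamPath⇒Traceable (xs , p , sp) = xs , spanning-unique sp , Path⇒Linked′ p , spanning-∈ sp

unbalanced⇒𝓗 : ∀ {G : Graph n} {a b} → a ≡ ⌈ n /2⌉ ∸ 1 → b ≡ ⌊ n /2⌋ + 1 → Unbalanced G a b → 𝓗 G
unbalanced⇒𝓗 refl refl = unbalanced-sandwich

m∸n∸1-eq : ∀ {n k} → suc k ≤ n → n ≡ suc (k + (n ∸ k ∸ 1))
m∸n∸1-eq {n} {k} k<n = begin
  n                        ≡⟨ ℕ.m+[n∸m]≡n k<n ⟨
  suc k + (n ∸ suc k)      ≡⟨ cong (λ a → suc k + (n ∸ a)) (ℕ.+-comm 1 k) ⟩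
  suc k + (n ∸ (k + 1))    ≡⟨ cong (suc k +_) (ℕ.∸-+-assoc n k 1) ⟨
  suc k + (n ∸ k ∸ 1)      ∎
  where open ≡-Reasoning

-- The cone has order n + 1 and minimum degree at least k + 1, so the general result is applied with
-- `suc k` and the same m. The bound (k + 1) m already comes from the complement of `Lᵤ n k`, since
-- coning only adds an isolated vertex to complements.
traceable-part : ∀ (k : ℕ) (G : Graph n) → k ≤ δ G → 2 * k + 2 ≤ n →
  ∀ r s → IsSpectralRadius (complement G) r → IsSpectralRadius (complement (Lᵤ n k)) s → r ≤ᴿ s →
  Traceable G ⊎ ((G ≅ Lᵤ n k) ⊎ ((n ≡ 2 * k + 2) × 𝓗 G))
traceable-part {n} k G k≤δ 2k+2≤n r s ρG ρL r≤s =
  conclude (hamiltonian-or-extremal (cone G) (suc k) m (s≤s z≤n) k<m (cong suc n≡) δ≥ (cone-tight G 1≤c tight))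
  where
  m : ℕ
  m = n ∸ k ∸ 1
  2k+2 : 2 * k + 2 ≡ suc (k + suc k)
  2k+2 = e k
    where
    e : ∀ k → 2 * k + 2 ≡ suc (k + suc k)
    e = ℕ.solve-∀
  n≡ : n ≡ suc (k + m)
  n≡ = m∸n∸1-eq (ℕ.≤-trans (s≤s (ℕ.m≤m+n k (suc k))) (ℕ.≤-trans (ℕ.≤-reflexive (sym 2k+2)) 2k+2≤n))
  k<m : suc k ≤ m
  k<m = ℕ.+-cancelˡ-≤ (suc k) _ _ (ℕ.≤-trans (ℕ.≤-reflexive (sym 2k+2)) (ℕ.≤-trans 2k+2≤n (ℕ.≤-reflexive n≡)))
  1≤m : 1 ≤ m
  1≤m = ℕ.≤-trans (s≤s z≤n) k<m
  1≤n : 1 ≤ n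
  1≤n = subst (1 ≤_) (sym n≡) (s≤s z≤n)
  1≤c : 1 ≤ suc k * m
  1≤c = ℕ.*-mono-≤ {1} {suc k} (s≤s z≤n) 1≤m
  extremal : TwoCliques (Lᵤ n k) 0 (suc k) m
  extremal = subst (λ a → TwoCliques (Lᵤ n k) 0 a m) (ℕ.+-comm k 1) (union-twoCliques (k + 1) m)
  tight : Tight (adj (complement G)) (suc k * m)
  tight = spectral⇒tight (complement G) (complement (Lᵤ n k)) r s ρG ρL r≤s (suc k * m) 1≤c (twoCliques-walks extremal)
  δ≥ : ∀ u → suc k ≤ deg (cone G) u
  δ≥ zero    = ℕ.≤-trans (ℕ.≤-trans (s≤s (ℕ.m≤m+n k m)) (ℕ.≤-reflexive (sym n≡)))
    (ℕ.≤-reflexive (sym (count-all {n} (λ _ → true) (λ _ → tt))))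
  δ≥ (suc u) = s≤s (ℕ.≤-trans k≤δ (δ≤deg G u))
  conclude : HamCycle (cone G) ⊎ (TwoCliques (cone G) 1 (suc k) m ⊎ (suc k ≡ m × Unbalanced (cone G) (suc k) (suc (suc k)))) →
    Traceable G ⊎ ((G ≅ Lᵤ n k) ⊎ ((n ≡ 2 * k + 2) × 𝓗 G))
  conclude (inj₁ hc) with cone-hamCycle G 1≤n hc
  ... | _ , _ , path = inj₁ (hamPath⇒Traceable {G = G} path)
  conclude (inj₂ (inj₁ S)) = inj₂ (inj₁ (twoCliques-≅ (cone-twoCliques⁻¹ (s≤s z≤n) 1≤m S) extremal))
  conclude (inj₂ (inj₂ (k+1≡m , U))) = inj₂ (inj₂ (trans n≡′ (sym 2k+2) ,
      unbalanced⇒𝓗 a≡ b≡ (cone-unbalanced⁻¹ (s≤s (s≤s z≤n)) U)))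
    where
    n≡′ : n ≡ suc (k + suc k)
    n≡′ = trans n≡ (cong (λ a → suc (k + a)) (sym k+1≡m))
    n≡″ : n ≡ suc (suc (k + k))
    n≡″ = trans n≡′ (cong suc (ℕ.+-suc k k))
    a≡ : k ≡ ⌈ n /2⌉ ∸ 1
    a≡ = trans (ℕ.n≡⌈n+n/2⌉ k) (cong (λ a → ⌈ a /2⌉ ∸ 1) (sym n≡″))
    b≡ : suc (suc k) ≡ ⌊ n /2⌋ + 1
    b≡ = trans (ℕ.+-comm 1 (suc k)) (cong (_+ 1) (trans (cong suc (ℕ.n≡⌊n+n/2⌋ k)) (cong ⌊_/2⌋ (sym n≡″))))

hamiltonian-part : ∀ (k : ℕ) (G : Graph n) → k ≤ δ G → 1 ≤ k → 2 * k + 1 ≤ n →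
  ∀ r s → IsSpectralRadius (complement G) r → IsSpectralRadius (complement (L n k)) s → r ≤ᴿ s →
  Hamiltonian G ⊎ ((G ≅ L n k) ⊎ ((n ≡ 2 * k + 1) × 𝓗 G))
hamiltonian-part {n} k G k≤δ 1≤k 2k+1≤n r s ρG ρL r≤s =
  conclude (hamiltonian-or-extremal G k m 1≤k k≤m n≡ (λ u → ℕ.≤-trans k≤δ (δ≤deg G u)) tight)
  where
  m : ℕ
  m = n ∸ k ∸ 1
  2k+1 : 2 * k + 1 ≡ suc (k + k)
  2k+1 = e k
    where
    e : ∀ k → 2 * k + 1 ≡ suc (k + k)
    e = ℕ.solve-∀
  n≡ : n ≡ suc (k + m)
  n≡ = m∸n∸1-eq (ℕ.≤-trans (s≤s (ℕ.m≤m+n k k)) (ℕ.≤-trans (ℕ.≤-reflexive (sym 2k+1)) 2k+1≤n))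
  k≤m : k ≤ m
  k≤m = ℕ.+-cancelˡ-≤ (suc k) _ _ (ℕ.≤-trans (ℕ.≤-reflexive (sym 2k+1)) (ℕ.≤-trans 2k+1≤n (ℕ.≤-reflexive n≡)))
  extremal : TwoCliques (L n k) 1 k m
  extremal = cone-twoCliques (union-twoCliques k m)
  tight : Tight (adj (complement G)) (k * m)
  tight = spectral⇒tight (complement G) (complement (L n k)) r s ρG ρL r≤s (k * m)
    (ℕ.*-mono-≤ 1≤k (ℕ.≤-trans 1≤k k≤m)) (twoCliques-walks extremal)
  3≤n : 3 ≤ n
  3≤n = ℕ.≤-trans (ℕ.≤-trans (s≤s (ℕ.+-mono-≤ 1≤k 1≤k)) (ℕ.≤-reflexive (sym 2k+1))) 2k+1≤n
  conclude : HamCycle G ⊎ (TwoCliques G 1 k m ⊎ (k ≡ m × Unbalanced G k (suc k))) →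
    Hamiltonian G ⊎ ((G ≅ L n k) ⊎ ((n ≡ 2 * k + 1) × 𝓗 G))
  conclude (inj₁ hc)        = inj₁ (hamCycle⇒Hamiltonian {G = G} 3≤n hc)
  conclude (inj₂ (inj₁ S))  = inj₂ (inj₁ (twoCliques-≅ S extremal))
  conclude (inj₂ (inj₂ (k≡m , U))) = inj₂ (inj₂ (trans n≡′ (sym 2k+1) , unbalanced⇒𝓗 a≡ b≡ U))
    where
    n≡′ : n ≡ suc (k + k)
    n≡′ = trans n≡ (cong (λ a → suc (k + a)) (sym k≡m))
    -- For odd n the roundings swap: `⌈ suc (k + k) /2⌉` computes to `suc ⌊ k + k /2⌋`, and
    -- `⌊ suc (k + k) /2⌋` is `⌈ k + k /2⌉` by definition.
    a≡ : k ≡ ⌈ n /2⌉ ∸ 1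
    a≡ = trans (ℕ.n≡⌊n+n/2⌋ k) (cong (λ a → ⌈ a /2⌉ ∸ 1) (sym n≡′))
    b≡ : suc k ≡ ⌊ n /2⌋ + 1
    b≡ = trans (ℕ.+-comm 1 k) (cong (_+ 1) (trans (ℕ.n≡⌈n+n/2⌉ k) (cong ⌊_/2⌋ (sym n≡′))))

theorem1p6 : (k n : ℕ) (G : Graph n) →
    (δ G ≥ k → k ≥ 0 → n ≥ 2 * k + 2 →
    (∀ r s → IsSpectralRadius (complement G) r →
    IsSpectralRadius (complement (Lᵤ n k)) s → r ≤ᴿ s →
    Traceable G ⊎ ((G ≅ Lᵤ n k) ⊎ ((n ≡ 2 * k + 2) × 𝓗 G))))
    ×
    (δ G ≥ k → k ≥ 1 → n ≥ 2 * k + 1 →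
    (∀ r s → IsSpectralRadius (complement G) r →
    IsSpectralRadius (complement (L n k)) s → r ≤ᴿ s →
    Hamiltonian G ⊎ ((G ≅ L n k) ⊎ ((n ≡ 2 * k + 1) × 𝓗 G))))
theorem1p6 k n G = (λ k≤δ _ → traceable-part k G k≤δ) , hamiltonian-part k G
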